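{- Let $q$ be a prime power, in the setting of the context. Let $\mathcal{C}$ be the set of planes of $V$ obtained from $\mathcal{L}=\{\Gamma_f:f\in\mathcal{G}\}$ by removing all planes $\Gamma_f$ with $f\in\mathcal{R}$ and adding all planes of the form $N(Z,\mathbb{F}_q(ab^q-a^qb),f|_Z)$, where $Z=\langle a,b\rangle$ ranges over the $2$-dimensional $\mathbb{F}_q$-subspaces of $W$ and $f$ ranges over $\mathcal{R}$. Then $\mathcal{C}$ is a plane subspace code of size $\#\mathcal{C}=q^8+q^3+q^2$. Moreover, $\mathcal{C}$ can be augmented by $q^4+q^3+2q^2+q+1$ further planes, each meeting $S$ in a $2$-dimensional subspace, to a plane subspace code $\widehat{\mathcal{C}}$ of size $q^8+q^4+2q^3+3q^2+q+1$.
   Context: $\mathbb{F}_{q^4}$ is viewed as a $4$-dimensional $\mathbb{F}_q$-space. $W=\{x\in\mathbb{F}_{q^4}:x+x^q+x^{q^2}+x^{q^3}=0\}$, $V=W\times\mathbb{F}_{q^4}$ (a $7$-dimensional $\mathbb{F}_q$-space), $S=\{0\}\times\mathbb{F}_{q^4}$. Planes are $3$-dimensional $\mathbb{F}_q$-subspaces; a plane subspace code is a set of planes of $V$ pairwise intersecting in dimension at most $1$. For $\mathbb{F}_q$-linear $f\colon W\to\mathbb{F}_{q^4}$, $\Gamma_f=\{(x,f(x)):x\in W\}$. $\mathcal{G}=\{x\mapsto a_0x+a_1x^q:a_0,a_1\in\mathbb{F}_{q^4}\}$ and $\mathcal{R}=\{x\mapsto ax^q-a^qx: a\in\mathbb{F}_{q^4}\}$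 (maps $W\to\mathbb{F}_{q^4}$). For an $\mathbb{F}_q$-subspace $Z\subseteq W$, an $\mathbb{F}_q$-subspace $T\subseteq\mathbb{F}_{q^4}$ and $\mathbb{F}_q$-linear $g\colon Z\to\mathbb{F}_{q^4}$, $N(Z,T,g)=\{(x,g(x)+y):x\in Z,y\in T\}$. -}

module Defs where

open import Level using (0ℓ)
open import Data.Nat as ℕ using (ℕ; zero; suc)
open import Data.Nat.Primality using (Prime)
open import Data.Fin using (Fin; zero; suc)
open import Data.Product using (Σ; ∃; _×_; _,_; proj₁; proj₂)
open import Data.Sum using (_⊎_)
open import Relation.Binary.PropositionalEquality using (_≡_; _≢_)
open import Relation.Nullary using (¬_)
open import Function.Bundles using (_⤖_; _⇔_)
open import Algebra.Structures using (IsCommutativeRing)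

IsPrimePower : ℕ → Set
IsPrimePower q = Σ ℕ λ p → Σ ℕ λ k → Prime p × q ≡ p ℕ.^ suc k

record FiniteField (n : ℕ) : Set₁ where
  field
    Carrier  : Set
    _+_ _*_  : Carrier → Carrier → Carrier
    -_       : Carrier → Carrier
    0# 1#    : Carrier
    isCommutativeRing : IsCommutativeRing _≡_ _+_ _*_ -_ 0# 1#
    0≢1      : 0# ≢ 1#
    inverse  : ∀ x → x ≢ 0# → Σ Carrier λ y → x * y ≡ 1#
    enum     : Fin n ⤖ Carrier

-- The construction of the paper, for a finite field K of order q^4
-- (so K is F_{q^4}) and F_q = { x ∈ K : x^q = x }.
module Construction {n : ℕ} (K : FiniteField n) (q : ℕ) where
  open FiniteField K

  _-ᴷ_ : Carrier → Carrier → Carrier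
  x -ᴷ y = x + (- y)

  _^ᴷ_ : Carrier → ℕ → Carrier
  x ^ᴷ zero  = 1#
  x ^ᴷ suc k = x * (x ^ᴷ k)

  Fq : Carrier → Set
  Fq c = c ^ᴷ q ≡ c

  -- W = kernel of the trace F_{q^4} → F_q
  W : Carrier → Set
  W x = (((x + (x ^ᴷ q)) + (x ^ᴷ (q ℕ.^ 2))) + (x ^ᴷ (q ℕ.^ 3))) ≡ 0#

  -- ambient space: pairs (x , y) with x ∈ W  (V = W × F_{q^4})
  Vec2 : Set
  Vec2 = Carrier × Carrier

  VSet : Set₁
  VSet = Vec2 → Set

  _⊕_ : Vec2 → Vec2 → Vec2
  (x , y) ⊕ (x' , y') = (x + x') , (y + y')

  _·_ : Carrier → Vec2 → Vec2
  c · (x , y) = (c * x) , (c * y)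

  𝟘 : Vec2
  𝟘 = 0# , 0#

  lincomb : (m : ℕ) → (Fin m → Carrier) → (Fin m → Vec2) → Vec2
  lincomb zero    c v = 𝟘
  lincomb (suc m) c v = (c zero · v zero) ⊕ lincomb m (λ i → c (suc i)) (λ i → v (suc i))

  Independent : (m : ℕ) → (Fin m → Vec2) → Set
  Independent m v = (c : Fin m → Carrier) → (∀ i → Fq (c i)) →
                    lincomb m c v ≡ 𝟘 → ∀ i → c i ≡ 0#

  InSpan : (m : ℕ) → (Fin m → Vec2) → Vec2 → Set
  InSpan m v w = Σ (Fin m → Carrier) λ c → (∀ i → Fq (c i)) × w ≡ lincomb m c v

  _≐_ : VSet → VSet → Set
  P ≐ Q = ∀ w → (P w ⇔ Q w)

  _∩_ : VSet → VSet → VSet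
  (P ∩ Q) w = P w × Q w

  IsSubspaceOfDim : VSet → ℕ → Set
  IsSubspaceOfDim P m = Σ (Fin m → Vec2) λ b →
    (∀ i → W (proj₁ (b i))) × Independent m b × P ≐ InSpan m b

  Plane : VSet → Set
  Plane P = IsSubspaceOfDim P 3

  S : VSet
  S (x , y) = x ≡ 0#

  Family : Set₁
  Family = VSet → Set

  IsPlaneCode : Family → Set₁
  IsPlaneCode 𝒞 = (∀ P → 𝒞 P → Plane P) ×
    (∀ P Q → 𝒞 P → 𝒞 Q → ¬ (P ≐ Q) →
       Σ ℕ λ k → (k ℕ.≤ 1) × IsSubspaceOfDim (P ∩ Q) k)

  HasSize : Family → ℕ → Set₁
  HasSize 𝒞 m = Σ (Fin m → VSet) λ L →
    (∀ i → 𝒞 (L i)) ×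
    (∀ i j → L i ≐ L j → i ≡ j) ×
    (∀ P → 𝒞 P → Σ (Fin m) λ i → P ≐ L i)

  Γ : (Carrier → Carrier) → VSet
  Γ f (x , y) = W x × y ≡ f x

  gmap : Carrier → Carrier → Carrier → Carrier
  gmap a₀ a₁ x = (a₀ * x) + (a₁ * (x ^ᴷ q))

  rmap : Carrier → Carrier → Carrier
  rmap a x = (a * (x ^ᴷ q)) -ᴷ ((a ^ᴷ q) * x)

  InR : (Carrier → Carrier) → Set
  InR f = Σ Carrier λ a → ∀ x → W x → f x ≡ rmap a x

  Indep₂ : Carrier → Carrier → Set
  Indep₂ a b = ∀ c d → Fq c → Fq d → (c * a) + (d * b) ≡ 0# → (c ≡ 0#) × (d ≡ 0#)

  Span₂ : Carrier → Carrier → Carrier → Set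
  Span₂ a b x = Σ Carrier λ c → Σ Carrier λ d → Fq c × Fq d × x ≡ (c * a) + (d * b)

  Line : Carrier → Carrier → Set
  Line t y = Σ Carrier λ c → Fq c × y ≡ c * t

  N : (Carrier → Set) → (Carrier → Set) → (Carrier → Carrier) → VSet
  N Z T g w = Σ Carrier λ x → Σ Carrier λ y → Z x × T y × w ≡ (x , (g x + y))

  𝒞 : Family
  𝒞 P =
    (Σ Carrier λ a₀ → Σ Carrier λ a₁ → ¬ InR (gmap a₀ a₁) × P ≐ Γ (gmap a₀ a₁))
    ⊎
    (Σ Carrier λ a → Σ Carrier λ b → Σ Carrier λ r →
       W a × W b × Indep₂ a b ×
       P ≐ N (Span₂ a b) (Line ((a * (b ^ᴷ q)) -ᴷ ((a ^ᴷ q) * b))) (rmap r))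

  augment : {m : ℕ} → (Fin m → VSet) → Family
  augment D P = 𝒞 P ⊎ Σ (Fin _) λ i → P ≐ D i

{-# OPTIONS --safe #-}
module Submission where

-- W is three-dimensional over 𝔽 = F_q, so every element of Λ²W is decomposable and a ∧ b ↦ a b^q − a^q b embeds Λ²W into K.
-- Its image U has one point T_Z for every 2-dimensional Z ⊂ W. In coordinates Λ²W ≅ 𝔽³ by the cross product.
-- Two planes of 𝒞 with two independent common vectors coincide; the key case is Γ_f and N(Z,T,g), where these vectors force
-- f − g to map Z into T, and then f − g ∈ ℛ by interpolation on Z.
-- The additional planes are ⟨(x,y)⟩ + {0} × T, where every 2-dimensional T ⊂ K is used exactly once:
-- a line T of U is {r x^q − r^q x : r ∈ W} for a point x of W, and is taken with this x and y = e₀ x^{q+1},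
-- which lies outside {r x^q − r^q x : r ∈ K} as Tr(e₀) ≠ 0;
-- the q² lines T ⊄ U through T_Z are taken with a point x ∉ Z, where Z ↦ x is a bijection, and with y = θ(κ) when
-- T = ⟨T_Z, e′ + κ⟩ with κ in the complement {r x^q − r^q x : r ∈ W} of T_Z in U. As θ has no eigenvalue, planes with the same x
-- meet in dimension at most 1.

open import Level using (0ℓ)
open import Algebra.Bundles using (CommutativeRing)
import Algebra.Properties.AbelianGroup
import Algebra.Properties.CommutativeMonoid.Sum
import Algebra.Properties.CommutativeSemiring.Binomial
import Algebra.Properties.CommutativeSemiring.Exp
import Algebra.Properties.Ring
import Algebra.Properties.Semiring.Mult
import Algebra.Properties.Semiring.Mult.TCOptimised
import Algebra.Solver.Ring
open import Algebra.Solver.Ring.AlmostCommutativeRing using (fromCommutativeRing; _-Raw-AlmostCommutative⟶_)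
open import Axiom.UniquenessOfIdentityProofs using (module Decidable⇒UIP)
open import Data.Empty using (⊥; ⊥-elim)
open import Data.Fin as Fin using (Fin; zero; suc; toℕ; inject₁; fromℕ)
open import Data.Fin.Permutation using (↔⇒≡)
import Data.Fin.Properties as Fin
open import Data.Integer as ℤ using (ℤ)
import Data.Integer.Properties as ℤ
open import Data.Maybe using (Maybe; just; nothing)
open import Data.Nat as ℕ using (ℕ; zero; suc; _!; _∸_)
open import Data.Nat.Combinatorics using (_C_; nCn≡1; nCk≡n!/k![n-k]!; k![n∸k]!∣n!)
open import Data.Nat.DivMod using (m/n*n≡m)
open import Data.Nat.Divisibility using (_∣_; divides; ∣⇒≤; m∣m*n)
open import Data.Nat.Primality using (Prime; euclidsLemma; prime⇒nonZero; prime⇒nonTrivial; ¬prime[0]; ¬prime[1])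
import Data.Nat.Properties as ℕ
import Data.Nat.Solver
open import Data.Product using (Σ; ∃; _×_; _,_; proj₁; proj₂)
open import Data.Product.Function.NonDependent.Propositional using (_×-↔_)
open import Data.Sign using (Sign)
open import Data.Sum using (_⊎_; inj₁; inj₂; [_,_]′)
open import Data.Sum.Function.Propositional using (_⊎-↔_)
open import Data.Unit using (⊤; tt)
open import Function.Base using (_∘_; id)
open import Function.Bundles using (_↔_; mk⇔; mk↔ₛ′; Equivalence; Inverse)
open import Function.Construct.Composition using (_↔-∘_)
open import Function.Construct.Symmetry using (↔-sym)
open import Function.Definitions using (Injective)
open import Function.Properties.Bijection using (⤖⇒↔)
open import Relation.Binary.Definitions using (DecidableEquality)
open import Relation.Binary.PropositionalEquality using (_≡_; _≢_; refl; sym; trans; cong; cong₂; subst; module ≡-Reasoning)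
import Relation.Binary.Reasoning.Setoid
open import Relation.Nullary using (¬_; Dec; yes; no; contradiction)
open import Relation.Nullary.Decidable using (decidable-stable; map′; _×-dec_; ¬?)
open import Relation.Unary using (Decidable)
open import Defs

-- Two distinct planes of a code cannot meet S in the same 2-dimensional T, so such planes number at
-- most the lines of PG(3,q), which are (q²+1)(q²+q+1) = q⁴+q³+2q²+q+1. The augmentation reaches
-- this bound, which is why every T must be used. The size of 𝒞 is (q⁴-1)q⁴ + (q²+q+1)q². The last
-- factor q² is the order of K/Z: for m ∈ Z the map x ↦ m x^q - m^q x sends Z into T_Z, so a plane N
-- over Z depends on r only modulo Z. The obstacle to augmenting is a plane N over Z that contains
-- T_Z and also a vector over x ∈ Z. If T ⊄ U, then T contains a single T_Z, and keeping x off Z is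
-- enough. If T ⊂ U, then T contains T_Z for all Z through one point of W, and every x in W lies in
-- one of these Z, so the choice of x cannot help. With x equal to that common point, all vectors
-- over x that combine T with a plane N through T_Z have second component in the 3-dimensional image
-- of r ↦ r x^q - r^q x, and it is y that avoids it.

-- Integer coefficients for ring identities.

module IntegerCoefficients (R : CommutativeRing 0ℓ 0ℓ) where
  open import Data.Integer using (+_; -[1+_]; _⊖_; _◃_)
  open CommutativeRing R renaming (refl to ≈-refl; sym to ≈-sym; trans to ≈-trans)
  open Algebra.Properties.Ring ring using (-‿distribˡ-*; -‿distribʳ-*; -‿involutive; -0#≈0#)
  open Algebra.Properties.AbelianGroup +-abelianGroup using (⁻¹-∙-comm)
  open Algebra.Properties.Semiring.Mult.TCOptimised semiring using (×1-homo-*; 1+×; ×-homo-+) renaming (_×_ to _•_)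
  open Relation.Binary.Reasoning.Setoid setoid

  fromℤ : ℤ → Carrier
  fromℤ (+ n)    = n • 1#
  fromℤ -[1+ n ] = - (suc n • 1#)

  fromℤ-⊖ : ∀ m n → fromℤ (m ⊖ n) ≈ m • 1# + - (n • 1#)
  fromℤ-⊖ zero zero = ≈-sym (-‿inverseʳ 0#)
  fromℤ-⊖ zero (suc n) = ≈-sym (+-identityˡ _)
  fromℤ-⊖ (suc m) zero = ≈-sym (≈-trans (+-congˡ -0#≈0#) (+-identityʳ _))
  fromℤ-⊖ (suc m) (suc n) rewrite ℤ.[1+m]⊖[1+n]≡m⊖n m n = begin
    fromℤ (m ⊖ n)                          ≈⟨ fromℤ-⊖ m n ⟩
    m • 1# + - (n • 1#)                    ≈⟨ +-congʳ (≈-sym (+-identityˡ _)) ⟩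
    (0# + m • 1#) + - (n • 1#)             ≈⟨ +-congʳ (+-congʳ (≈-sym (-‿inverseʳ 1#))) ⟩
    ((1# + - 1#) + m • 1#) + - (n • 1#)    ≈⟨ +-congʳ (≈-trans (+-assoc _ _ _) (≈-trans (+-congˡ (+-comm _ _)) (≈-sym (+-assoc _ _ _)))) ⟩
    ((1# + m • 1#) + - 1#) + - (n • 1#)    ≈⟨ +-assoc _ _ _ ⟩
    (1# + m • 1#) + (- 1# + - (n • 1#))    ≈⟨ +-cong (≈-sym (1+× m 1#)) (≈-trans (⁻¹-∙-comm _ _) (-‿cong (≈-sym (1+× n 1#)))) ⟩
    suc m • 1# + - (suc n • 1#)            ∎

  fromℤ-+ : ∀ i j → fromℤ (i ℤ.+ j) ≈ fromℤ i + fromℤ j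
  fromℤ-+ (+ m) (+ n) = ×-homo-+ 1# m n
  fromℤ-+ (+ m) -[1+ n ] = fromℤ-⊖ m (suc n)
  fromℤ-+ -[1+ m ] (+ n) = ≈-trans (fromℤ-⊖ n (suc m)) (+-comm _ _)
  fromℤ-+ -[1+ m ] -[1+ n ] = begin
    - (suc (suc (m ℕ.+ n)) • 1#)      ≡⟨ cong (λ k → - (suc k • 1#)) (ℕ.+-suc m n) ⟨
    - ((suc m ℕ.+ suc n) • 1#)        ≈⟨ -‿cong (×-homo-+ 1# (suc m) (suc n)) ⟩
    - (suc m • 1# + suc n • 1#)       ≈⟨ ⁻¹-∙-comm _ _ ⟨
    - (suc m • 1#) + - (suc n • 1#)   ∎

  fromℤ-−◃ : ∀ n → fromℤ (Sign.- ◃ n) ≈ - (n • 1#)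
  fromℤ-−◃ zero = ≈-sym -0#≈0#
  fromℤ-−◃ (suc n) = ≈-refl

  fromℤ-* : ∀ i j → fromℤ (i ℤ.* j) ≈ fromℤ i * fromℤ j
  fromℤ-* (+ m) (+ n) rewrite ℤ.+◃n≡+n (m ℕ.* n) = ×1-homo-* m n
  fromℤ-* (+ m) -[1+ n ] = ≈-trans (fromℤ-−◃ (m ℕ.* suc n))
    (≈-trans (-‿cong (×1-homo-* m (suc n))) (-‿distribʳ-* _ _))
  fromℤ-* -[1+ m ] (+ n) = ≈-trans (fromℤ-−◃ (suc m ℕ.* n))
    (≈-trans (-‿cong (×1-homo-* (suc m) n)) (-‿distribˡ-* _ _))
  fromℤ-* -[1+ m ] -[1+ n ] = begin
    (suc m ℕ.* suc n) • 1#                  ≈⟨ ×1-homo-* (suc m) (suc n) ⟩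
    (suc m • 1#) * (suc n • 1#)             ≈⟨ -‿involutive _ ⟨
    - (- ((suc m • 1#) * (suc n • 1#)))     ≈⟨ -‿cong (-‿distribʳ-* _ _) ⟩
    - ((suc m • 1#) * - (suc n • 1#))       ≈⟨ -‿distribˡ-* _ _ ⟩
    - (suc m • 1#) * - (suc n • 1#)         ∎

  fromℤ-- : ∀ i → fromℤ (ℤ.- i) ≈ - fromℤ i
  fromℤ-- (+ zero) = ≈-sym -0#≈0#
  fromℤ-- (+ suc n) = ≈-refl
  fromℤ-- -[1+ n ] = ≈-sym (-‿involutive _)

  homomorphism : ℤ.+-*-rawRing -Raw-AlmostCommutative⟶ fromCommutativeRing R
  homomorphism = record
    { ⟦_⟧ = fromℤ ; +-homo = fromℤ-+ ; *-homo = fromℤ-* ; -‿homo = fromℤ--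
    ; 0-homo = ≈-refl ; 1-homo = ≈-refl }

  -- Distinct integers may have equal images in positive characteristic, so inequality in ℤ yields
  -- `nothing` and no refutation.
  coefficient≟ : ∀ i j → Maybe (fromℤ i ≈ fromℤ j)
  coefficient≟ i j with i ℤ.≟ j
  ... | yes refl = just ≈-refl
  ... | no _     = nothing

  open Algebra.Solver.Ring ℤ.+-*-rawRing (fromCommutativeRing R) homomorphism coefficient≟ public
    using (solve; _:=_; _:+_; _:*_; _:-_; :-_; con; Polynomial)

-- Finite sets, pigeonhole arguments and counting of subsets.

module FiniteType {n : ℕ} {A : Set} (count : Fin n ↔ A) where
  open Inverse count using (to; from; strictlyInverseˡ; strictlyInverseʳ)

  from-injective : ∀ {x y} → from x ≡ from y → x ≡ y
  from-injective {x} {y} eq = trans (sym (strictlyInverseˡ x)) (trans (cong to eq) (strictlyInverseˡ y))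

  to-injective : ∀ {i j} → to i ≡ to j → i ≡ j
  to-injective {i} {j} eq = trans (sym (strictlyInverseʳ i)) (trans (cong from eq) (strictlyInverseʳ j))

  infix 4 _≟_
  _≟_ : DecidableEquality A
  x ≟ y = map′ from-injective (cong from) (from x Fin.≟ from y)

  exists? : ∀ {ℓ} {P : A → Set ℓ} → Decidable P → Dec (∃ P)
  exists? {P = P} P? = map′ (λ (i , p) → to i , p)
    (λ (x , p) → from x , subst P (sym (strictlyInverseˡ x)) p) (Fin.any? (P? ∘ to))

  -- Hedberg's theorem. Subsets cut out by equations, such as F_q and W, then have elements
  -- determined by their first component.
  ≡-irrelevant : ∀ {x y : A} (p q : x ≡ y) → p ≡ q
  ≡-irrelevant = Decidable⇒UIP.≡-irrelevant _≟_

  missed? : ∀ {B : Set} {m} → Fin m ↔ B → (f : B → A) → Dec (∃ λ x → ∀ b → f b ≢ x)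
  missed? count-B f = exists? λ x → map′
    (λ h b eq → h (Inverse.from count-B b) (trans (cong f (Inverse.strictlyInverseˡ count-B b)) eq))
    (λ h i → h (Inverse.to count-B i))
    (Fin.all? λ i → map′ (λ h → h) (λ h → h) (¬?-≡ (f (Inverse.to count-B i)) x))
    where
    ¬?-≡ : ∀ x y → Dec (x ≢ y)
    ¬?-≡ x y with x ≟ y
    ... | yes p = no λ h → h p
    ... | no h = yes h

module _ {m n : ℕ} {A B : Set} (count-A : Fin m ↔ A) (count-B : Fin n ↔ B) where
  private
    module A = FiniteType count-A
    module B = FiniteType count-B
    toA = Inverse.to count-A
    fromB = Inverse.from count-B

  injective⇒≤ : {f : A → B} → Injective _≡_ _≡_ f → m ℕ.≤ n
  injective⇒≤ {f} inj = Fin.injective⇒≤ {f = fromB ∘ f ∘ toA} (A.to-injective ∘ inj ∘ B.from-injective)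

  preimage : (f : A → B) → ¬ (∃ λ y → ∀ x → f x ≢ y) → ∀ y → ∃ λ x → f x ≡ y
  preimage f none y with A.exists? (λ x → f x B.≟ y)
  ... | yes found = found
  ... | no ¬found = contradiction (y , λ x eq → ¬found (x , eq)) none

module _ {m n : ℕ} {A B : Set} (count-A : Fin m ↔ A) (count-B : Fin n ↔ B) where

  -- If nothing were missed, a choice of preimages would inject the larger set into the smaller.
  -- Since being missed is decidable, the contradiction turns into a witness.
  <⇒missed : m ℕ.< n → (f : A → B) → ∃ λ y → ∀ x → f x ≢ y
  <⇒missed m<n f with FiniteType.missed? count-B count-A f
  ... | yes found = found
  ... | no none = contradiction (injective⇒≤ count-B count-A {proj₁ ∘ g} g-inj) (ℕ.<⇒≱ m<n)
    where
    g = preimage count-A count-B f none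
    g-inj : ∀ {x y} → proj₁ (g x) ≡ proj₁ (g y) → x ≡ y
    g-inj {x} {y} eq = trans (sym (proj₂ (g x))) (trans (cong f eq) (proj₂ (g y)))

extend : ∀ {n} {A : Set} {B : Set} → Fin n ↔ A → (A → B) → B → Fin (suc n) → B
extend count-A f b zero = b
extend count-A f b (suc i) = f (Inverse.to count-A i)

-- A missed `y` could be added as one more value, which would inject n + 1 elements into n.
injective⇒surjective : ∀ {n} {A B : Set} → Fin n ↔ A → Fin n ↔ B → {f : A → B} →
  Injective _≡_ _≡_ f → ∀ y → ∃ λ x → f x ≡ y
injective⇒surjective {n} {A} {B} count-A count-B {f} inj = preimage count-A count-B f λ (y , miss) →
  contradiction (Fin.injective⇒≤ {f = Inverse.from count-B ∘ extend count-A f y} (λ {i} {j} eq → extend-injective y miss i j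
      (FiniteType.from-injective count-B eq))) ℕ.1+n≰n
  where
  extend-injective : ∀ y → (∀ x → f x ≢ y) → ∀ i j → extend count-A f y i ≡ extend count-A f y j → i ≡ j
  extend-injective y miss zero zero _ = refl
  extend-injective y miss zero (suc j) eq = contradiction (sym eq) (miss _)
  extend-injective y miss (suc i) zero eq = contradiction eq (miss _)
  extend-injective y miss (suc i) (suc j) eq = cong suc (FiniteType.to-injective count-A (inj eq))

-- A section of `f` is injective, hence onto, and therefore a two-sided inverse of `f`.
surjective⇒injective : ∀ {n} {A : Set} → Fin n ↔ A → {f : A → A} →
  (∀ y → ∃ λ x → f x ≡ y) → Injective _≡_ _≡_ f
surjective⇒injective count-A {f} surj {x} {y} eq =
  trans (sym (proj₂ (hit x))) (trans (cong (proj₁ ∘ surj) images-equal) (proj₂ (hit y)))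
  where
  section-injective : Injective _≡_ _≡_ (proj₁ ∘ surj)
  section-injective {u} {v} e = trans (sym (proj₂ (surj u))) (trans (cong f e) (proj₂ (surj v)))
  hit = injective⇒surjective count-A count-A section-injective
  image : ∀ z → proj₁ (hit z) ≡ f z
  image z = trans (sym (proj₂ (surj (proj₁ (hit z))))) (cong f (proj₂ (hit z)))
  images-equal = trans (image x) (trans eq (sym (image y)))

subset-count : ∀ n {P : Fin n → Set} → Decidable P → (∀ {i} (p q : P i) → p ≡ q) → ∃ λ m → Fin m ↔ Σ (Fin n) P
subset-count zero P? irr = 0 , mk↔ₛ′ (λ ()) (λ ()) (λ ()) (λ ())
subset-count (suc n) {P} P? irr with subset-count n (P? ∘ suc) irr | P? zero
... | m , I | yes p = suc m , mk↔ₛ′ to′ from′ inv₁ inv₂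
  where
  open Inverse I
  to′ : Fin (suc m) → Σ (Fin (suc n)) P
  to′ zero = zero , p
  to′ (suc i) = suc (proj₁ (to i)) , proj₂ (to i)
  from′ : Σ (Fin (suc n)) P → Fin (suc m)
  from′ (zero , _) = zero
  from′ (suc i , q) = suc (from (i , q))
  inv₁ : ∀ x → to′ (from′ x) ≡ x
  inv₁ (zero , q) = cong (zero ,_) (irr p q)
  inv₁ (suc i , q) = cong (λ (j , r) → suc j , r) (strictlyInverseˡ (i , q))
  inv₂ : ∀ x → from′ (to′ x) ≡ x
  inv₂ zero = refl
  inv₂ (suc i) = cong suc (strictlyInverseʳ i)
... | m , I | no ¬p = m , mk↔ₛ′ (λ i → suc (proj₁ (to i)) , proj₂ (to i)) from′ inv₁ strictlyInverseʳ
  where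
  open Inverse I
  from′ : Σ (Fin (suc n)) P → Fin m
  from′ (zero , q) = ⊥-elim (¬p q)
  from′ (suc i , q) = from (i , q)
  inv₁ : ∀ x → (suc (proj₁ (to (from′ x))) , proj₂ (to (from′ x))) ≡ x
  inv₁ (zero , q) = ⊥-elim (¬p q)
  inv₁ (suc i , q) = cong (λ (j , r) → suc j , r) (strictlyInverseˡ (i , q))

subtype-count : ∀ {n} {A : Set} → Fin n ↔ A → {P : A → Set} → Decidable P → (∀ {x} (p q : P x) → p ≡ q) →
  ∃ λ m → Fin m ↔ Σ A P
subtype-count {n} {A} I {P} P? irr with subset-count n (P? ∘ Inverse.to I) irr
... | m , J = m , mk↔ₛ′
  (λ i → to (proj₁ (Inverse.to J i)) , proj₂ (Inverse.to J i))
  (λ (x , p) → Inverse.from J (pull x p))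
  (λ (x , p) → trans (cong push (Inverse.strictlyInverseˡ J (pull x p))) (Σ-≡ (strictlyInverseˡ x)))
  (λ i → trans (cong (Inverse.from J) (Σ-≡′ (strictlyInverseʳ _))) (Inverse.strictlyInverseʳ J i))
  where
  open Inverse I
  Σ-≡ : ∀ {x y : A} {p : P x} {q : P y} → x ≡ y → (x , p) ≡ (y , q)
  Σ-≡ {p = p} {q} refl = cong (_ ,_) (irr p q)
  Σ-≡′ : ∀ {i j} {p : P (to i)} {q : P (to j)} → i ≡ j → _≡_ {A = Σ (Fin n) (P ∘ to)} (i , p) (j , q)
  Σ-≡′ {p = p} {q} refl = cong (_ ,_) (irr p q)
  pull : ∀ x → P x → Σ (Fin n) (P ∘ to)
  pull x p = from x , subst P (sym (strictlyInverseˡ x)) p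
  push : Σ (Fin n) (P ∘ to) → Σ A P
  push (i , p) = to i , p

-- Arithmetic in a finite field.

module Field {n : ℕ} (K : FiniteField n) where

  commutativeRing : CommutativeRing 0ℓ 0ℓ
  commutativeRing = record { isCommutativeRing = FiniteField.isCommutativeRing K }

  open CommutativeRing commutativeRing public
    using (Carrier; _+_; _*_; -_; 0#; 1#; +-comm; +-assoc; +-identityˡ; +-identityʳ; *-comm; *-assoc;
           *-identityˡ; *-identityʳ; zeroˡ; zeroʳ; -‿inverseʳ; -‿inverseˡ; distribˡ; distribʳ)
  open IntegerCoefficients commutativeRing public
    using (solve; _:=_; _:+_; _:*_; _:-_; :-_; con; Polynomial)

  0≢1 : 0# ≢ 1#
  0≢1 = FiniteField.0≢1 K

  count-K : Fin n ↔ Carrier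
  count-K = ⤖⇒↔ (FiniteField.enum K)

  open FiniteType count-K public

  infixl 6 _-_
  _-_ : Carrier → Carrier → Carrier
  x - y = x + (- y)

  x-y≡0⇒x≡y : ∀ {x y} → x - y ≡ 0# → x ≡ y
  x-y≡0⇒x≡y {x} {y} eq = trans (solve 2 (λ x y → x := x :- y :+ y) refl x y)
    (trans (cong (_+ y) eq) (+-identityˡ y))

  x≡y⇒x-y≡0 : ∀ {x y} → x ≡ y → x - y ≡ 0#
  x≡y⇒x-y≡0 refl = -‿inverseʳ _

  infix 8 _⁻¹
  -- Total, with the default `0#` at zero, so that quotients can be written without a proof that the
  -- denominator is nonzero.
  _⁻¹ : Carrier → Carrier
  x ⁻¹ with x ≟ 0#
  ... | yes _ = 0#
  ... | no x≢0 = proj₁ (FiniteField.inverse K x x≢0)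

  x*x⁻¹≡1 : ∀ {x} → x ≢ 0# → x * x ⁻¹ ≡ 1#
  x*x⁻¹≡1 {x} x≢0 with x ≟ 0#
  ... | yes x≡0 = contradiction x≡0 x≢0
  ... | no x≢0 = proj₂ (FiniteField.inverse K x x≢0)

  x*[x⁻¹*y]≡y : ∀ {x y} → x ≢ 0# → x * (x ⁻¹ * y) ≡ y
  x*[x⁻¹*y]≡y {x} {y} x≢0 = trans (sym (*-assoc x _ y)) (trans (cong (_* y) (x*x⁻¹≡1 x≢0)) (*-identityˡ y))

  x⁻¹*[x*y]≡y : ∀ {x y} → x ≢ 0# → x ⁻¹ * (x * y) ≡ y
  x⁻¹*[x*y]≡y {x} {y} x≢0 = trans (solve 3 (λ x i y → i :* (x :* y) := x :* (i :* y)) refl x (x ⁻¹) y) (x*[x⁻¹*y]≡y x≢0)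

  *-cancelˡ : ∀ {x y z} → x ≢ 0# → x * y ≡ x * z → y ≡ z
  *-cancelˡ {x} x≢0 eq = trans (sym (x⁻¹*[x*y]≡y x≢0)) (trans (cong (x ⁻¹ *_) eq) (x⁻¹*[x*y]≡y x≢0))

  x*y≡0⇒y≡0 : ∀ {x y} → x ≢ 0# → x * y ≡ 0# → y ≡ 0#
  x*y≡0⇒y≡0 {x} x≢0 eq = *-cancelˡ x≢0 (trans eq (sym (zeroʳ x)))

  x*y≢0 : ∀ {x y} → x ≢ 0# → y ≢ 0# → x * y ≢ 0#
  x*y≢0 x≢0 y≢0 eq = y≢0 (x*y≡0⇒y≡0 x≢0 eq)

-- The Frobenius endomorphism.

prime∤! : ∀ {p} → Prime p → ∀ m → m ℕ.< p → ¬ (p ∣ m !)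
prime∤! {suc (suc p)} p-prime zero m<p p∣1 = ℕ.<⇒≱ (ℕ.s≤s (ℕ.s≤s ℕ.z≤n)) (∣⇒≤ p∣1)
prime∤! {suc zero} p-prime zero m<p p∣1 = ¬prime[1] p-prime
prime∤! p-prime (suc m) m<p p∣m! with euclidsLemma (suc m) (m !) p-prime p∣m!
... | inj₁ p∣m = ℕ.<⇒≱ m<p (∣⇒≤ p∣m)
... | inj₂ p∣m! = prime∤! p-prime m (ℕ.<-trans (ℕ.n<1+n m) m<p) p∣m!

-- The prime divides p! = C(p,k) · k! (p-k)!, but neither k! nor (p-k)!, whose factors are all
-- smaller than p.
prime∣C : ∀ {p} → Prime p → ∀ k → 0 ℕ.< k → k ℕ.< p → p ∣ p C k
prime∣C {p} p-prime k 0<k k<p with euclidsLemma (p C k) (k ! ℕ.* (p ∸ k) !) p-prime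
    (subst (p ∣_) (sym C*k!*[p-k]!≡p!) (p∣p! p (ℕ.<-trans 0<k k<p)))
  where
  instance _ = ℕ.m*n≢0 (k !) ((p ∸ k) !) ⦃ k ℕ.!≢0 ⦄ ⦃ (p ∸ k) ℕ.!≢0 ⦄
  C*k!*[p-k]!≡p! : (p C k) ℕ.* (k ! ℕ.* (p ∸ k) !) ≡ p !
  C*k!*[p-k]!≡p! = trans (cong (ℕ._* (k ! ℕ.* (p ∸ k) !)) (nCk≡n!/k![n-k]! (ℕ.<⇒≤ k<p)))
    (m/n*n≡m (k![n∸k]!∣n! (ℕ.<⇒≤ k<p)))
  p∣p! : ∀ p → 0 ℕ.< p → p ∣ p !
  p∣p! (suc p) _ = m∣m*n (p !)
... | inj₁ p∣C = p∣C
... | inj₂ p∣k!*[p-k]! with euclidsLemma (k !) ((p ∸ k) !) p-prime p∣k!*[p-k]!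
... | inj₁ p∣k! = contradiction p∣k! (prime∤! p-prime k k<p)
... | inj₂ p∣[p-k]! = contradiction p∣[p-k]! (prime∤! p-prime (p ∸ k) (ℕ.∸-monoʳ-< 0<k (ℕ.<⇒≤ k<p)))

module Frobenius {n : ℕ} (K : FiniteField n) where
  open Field K
  open CommutativeRing commutativeRing using (commutativeSemiring; semiring; +-commutativeMonoid; *-commutativeMonoid)
  open Algebra.Properties.CommutativeSemiring.Exp commutativeSemiring using (_^_; ^-homo-*; ^-assocʳ; ^-distrib-*) public
  open Algebra.Properties.Semiring.Mult semiring using (×1-homo-*; ×-assoc-*; ×-homo-1; ×-assocˡ; ×-comm-*) renaming (_×_ to _•_)
  open Algebra.Properties.CommutativeSemiring.Binomial commutativeSemiring using (theorem; binomialExpansion; binomialTerm)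
  module Sum = Algebra.Properties.CommutativeMonoid.Sum +-commutativeMonoid
  module Prod = Algebra.Properties.CommutativeMonoid.Sum *-commutativeMonoid
  open Inverse count-K using (to; from; strictlyInverseˡ; strictlyInverseʳ)
  open ≡-Reasoning

  reindex : (f g : Carrier → Carrier) → (∀ x → f (g x) ≡ x) → (∀ x → g (f x) ≡ x) → Fin n ↔ Fin n
  reindex f g fg gf = mk↔ₛ′ (from ∘ f ∘ to) (from ∘ g ∘ to)
    (λ i → trans (cong (from ∘ f) (strictlyInverseˡ _)) (trans (cong from (fg _)) (strictlyInverseʳ i)))
    (λ i → trans (cong (from ∘ g) (strictlyInverseˡ _)) (trans (cong from (gf _)) (strictlyInverseʳ i)))

  -- Translation by `1#` permutes the field, so the sum s of all elements satisfies s = s + n · 1.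
  order•1≡0 : n • 1# ≡ 0#
  order•1≡0 = begin
    n • 1#                        ≡⟨ solve 2 (λ s m → m := (s :+ m) :- s) refl s (n • 1#) ⟩
    (s + n • 1#) - s              ≡⟨ cong (λ z → (s + z) - s) (Sum.sum-replicate n) ⟨
    (s + Sum.sum {n} (λ _ → 1#)) - s  ≡⟨ cong (_- s) (Sum.∑-distrib-+ to (λ _ → 1#)) ⟨
    Sum.sum (λ i → to i + 1#) - s ≡⟨ cong (_- s) (Sum.sum-cong-≗ (λ i → strictlyInverseˡ (to i + 1#))) ⟨
    Sum.sum (λ i → to (from (to i + 1#))) - s ≡⟨ cong (_- s) (Sum.sum-permute to shift) ⟨
    s - s                         ≡⟨ -‿inverseʳ s ⟩
    0# ∎
    where
    s = Sum.sum to
    shift = reindex (_+ 1#) (_- 1#) (λ x → solve 2 (λ x y → x :- y :+ y := x) refl x 1#)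
      (λ x → solve 2 (λ x y → x :+ y :- y := x) refl x 1#)

  -- The k-th power of p · 1 vanishes, and a field has no zero divisors.
  characteristic : ∀ p k → n ≡ p ℕ.^ k → p • 1# ≡ 0#
  characteristic p k n≡p^k = go k (trans (cong (_• 1#) (sym n≡p^k)) order•1≡0)
    where
    go : ∀ k → (p ℕ.^ k) • 1# ≡ 0# → p • 1# ≡ 0#
    go zero eq = contradiction (trans (sym eq) (×-homo-1 1#)) 0≢1
    go (suc k) eq with p • 1# ≟ 0#
    ... | yes p1≡0 = p1≡0
    ... | no p1≢0 = go k (x*y≡0⇒y≡0 p1≢0 (trans (sym (×1-homo-* p (p ℕ.^ k))) eq))

  module _ {p} (p-prime : Prime p) (p•1≡0 : p • 1# ≡ 0#) where

    p∣m⇒m•x≡0 : ∀ {m} → p ∣ m → ∀ x → m • x ≡ 0#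
    p∣m⇒m•x≡0 {m} (divides c refl) x = begin
      (c ℕ.* p) • x         ≡⟨ ×-assocˡ x c p ⟨
      c • (p • x)           ≡⟨ cong (c •_) (cong (p •_) (*-identityˡ x)) ⟨
      c • (p • (1# * x))    ≡⟨ cong (c •_) (×-assoc-* p 1# x) ⟨
      c • ((p • 1#) * x)    ≡⟨ cong (λ z → c • (z * x)) p•1≡0 ⟩
      c • (0# * x)          ≡⟨ ×-assoc-* c 0# x ⟨
      (c • 0#) * x          ≡⟨ cong (λ z → (c • z) * x) (zeroˡ 0#) ⟨
      (c • (0# * 0#)) * x   ≡⟨ cong (_* x) (×-comm-* c 0# 0#) ⟨
      (0# * (c • 0#)) * x   ≡⟨ cong (_* x) (zeroˡ _) ⟩
      0# * x                ≡⟨ zeroˡ x ⟩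
      0#                    ∎

    ^p-distrib-+ : ∀ x y → (x + y) ^ p ≡ x ^ p + y ^ p
    ^p-distrib-+ x y = trans (theorem p x y) (expand p refl)
      where
      expand : ∀ p′ → p ≡ p′ → binomialExpansion x y p′ ≡ x ^ p′ + y ^ p′
      expand zero eq = ⊥-elim (¬prime[0] (subst Prime eq p-prime))
      expand (suc m) refl = begin
        (p C 0) • (1# * y ^ p) + Sum.sum tail
          ≡⟨ cong₂ _+_ (trans (×-homo-1 _) (*-identityˡ _)) (Sum.sum-init-last tail) ⟩
        y ^ p + (Sum.sum (λ i → tail (inject₁ i)) + tail (fromℕ m))
          ≡⟨ cong₂ (λ a b → y ^ p + (a + b)) middle top ⟩
        y ^ p + (0# + x ^ p)
          ≡⟨ trans (cong (y ^ p +_) (+-identityˡ _)) (+-comm _ _) ⟩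
        x ^ p + y ^ p ∎
        where
        tail : Fin p → Carrier
        tail i = binomialTerm x y p (suc i)
        middle : Sum.sum (λ i → tail (inject₁ i)) ≡ 0#
        middle = trans (Sum.sum-cong-≗ λ i → p∣m⇒m•x≡0
          (prime∣C p-prime _ (ℕ.s≤s ℕ.z≤n) (ℕ.s≤s (subst (ℕ._< m) (sym (Fin.toℕ-inject₁ i)) (Fin.toℕ<n i)))) _)
          (Sum.sum-replicate-zero m)
        top : tail (fromℕ m) ≡ x ^ p
        top = begin
          (p C suc (toℕ (fromℕ m))) • (x ^ suc (toℕ (fromℕ m)) * y ^ (m ∸ toℕ (fromℕ m)))
            ≡⟨ cong (λ k → (p C suc k) • (x ^ suc k * y ^ (m ∸ k))) (Fin.toℕ-fromℕ m) ⟩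
          (p C p) • (x ^ p * y ^ (m ∸ m))
            ≡⟨ cong₂ (λ a b → a • (x ^ p * y ^ b)) (nCn≡1 p) (ℕ.n∸n≡0 m) ⟩
          1 • (x ^ p * 1#)
            ≡⟨ trans (×-homo-1 _) (*-identityʳ _) ⟩
          x ^ p ∎

    ^p^-distrib-+ : ∀ k x y → (x + y) ^ (p ℕ.^ k) ≡ x ^ (p ℕ.^ k) + y ^ (p ℕ.^ k)
    ^p^-distrib-+ zero x y = trans (*-identityʳ _) (sym (cong₂ _+_ (*-identityʳ _) (*-identityʳ _)))
    ^p^-distrib-+ (suc k) x y = begin
      (x + y) ^ (p ℕ.* p ℕ.^ k)                    ≡⟨ ^-assocʳ (x + y) p (p ℕ.^ k) ⟨
      ((x + y) ^ p) ^ (p ℕ.^ k)                    ≡⟨ cong (_^ (p ℕ.^ k)) (^p-distrib-+ x y) ⟩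
      (x ^ p + y ^ p) ^ (p ℕ.^ k)                  ≡⟨ ^p^-distrib-+ k (x ^ p) (y ^ p) ⟩
      (x ^ p) ^ (p ℕ.^ k) + (y ^ p) ^ (p ℕ.^ k)    ≡⟨ cong₂ _+_ (^-assocʳ x p (p ℕ.^ k)) (^-assocʳ y p (p ℕ.^ k)) ⟩
      x ^ (p ℕ.* p ℕ.^ k) + y ^ (p ℕ.* p ℕ.^ k)    ∎

  product≢0 : ∀ {m} (t : Fin m → Carrier) → (∀ i → t i ≢ 0#) → Prod.sum t ≢ 0#
  product≢0 {zero} t t≢0 eq = 0≢1 (sym eq)
  product≢0 {suc m} t t≢0 = x*y≢0 (t≢0 zero) (product≢0 (t ∘ suc) (t≢0 ∘ suc))

  -- The extra factor `x` makes up for the single entry `1#`, which keeps the exponent free of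
  -- subtraction.
  product-all-but-one : ∀ {m} (t : Fin m → Carrier) x i → t i ≡ 1# → (∀ j → j ≢ i → t j ≡ x) → x * Prod.sum t ≡ x ^ m
  product-all-but-one {suc m} t x zero ti≡1 t≡x = cong (x *_) (trans
    (cong₂ _*_ ti≡1 (trans (Prod.sum-cong-≗ (λ j → t≡x (suc j) λ ())) (Prod.sum-replicate m))) (*-identityˡ _))
  product-all-but-one {suc m} t x (suc i) ti≡1 t≡x = cong (x *_) (trans (cong (_* Prod.sum (t ∘ suc)) (t≡x zero λ ()))
    (product-all-but-one (t ∘ suc) x i ti≡1 λ j j≢i → t≡x (suc j) (j≢i ∘ Fin.suc-injective)))

  -- Multiplication by x ≠ 0 permutes the nonzero elements, so their product is unchanged when each
  -- is multiplied by x. To let the product run over the whole field, `unit` replaces zero by `1#`,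
  -- and `factor` records that this entry is not multiplied.
  x^n≡x : ∀ x → x ^ n ≡ x
  x^n≡x x with x ≟ 0#
  ... | yes refl = 0^ (from 0#)
    where
    0^ : ∀ {m} → Fin m → 0# ^ m ≡ 0#
    0^ {suc m} _ = zeroˡ _
  ... | no x≢0 = begin
    x ^ n            ≡⟨ product-all-but-one (λ i → factor (to i)) x (from 0#)
                          (trans (cong factor (strictlyInverseˡ 0#)) factor-0)
                          (λ j j≢ → factor-≢0 (to j) λ eq → j≢ (trans (sym (strictlyInverseʳ j)) (cong from eq))) ⟨
    x * Prod.sum (λ i → factor (to i)) ≡⟨ cong (x *_) product-factor≡1 ⟩
    x * 1#           ≡⟨ *-identityʳ x ⟩
    x                ∎
    where
    unit factor : Carrier → Carrier
    unit y with y ≟ 0#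
    ... | yes _ = 1#
    ... | no _  = y
    factor y with y ≟ 0#
    ... | yes _ = 1#
    ... | no _  = x
    unit≢0 : ∀ y → unit y ≢ 0#
    unit≢0 y with y ≟ 0#
    ... | yes _ = 0≢1 ∘ sym
    ... | no y≢0 = y≢0
    factor-0 : factor 0# ≡ 1#
    factor-0 with 0# ≟ 0#
    ... | yes _ = refl
    ... | no 0≢0 = contradiction refl 0≢0
    factor-≢0 : ∀ y → y ≢ 0# → factor y ≡ x
    factor-≢0 y y≢0 with y ≟ 0#
    ... | yes y≡0 = contradiction y≡0 y≢0
    ... | no _ = refl
    unit-x* : ∀ y → unit (x * y) ≡ factor y * unit y
    unit-x* y with y ≟ 0# | x * y ≟ 0#
    ... | yes _   | yes _   = sym (*-identityˡ 1#)
    ... | no y≢0  | no _    = refl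
    ... | yes refl | no xy≢0 = contradiction (zeroʳ x) xy≢0
    ... | no y≢0  | yes xy≡0 = contradiction xy≡0 (x*y≢0 x≢0 y≢0)
    scale = reindex (x *_) (x ⁻¹ *_) (λ y → x*[x⁻¹*y]≡y x≢0) (λ y → x⁻¹*[x*y]≡y x≢0)
    u = Prod.sum (unit ∘ to)
    product-factor≡1 : Prod.sum (λ i → factor (to i)) ≡ 1#
    product-factor≡1 = *-cancelˡ (product≢0 (unit ∘ to) (unit≢0 ∘ to)) (begin
      u * Prod.sum (λ i → factor (to i))              ≡⟨ *-comm _ _ ⟩
      Prod.sum (λ i → factor (to i)) * u              ≡⟨ Prod.∑-distrib-+ (factor ∘ to) (unit ∘ to) ⟨
      Prod.sum (λ i → factor (to i) * unit (to i))    ≡⟨ Prod.sum-cong-≗ (λ i → trans (cong unit (strictlyInverseˡ _)) (unit-x* (to i))) ⟨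
      Prod.sum (λ i → unit (to (from (x * to i))))    ≡⟨ Prod.sum-permute (unit ∘ to) scale ⟨
      u                                               ≡⟨ *-identityʳ u ⟨
      u * 1#                                          ∎)

module FrobeniusQ (q : ℕ) (q-primePower : IsPrimePower q) (K : FiniteField (q ℕ.^ 4)) where
  open Field K public
  open Frobenius K using (_^_; ^-distrib-*; ^-assocʳ; characteristic; ^p^-distrib-+; x^n≡x)
  open Construction K q using (_^ᴷ_)

  ^ᴷ≡^ : ∀ x m → x ^ᴷ m ≡ x ^ m
  ^ᴷ≡^ x zero = refl
  ^ᴷ≡^ x (suc m) = cong (x *_) (^ᴷ≡^ x m)

  φ : Carrier → Carrier
  φ x = x ^ᴷ q

  φ-+ : ∀ x y → φ (x + y) ≡ φ x + φ y
  φ-+ x y = trans (^ᴷ≡^ _ q) (trans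
    (subst (λ m → (x + y) ^ m ≡ x ^ m + y ^ m) (sym q≡p^)
      (^p^-distrib-+ p-prime (characteristic p (suc k ℕ.* 4) order≡) (suc k) x y))
    (sym (cong₂ _+_ (^ᴷ≡^ x q) (^ᴷ≡^ y q))))
    where
    p = proj₁ q-primePower
    k = proj₁ (proj₂ q-primePower)
    p-prime = proj₁ (proj₂ (proj₂ q-primePower))
    q≡p^ = proj₂ (proj₂ (proj₂ q-primePower))
    order≡ : q ℕ.^ 4 ≡ p ℕ.^ (suc k ℕ.* 4)
    order≡ = trans (cong (ℕ._^ 4) q≡p^) (ℕ.^-*-assoc p (suc k) 4)

  φ-* : ∀ x y → φ (x * y) ≡ φ x * φ y
  φ-* x y = trans (^ᴷ≡^ _ q) (trans (^-distrib-* x y q) (sym (cong₂ _*_ (^ᴷ≡^ x q) (^ᴷ≡^ y q))))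

  φ-^ : ∀ x m → φ (x ^ᴷ m) ≡ x ^ᴷ (q ℕ.* m)
  φ-^ x m = trans (^ᴷ≡^ _ q) (trans (cong (_^ q) (^ᴷ≡^ x m)) (trans (^-assocʳ x m q)
    (trans (cong (x ^_) (ℕ.*-comm m q)) (sym (^ᴷ≡^ x (q ℕ.* m))))))

  φ-0 : φ 0# ≡ 0#
  φ-0 = trans (solve 1 (λ a → a := (a :+ a) :- a) refl (φ 0#))
    (trans (cong (_- φ 0#) (trans (sym (φ-+ 0# 0#)) (cong φ (+-identityˡ 0#)))) (-‿inverseʳ _))

  φ-neg : ∀ x → φ (- x) ≡ - φ x
  φ-neg x = trans (solve 2 (λ a b → b := (a :+ b) :- a) refl (φ x) (φ (- x)))
    (trans (cong (_- φ x) (trans (sym (φ-+ x (- x))) (trans (cong φ (-‿inverseʳ x)) φ-0))) (+-identityˡ _))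

  φ-1 : φ 1# ≡ 1#
  φ-1 = trans (^ᴷ≡^ 1# q) (1^ q)
    where
    1^ : ∀ m → 1# ^ m ≡ 1#
    1^ zero = refl
    1^ (suc m) = trans (*-identityˡ _) (1^ m)

  φ²≡ : ∀ x → φ (φ x) ≡ x ^ᴷ (q ℕ.^ 2)
  φ²≡ x = trans (φ-^ x q) (cong (λ m → x ^ᴷ (q ℕ.* m)) (sym (ℕ.*-identityʳ q)))

  φ³≡ : ∀ x → φ (φ (φ x)) ≡ x ^ᴷ (q ℕ.^ 3)
  φ³≡ x = trans (cong φ (φ²≡ x)) (φ-^ x (q ℕ.^ 2))

  φ⁴≡id : ∀ x → φ (φ (φ (φ x))) ≡ x
  φ⁴≡id x = trans (cong φ (φ³≡ x)) (trans (φ-^ x (q ℕ.^ 3)) (trans (^ᴷ≡^ x (q ℕ.^ 4)) (x^n≡x x)))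

-- Roots of polynomials and the orders of F_q and W.

infixr 2 _×-count_
infixr 1 _⊎-count_
_⊎-count_ : ∀ {m n} {A B : Set} → Fin m ↔ A → Fin n ↔ B → Fin (m ℕ.+ n) ↔ (A ⊎ B)
I ⊎-count J = (I ⊎-↔ J) ↔-∘ Fin.+↔⊎

_×-count_ : ∀ {m n} {A B : Set} → Fin m ↔ A → Fin n ↔ B → Fin (m ℕ.* n) ↔ (A × B)
I ×-count J = (I ×-↔ J) ↔-∘ Fin.*↔×

record Vec3 (A : Set) : Set where
  constructor ⟨_,_,_⟩
  field
    x₁ x₂ x₃ : A

module Roots {n : ℕ} (K : FiniteField n) (q : ℕ) where
  open Field K
  open Construction K q using (_^ᴷ_)

  -- c is the coefficient of f at x^d; it may vanish.
  Polynomial≤ : ℕ → Carrier → (Carrier → Carrier) → Set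
  Polynomial≤ zero    c f = ∀ x → f x ≡ c
  Polynomial≤ (suc d) c f = Σ (Carrier → Carrier) λ g → Σ Carrier λ b →
    Polynomial≤ d c g × (∀ x → f x ≡ b + x * g x)

  polynomial-+ : ∀ d {c c′ f f′} → Polynomial≤ d c f → Polynomial≤ d c′ f′ →
    Polynomial≤ d (c + c′) (λ x → f x + f′ x)
  polynomial-+ zero p p′ x = cong₂ _+_ (p x) (p′ x)
  polynomial-+ (suc d) (g , b , p , eq) (g′ , b′ , p′ , eq′) =
    _ , b + b′ , polynomial-+ d p p′ , λ x → trans (cong₂ _+_ (eq x) (eq′ x))
      (solve 5 (λ b b′ x y y′ → (b :+ x :* y) :+ (b′ :+ x :* y′) := (b :+ b′) :+ x :* (y :+ y′)) refl b b′ x (g x) (g′ x))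

  polynomial-scale : ∀ d a {c f} → Polynomial≤ d c f → Polynomial≤ d (a * c) (λ x → a * f x)
  polynomial-scale zero a p x = cong (a *_) (p x)
  polynomial-scale (suc d) a (g , b , p , eq) = _ , a * b , polynomial-scale d a p , λ x →
    trans (cong (a *_) (eq x)) (solve 4 (λ a b x y → a :* (b :+ x :* y) := a :* b :+ x :* (a :* y)) refl a b x (g x))

  polynomial-raise : ∀ d {c f} → Polynomial≤ d c f → Polynomial≤ (suc d) 0# f
  polynomial-raise zero {c} p = (λ _ → 0#) , c , (λ _ → refl) , λ x →
    trans (p x) (sym (trans (cong (c +_) (zeroʳ x)) (+-identityʳ c)))
  polynomial-raise (suc d) (g , b , p , eq) = g , b , polynomial-raise d p , eq

  polynomial-raise-< : ∀ {d d′ c f} → d ℕ.<′ d′ → Polynomial≤ d c f → Polynomial≤ d′ 0# f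
  polynomial-raise-< (ℕ.≤′-reflexive refl) p = polynomial-raise _ p
  polynomial-raise-< (ℕ.≤′-step d<d′) p = polynomial-raise _ (polynomial-raise-< d<d′ p)

  polynomial-^ : ∀ d → Polynomial≤ d 1# (_^ᴷ d)
  polynomial-^ zero x = refl
  polynomial-^ (suc d) = _ , 0# , polynomial-^ d , λ x → sym (+-identityˡ _)

  -- Division with remainder by x - a. The quotient keeps the leading coefficient, so the induction
  -- on the number of roots never loses that it is nonzero.
  divide : ∀ d {c f} → Polynomial≤ (suc d) c f → ∀ a → ∃ λ h → Polynomial≤ d c h × (∀ x → f x ≡ f a + (x - a) * h x)
  divide zero {c} {f} (g , b , p , eq) a = g , p , λ x → begin
    f x                              ≡⟨ eq x ⟩
    b + x * g x                      ≡⟨ cong (λ y → b + x * y) (p x) ⟩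
    b + x * c                        ≡⟨ solve 4 (λ a b c x → b :+ x :* c := (b :+ a :* c) :+ (x :- a) :* c) refl a b c x ⟩
    (b + a * c) + (x - a) * c        ≡⟨ cong₂ (λ y z → (b + a * y) + (x - a) * z) (p a) (p x) ⟨
    (b + a * g a) + (x - a) * g x    ≡⟨ cong (_+ (x - a) * g x) (eq a) ⟨
    f a + (x - a) * g x              ∎
    where open ≡-Reasoning
  divide (suc d) {c} {f} (g , b , p , eq) a with divide d p a
  ... | h , ph , g≡ = (λ x → g x + a * h x)
    , subst (λ c → Polynomial≤ (suc d) c _) (+-identityʳ c) (polynomial-+ (suc d) p (polynomial-raise d (polynomial-scale d a ph)))
    , λ x → begin
      f x                                            ≡⟨ eq x ⟩
      b + x * g x
        -- A zero term `a * (g x - g x)` is inserted so that the induction hypothesis can rewrite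
        -- one occurrence of `g x` alone.
        ≡⟨ solve 5 (λ a b x y t → b :+ x :* y := (b :+ x :* y) :+ a :* (y :- y)) refl a b x (g x) b ⟩
      (b + x * g x) + a * (g x - g x)                ≡⟨ cong (λ y → (b + x * g x) + a * (y - g x)) (g≡ x) ⟩
      (b + x * g x) + a * ((g a + (x - a) * h x) - g x)
        ≡⟨ solve 6 (λ a b x gx ga hx → (b :+ x :* gx) :+ a :* ((ga :+ (x :- a) :* hx) :- gx) := (b :+ a :* ga) :+ (x :- a) :*
            (gx :+ a :* hx)) refl a b x (g x) (g a) (h x) ⟩
      (b + a * g a) + (x - a) * (g x + a * h x)      ≡⟨ cong (_+ (x - a) * (g x + a * h x)) (eq a) ⟨
      f a + (x - a) * (g x + a * h x)                ∎
    where open ≡-Reasoning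

  roots≤degree : ∀ d {c f} → Polynomial≤ d c f → c ≢ 0# → ∀ m (r : Fin m → Carrier) →
    Injective _≡_ _≡_ r → (∀ i → f (r i) ≡ 0#) → m ℕ.≤ d
  roots≤degree d p c≢0 zero r r-inj root = ℕ.z≤n
  roots≤degree zero p c≢0 (suc m) r r-inj root = contradiction (trans (sym (p (r zero))) (root zero)) c≢0
  roots≤degree (suc d) p c≢0 (suc m) r r-inj root with divide d p (r zero)
  ... | h , ph , f≡ = ℕ.s≤s (roots≤degree d ph c≢0 m (r ∘ suc) (Fin.suc-injective ∘ r-inj) λ i →
    x*y≡0⇒y≡0 (λ eq → contradiction (r-inj (x-y≡0⇒x≡y eq)) λ ())
      (trans (sym (+-identityˡ _)) (trans (cong (_+ (r (suc i) - r zero) * h (r (suc i))) (sym (root zero)))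
        (trans (sym (f≡ (r (suc i)))) (root (suc i))))))

module Subfield (q : ℕ) (q-primePower : IsPrimePower q) (K : FiniteField (q ℕ.^ 4)) where
  open FrobeniusQ q q-primePower K public
  open Construction K q using (_^ᴷ_; Fq; W) public
  open Roots K q

  1<q : 1 ℕ.< q
  1<q = go q-primePower
    where
    go : IsPrimePower q → 1 ℕ.< q
    go (p , k , p-prime , q≡p^) = subst (1 ℕ.<_) (sym q≡p^)
      (ℕ.<-≤-trans (ℕ.nonTrivial⇒n>1 p ⦃ prime⇒nonTrivial p-prime ⦄)
        (ℕ.m≤m*n p (p ℕ.^ k) ⦃ ℕ.m^n≢0 p k ⦃ prime⇒nonZero p-prime ⦄ ⦄))

  instance
    q-nonZero : ℕ.NonZero q
    q-nonZero = ℕ.>-nonZero (ℕ.<-trans (ℕ.s≤s ℕ.z≤n) 1<q)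

  Fq-0 : Fq 0#
  Fq-0 = φ-0
  Fq-1 : Fq 1#
  Fq-1 = φ-1
  Fq-+ : ∀ {x y} → Fq x → Fq y → Fq (x + y)
  Fq-+ {x} {y} fx fy = trans (φ-+ x y) (cong₂ _+_ fx fy)
  Fq-* : ∀ {x y} → Fq x → Fq y → Fq (x * y)
  Fq-* {x} {y} fx fy = trans (φ-* x y) (cong₂ _*_ fx fy)
  Fq-neg : ∀ {x} → Fq x → Fq (- x)
  Fq-neg {x} fx = trans (φ-neg x) (cong -_ fx)
  Fq-- : ∀ {x y} → Fq x → Fq y → Fq (x - y)
  Fq-- fx fy = Fq-+ fx (Fq-neg fy)
  Fq-⁻¹ : ∀ {x} → x ≢ 0# → Fq x → Fq (x ⁻¹)
  Fq-⁻¹ {x} x≢0 fx = *-cancelˡ x≢0 (trans (cong (_* φ (x ⁻¹)) (sym fx))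
    (trans (sym (φ-* x (x ⁻¹))) (trans (cong φ (x*x⁻¹≡1 x≢0)) (trans φ-1 (sym (x*x⁻¹≡1 x≢0))))))

  Fq? : ∀ x → Dec (Fq x)
  Fq? x = φ x ≟ x

  W? : ∀ x → Dec (W x)
  W? x = _ ≟ 0#

  -- In this form, with iterates of `φ` in place of the powers that define `W`, linearity and
  -- Frobenius invariance are formal.
  Tr : Carrier → Carrier
  Tr x = ((x + φ x) + φ (φ x)) + φ (φ (φ x))

  W-polynomial : Carrier → Carrier
  W-polynomial x = ((x + (x ^ᴷ q)) + (x ^ᴷ (q ℕ.^ 2))) + (x ^ᴷ (q ℕ.^ 3))

  Tr≡ : ∀ x → Tr x ≡ W-polynomial x
  Tr≡ x = cong₂ (λ a b → ((x + φ x) + a) + b) (φ²≡ x) (φ³≡ x)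

  W⇒Tr≡0 : ∀ {x} → W x → Tr x ≡ 0#
  W⇒Tr≡0 {x} w = trans (Tr≡ x) w

  Tr≡0⇒W : ∀ {x} → Tr x ≡ 0# → W x
  Tr≡0⇒W {x} t = trans (sym (Tr≡ x)) t

  Tr-+ : ∀ x y → Tr (x + y) ≡ Tr x + Tr y
  Tr-+ x y = trans (cong₂ _+_ (cong₂ _+_ (cong₂ _+_ refl (φ-+ x y)) φφ) (trans (cong φ φφ) (φ-+ _ _)))
    (solve 8 (λ a b c d e f g h → (((a :+ b) :+ (c :+ d)) :+ (e :+ f)) :+ (g :+ h) := (((a :+ c) :+ e) :+ g) :+ (((b :+ d) :+ f) :+ h)) refl
      x y (φ x) (φ y) (φ (φ x)) (φ (φ y)) (φ (φ (φ x))) (φ (φ (φ y))))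
    where φφ = trans (cong φ (φ-+ x y)) (φ-+ _ _)

  Tr-* : ∀ {c} → Fq c → ∀ x → Tr (c * x) ≡ c * Tr x
  Tr-* {c} fc x = trans (cong₂ _+_ (cong₂ _+_ (cong₂ _+_ refl (step x)) φφ) (trans (cong φ φφ) (step _)))
    (solve 5 (λ c a b d e → ((c :* a :+ c :* b) :+ c :* d) :+ c :* e := c :* (((a :+ b) :+ d) :+ e)) refl c x (φ x) (φ (φ x)) (φ (φ (φ x))))
    where
    step : ∀ y → φ (c * y) ≡ c * φ y
    step y = trans (φ-* c y) (cong (_* φ y) fc)
    φφ = trans (cong φ (step x)) (step _)

  Tr-φ : ∀ x → Tr (φ x) ≡ Tr x
  Tr-φ x = trans (cong (((φ x + φ (φ x)) + φ (φ (φ x))) +_) (φ⁴≡id x))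
    (solve 4 (λ a b c d → ((b :+ c) :+ d) :+ a := ((a :+ b) :+ c) :+ d) refl x (φ x) (φ (φ x)) (φ (φ (φ x))))

  Tr-neg : ∀ x → Tr (- x) ≡ - Tr x
  Tr-neg x = trans (cong Tr (solve 1 (λ x → :- x := (:- con (ℤ.+ 1)) :* x) refl x)) (trans (Tr-* (Fq-neg Fq-1) x)
    (solve 1 (λ x → (:- con (ℤ.+ 1)) :* x := :- x) refl (Tr x)))

  Fq-Tr : ∀ x → Fq (Tr x)
  Fq-Tr x = trans (trans (φ-+ _ _) (cong (_+ φ (φ (φ (φ x)))) (trans (φ-+ _ _)
    (cong (_+ φ (φ (φ x))) (φ-+ _ _))))) (Tr-φ x)

  W-+ : ∀ {x y} → W x → W y → W (x + y)
  W-+ {x} {y} wx wy = Tr≡0⇒W (trans (Tr-+ x y) (trans (cong₂ _+_ (W⇒Tr≡0 wx) (W⇒Tr≡0 wy)) (+-identityˡ 0#)))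

  W-* : ∀ {c x} → Fq c → W x → W (c * x)
  W-* {c} {x} fc wx = Tr≡0⇒W (trans (Tr-* fc x) (trans (cong (c *_) (W⇒Tr≡0 wx)) (zeroʳ c)))

  W-0 : W 0#
  W-0 = Tr≡0⇒W (trans (cong Tr (sym (zeroˡ 0#))) (trans (Tr-* Fq-0 0#) (zeroˡ _)))

  𝔽 𝕎 : Set
  𝔽 = Σ Carrier Fq
  𝕎 = Σ Carrier W

  𝔽-≡ : {a b : 𝔽} → proj₁ a ≡ proj₁ b → a ≡ b
  𝔽-≡ {a , _} refl = cong (a ,_) (≡-irrelevant _ _)

  𝕎-≡ : {a b : 𝕎} → proj₁ a ≡ proj₁ b → a ≡ b
  𝕎-≡ {a , _} refl = cong (a ,_) (≡-irrelevant _ _)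

  private
    some-count-𝔽 : ∃ λ m → Fin m ↔ 𝔽
    some-count-𝔽 = subtype-count count-K Fq? ≡-irrelevant

    some-count-𝕎 : ∃ λ m → Fin m ↔ 𝕎
    some-count-𝕎 = subtype-count count-K W? ≡-irrelevant

    #𝔽 = proj₁ some-count-𝔽
    #𝕎 = proj₁ some-count-𝕎

    #𝔽≤q : #𝔽 ℕ.≤ q
    #𝔽≤q = roots≤degree q
      -- The polynomial x^q - x. As 1 < q, the linear term contributes `0#` in degree q.
      (polynomial-+ q (polynomial-^ q) (polynomial-raise-< (ℕ.≤⇒≤′ 1<q) (polynomial-scale 1 (- 1#) (polynomial-^ 1))))
      (λ eq → 0≢1 (trans (sym eq) (+-identityʳ 1#))) #𝔽
      (proj₁ ∘ Inverse.to (proj₂ some-count-𝔽)) (FiniteType.to-injective (proj₂ some-count-𝔽) ∘ 𝔽-≡)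
      λ i → let (x , fx) = Inverse.to (proj₂ some-count-𝔽) i in
        trans (cong (_+ (- 1#) * (x * 1#)) fx) (trans (cong (x +_) (solve 2 (λ x o → (:- o) :* (x :* o) := :- (o :* (o :* x))) refl x 1#))
          (trans (cong (λ y → x - y) (trans (*-identityˡ _) (*-identityˡ x))) (-‿inverseʳ x)))

    #𝕎≤q³ : #𝕎 ℕ.≤ q ℕ.^ 3
    #𝕎≤q³ = roots≤degree (q ℕ.^ 3)
      (polynomial-+ (q ℕ.^ 3)
        (polynomial-+ (q ℕ.^ 3) (polynomial-+ (q ℕ.^ 3) (raise (ℕ.^-monoʳ-< q 1<q {0} {3} (ℕ.s≤s ℕ.z≤n)) X¹) (raise q<q³ (polynomial-^ q)))
          (raise (ℕ.^-monoʳ-< q 1<q {2} {3} ℕ.≤-refl) (polynomial-^ (q ℕ.^ 2))))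
        (polynomial-^ (q ℕ.^ 3)))
      (λ eq → 0≢1 (trans (sym eq) (trans (cong (_+ 1#) (trans (+-identityʳ _) (+-identityʳ _))) (+-identityˡ 1#)))) #𝕎
      (proj₁ ∘ Inverse.to (proj₂ some-count-𝕎)) (FiniteType.to-injective (proj₂ some-count-𝕎) ∘ 𝕎-≡)
      λ i → proj₂ (Inverse.to (proj₂ some-count-𝕎) i)
      where
      raise : ∀ {d d′ c f} → d ℕ.< d′ → Polynomial≤ d c f → Polynomial≤ d′ 0# f
      raise d<d′ = polynomial-raise-< (ℕ.≤⇒≤′ d<d′)
      q<q³ : q ℕ.< q ℕ.^ 3
      q<q³ = subst (ℕ._< q ℕ.^ 3) (ℕ.^-identityʳ q) (ℕ.^-monoʳ-< q 1<q {1} {3} (ℕ.s≤s (ℕ.s≤s ℕ.z≤n)))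
      X¹ : Polynomial≤ 1 1# (λ x → x)
      X¹ = (λ _ → 1#) , 0# , (λ _ → refl) , λ x → sym (trans (+-identityˡ _) (*-identityʳ x))

    -- The fibres of Tr : K → 𝔽 embed into 𝕎.
    q⁴≤#𝔽*#𝕎 : q ℕ.^ 4 ℕ.≤ #𝔽 ℕ.* #𝕎
    q⁴≤#𝔽*#𝕎 = injective⇒≤ count-K (proj₂ some-count-𝔽 ×-count proj₂ some-count-𝕎) {f} f-injective
      where
      section : ∀ τ → Dec (∃ λ y → Tr y ≡ τ) → Carrier
      section τ (yes (y , _)) = y
      -- Never reached for τ = Tr x, where x itself is a preimage.
      section τ (no _) = 0#
      section-Tr : ∀ τ (d : Dec (∃ λ y → Tr y ≡ τ)) → ∀ x → Tr x ≡ τ → Tr (section τ d) ≡ τ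
      section-Tr τ (yes (_ , eq)) x _ = eq
      section-Tr τ (no none) x eq = contradiction (x , eq) none
      -- `s x` depends on x through `Tr x` alone, so elements of equal trace are shifted by the same
      -- amount.
      s : Carrier → Carrier
      s x = section (Tr x) (exists? λ y → Tr y ≟ Tr x)
      W-diff : ∀ x → W (x - s x)
      W-diff x = Tr≡0⇒W (trans (Tr-+ x _) (trans (cong (Tr x +_) (trans (Tr-neg (s x)) (cong -_ (section-Tr (Tr x)
          (exists? λ y → Tr y ≟ Tr x) x refl)))) (-‿inverseʳ _)))
      f : Carrier → 𝔽 × 𝕎
      f x = (Tr x , Fq-Tr x) , (x - s x , W-diff x)
      f-injective : Injective _≡_ _≡_ f
      f-injective {x} {y} eq = trans (solve 2 (λ x a → x := (x :- a) :+ a) refl x (s x))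
        (trans (cong₂ _+_ (cong (proj₁ ∘ proj₂) eq) (cong (λ τ → section τ (exists? λ y → Tr y ≟ τ)) (cong (proj₁ ∘ proj₁) eq)))
          (solve 2 (λ x a → (x :- a) :+ a := x) refl y (s y)))

    -- The upper bounds q and q³ obtained from root counts multiply to q⁴, and q⁴ is also a lower
    -- bound for the product of the two orders. Hence both bounds are attained.
    #𝔽≡q : #𝔽 ≡ q
    #𝔽≡q = ℕ.≤-antisym #𝔽≤q (ℕ.≮⇒≥ λ #𝔽<q → ℕ.<⇒≱
      (ℕ.≤-<-trans (ℕ.*-monoʳ-≤ #𝔽 #𝕎≤q³) (ℕ.*-monoˡ-< (q ℕ.^ 3) ⦃ ℕ.m^n≢0 q 3 ⦄ #𝔽<q)) q⁴≤#𝔽*#𝕎)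

    #𝕎≡q³ : #𝕎 ≡ q ℕ.^ 3
    #𝕎≡q³ = ℕ.≤-antisym #𝕎≤q³ (ℕ.*-cancelˡ-≤ q (subst (λ m → q ℕ.^ 4 ℕ.≤ m ℕ.* #𝕎) #𝔽≡q q⁴≤#𝔽*#𝕎))

  abstract
    count-𝔽 : Fin q ↔ 𝔽
    count-𝔽 = subst (λ m → Fin m ↔ 𝔽) #𝔽≡q (proj₂ some-count-𝔽)

    count-𝕎 : Fin (q ℕ.^ 3) ↔ 𝕎
    count-𝕎 = subst (λ m → Fin m ↔ 𝕎) #𝕎≡q³ (proj₂ some-count-𝕎)

open Vec3

-- A basis of W, and an irreducible quadratic over F_q.

module Bases (q : ℕ) (q-primePower : IsPrimePower q) (K : FiniteField (q ℕ.^ 4)) where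
  open Subfield q q-primePower K public

  Vec : Set
  Vec = Vec3 Carrier

  𝟎 : Vec
  𝟎 = ⟨ 0# , 0# , 0# ⟩

  FqVec : Vec → Set
  FqVec v = Fq (x₁ v) × Fq (x₂ v) × Fq (x₃ v)

  vec-≡ : {v w : Vec} → x₁ v ≡ x₁ w → x₂ v ≡ x₂ w → x₃ v ≡ x₃ w → v ≡ w
  vec-≡ refl refl refl = refl

  -- The extra element `e₀` lies outside the trace kernel W and so completes the basis of W to one
  -- of K.
  record Basis : Set where
    field
      e₁ e₂ e₃ : Carrier

    comb : Vec → Carrier
    comb v = x₁ v * e₁ + x₂ v * e₂ + x₃ v * e₃

    field
      comb-W      : ∀ {v} → FqVec v → W (comb v)
      independent : ∀ {v} → FqVec v → comb v ≡ 0# → v ≡ 𝟎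
      span        : ∀ {x} → W x → ∃ λ v → FqVec v × x ≡ comb v
      e₀          : Carrier
      Tr-e₀≢0     : Tr e₀ ≢ 0#

  𝔽³ : Set
  𝔽³ = 𝔽 × 𝔽 × 𝔽

  count-𝔽³ : Fin (q ℕ.^ 3) ↔ 𝔽³
  count-𝔽³ = subst (λ m → Fin (q ℕ.* (q ℕ.* m)) ↔ 𝔽³) (sym (ℕ.*-identityʳ q)) (count-𝔽 ×-count count-𝔽 ×-count count-𝔽)

  module Spanning {e₁ e₂ e₃ : Carrier} (w₁ : W e₁) (w₂ : W e₂) (w₃ : W e₃) (e₁≢0 : e₁ ≢ 0#)
    (e₂∉ : ∀ {a} → Fq a → a * e₁ ≢ e₂) (e₃∉ : ∀ {a b} → Fq a → Fq b → a * e₁ + b * e₂ ≢ e₃) where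

    comb : Vec → Carrier
    comb v = x₁ v * e₁ + x₂ v * e₂ + x₃ v * e₃

    comb-W : ∀ {v} → FqVec v → W (comb v)
    comb-W (f₁ , f₂ , f₃) = W-+ (W-+ (W-* f₁ w₁) (W-* f₂ w₂)) (W-* f₃ w₃)

    solve-for : ∀ {c x y} → c ≢ 0# → y + c * x ≡ 0# → (- (c ⁻¹)) * y ≡ x
    solve-for {c} {x} {y} c≢0 eq = begin
      (- (c ⁻¹)) * y                   ≡⟨ solve 4 (λ i c x y → (:- i) :* y := i :* (c :* x) :- i :* (y :+ c :* x)) refl (c ⁻¹) c x y ⟩
      c ⁻¹ * (c * x) - c ⁻¹ * (y + c * x) ≡⟨ cong₂ (λ s t → s - c ⁻¹ * t) (x⁻¹*[x*y]≡y c≢0) eq ⟩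
      x - c ⁻¹ * 0#                    ≡⟨ solve 2 (λ x i → x :- i :* con (ℤ.+ 0) := x) refl x (c ⁻¹) ⟩
      x                                ∎
      where open ≡-Reasoning

    independent : ∀ {v} → FqVec v → comb v ≡ 0# → v ≡ 𝟎
    independent {⟨ a , b , c ⟩} (fa , fb , fc) eq = vec-≡ a≡0 b≡0 c≡0
      where
      c≡0 : c ≡ 0#
      c≡0 = decidable-stable (c ≟ 0#) λ c≢0 →
        e₃∉ (Fq-* (Fq-neg (Fq-⁻¹ c≢0 fc)) fa) (Fq-* (Fq-neg (Fq-⁻¹ c≢0 fc)) fb)
          (trans (solve 5 (λ i a b e f → (i :* a) :* e :+ (i :* b) :* f := i :* (a :* e :+ b :* f)) refl (-
              (c ⁻¹)) a b e₁ e₂) (solve-for c≢0 eq))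
      eq₂ : a * e₁ + b * e₂ ≡ 0#
      eq₂ = trans (sym (trans (cong (λ c → a * e₁ + b * e₂ + c * e₃) c≡0) (trans (cong (a * e₁ + b * e₂ +_) (zeroˡ e₃))
          (+-identityʳ _)))) eq
      b≡0 : b ≡ 0#
      b≡0 = decidable-stable (b ≟ 0#) λ b≢0 →
        e₂∉ (Fq-* (Fq-neg (Fq-⁻¹ b≢0 fb)) fa) (trans (*-assoc _ a e₁) (solve-for b≢0 eq₂))
      eq₁ : a * e₁ ≡ 0#
      eq₁ = trans (sym (trans (cong (λ b → a * e₁ + b * e₂) b≡0) (trans (cong (a * e₁ +_) (zeroˡ e₂)) (+-identityʳ _)))) eq₂
      a≡0 : a ≡ 0#
      a≡0 = x*y≡0⇒y≡0 e₁≢0 (trans (*-comm e₁ a) eq₁)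

    f : 𝔽³ → 𝕎
    f ((a , fa) , (b , fb) , (c , fc)) = comb ⟨ a , b , c ⟩ , comb-W (fa , fb , fc)

    f-injective : Injective _≡_ _≡_ f
    f-injective {(a , fa) , (b , fb) , (c , fc)} {(a′ , fa′) , (b′ , fb′) , (c′ , fc′)} eq =
      cong₂ _,_ (𝔽-≡ (x-y≡0⇒x≡y (cong x₁ diff≡𝟎))) (cong₂ _,_ (𝔽-≡ (x-y≡0⇒x≡y (cong x₂ diff≡𝟎))) (𝔽-≡ (x-y≡0⇒x≡y (cong x₃ diff≡𝟎))))
      where
      diff≡𝟎 : ⟨ a - a′ , b - b′ , c - c′ ⟩ ≡ 𝟎
      diff≡𝟎 = independent (Fq-- fa fa′ , Fq-- fb fb′ , Fq-- fc fc′) (trans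
        (solve 9 (λ a b c a′ b′ c′ e f g → (a :- a′) :* e :+ (b :- b′) :* f :+ (c :- c′) :* g :=
          (a :* e :+ b :* f :+ c :* g) :- (a′ :* e :+ b′ :* f :+ c′ :* g)) refl a b c a′ b′ c′ e₁ e₂ e₃)
        (x≡y⇒x-y≡0 (cong proj₁ eq)))

    -- Independence makes 𝔽³ → W injective, and both sides have q³ elements, so coordinates exist by
    -- counting.
    span : ∀ {x} → W x → ∃ λ v → FqVec v × x ≡ comb v
    span {x} wx = go (injective⇒surjective count-𝔽³ count-𝕎 f-injective (x , wx))
      where
      go : (∃ λ v → f v ≡ (x , wx)) → ∃ λ v → FqVec v × x ≡ comb v
      go (((a , fa) , (b , fb) , (c , fc)) , eq) = ⟨ a , b , c ⟩ , (fa , fb , fc) , sym (cong proj₁ eq)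

  new-W : ∀ {m} {A : Set} → Fin m ↔ A → m ℕ.< q ℕ.^ 3 → (f : A → 𝕎) →
    Σ Carrier λ w → W w × (∀ a → proj₁ (f a) ≢ w)
  new-W I m<q³ f with <⇒missed I count-𝕎 m<q³ f
  ... | (w , ww) , miss = w , ww , λ a eq → miss a (𝕎-≡ eq)

  abstract
    -- A greedy choice: the spans of 0, 1 and 2 vectors have at most 1, q and q² elements and miss
    -- something in W, and W misses something in K.
    basis : Basis
    basis = go₁ (new-W Fin.1↔⊤ (<q³ 0 (ℕ.s≤s ℕ.z≤n)) (λ _ → 0# , W-0))
      where
      <q³ : ∀ m → m ℕ.< 3 → q ℕ.^ m ℕ.< q ℕ.^ 3
      <q³ m m<3 = ℕ.^-monoʳ-< q 1<q m<3

      go₁ : (Σ Carrier λ w → W w × (⊤ → 0# ≢ w)) → Basis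
      go₁ (e₁ , w₁ , 0≢e₁) = go₂ (new-W count-𝔽 (subst (ℕ._< q ℕ.^ 3) (ℕ.^-identityʳ q) (<q³ 1 (ℕ.s≤s (ℕ.s≤s ℕ.z≤n))))
        (λ (c , fc) → c * e₁ , W-* fc w₁))
        where
        go₂ : (Σ Carrier λ w → W w × (((c , _) : 𝔽) → c * e₁ ≢ w)) → Basis
        go₂ (e₂ , w₂ , e₂∉) = go₃
          (new-W (count-𝔽 ×-count count-𝔽) (subst (λ m → q ℕ.* m ℕ.< q ℕ.^ 3) (ℕ.*-identityʳ q) (<q³ 2 ℕ.≤-refl))
            (λ ((c , fc) , (d , fd)) → c * e₁ + d * e₂ , W-+ (W-* fc w₁) (W-* fd w₂)))
          (<⇒missed count-𝕎 count-K (ℕ.^-monoʳ-< q 1<q {3} {4} ℕ.≤-refl) proj₁)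
          where
          go₃ : (Σ Carrier λ w → W w × ((((c , _) , (d , _)) : 𝔽 × 𝔽) → c * e₁ + d * e₂ ≢ w)) →
            (∃ λ x → ∀ (w : 𝕎) → proj₁ w ≢ x) → Basis
          go₃ (e₃ , w₃ , e₃∉) (e₀ , e₀∉) = record
            { e₁ = e₁ ; e₂ = e₂ ; e₃ = e₃ ; comb-W = comb-W ; independent = independent
            ; span = span ; e₀ = e₀ ; Tr-e₀≢0 = λ t → e₀∉ (e₀ , Tr≡0⇒W t) refl }
            where open Spanning w₁ w₂ w₃ (0≢e₁ tt ∘ sym) (λ fa → e₂∉ (_ , fa)) (λ fa fb → e₃∉ ((_ , fa) , (_ , fb)))

    -- t ↦ t² − t is not injective on 𝔽, hence not surjective.
    rootless : ∃ λ δ → Fq δ × (∀ {t} → Fq t → t * t - t ≢ δ)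
    rootless = go (FiniteType.missed? count-𝔽 count-𝔽 g)
      where
      g : 𝔽 → 𝔽
      g (t , ft) = t * t - t , Fq-- (Fq-* ft ft) ft
      g0≡g1 : g (0# , Fq-0) ≡ g (1# , Fq-1)
      g0≡g1 = 𝔽-≡ (trans (x≡y⇒x-y≡0 (zeroˡ 0#)) (sym (x≡y⇒x-y≡0 (*-identityˡ 1#))))
      go : Dec (∃ λ y → ∀ x → g x ≢ y) → ∃ λ δ → Fq δ × (∀ {t} → Fq t → t * t - t ≢ δ)
      go (yes ((δ , fδ) , miss)) = δ , fδ , λ ft eq → miss (_ , ft) (𝔽-≡ eq)
      go (no none) = contradiction (cong proj₁ (surjective⇒injective count-𝔽 (preimage count-𝔽 count-𝔽 g none) g0≡g1)) 0≢1

-- Vector algebra in coordinates and the points of PG(2,q).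

module Vectors (q : ℕ) (q-primePower : IsPrimePower q) (K : FiniteField (q ℕ.^ 4)) where
  open Bases q q-primePower K public
  open Construction K q using (rmap) public

  infixl 6 _⊞_
  infixr 7 _⊛_
  infix 7 _∙_
  infixl 8 _⨯_

  _⊞_ : Vec → Vec → Vec
  v ⊞ w = ⟨ x₁ v + x₁ w , x₂ v + x₂ w , x₃ v + x₃ w ⟩

  _⊛_ : Carrier → Vec → Vec
  c ⊛ v = ⟨ c * x₁ v , c * x₂ v , c * x₃ v ⟩

  _∙_ : Vec → Vec → Carrier
  v ∙ w = x₁ v * x₁ w + x₂ v * x₂ w + x₃ v * x₃ w

  _⨯_ : Vec → Vec → Vec
  v ⨯ w = ⟨ x₂ v * x₃ w - x₃ v * x₂ w , x₃ v * x₁ w - x₁ v * x₃ w , x₁ v * x₂ w - x₂ v * x₁ w ⟩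

  FqVec-⊞ : ∀ {v w} → FqVec v → FqVec w → FqVec (v ⊞ w)
  FqVec-⊞ (a , b , c) (d , e , f) = Fq-+ a d , Fq-+ b e , Fq-+ c f

  FqVec-⊛ : ∀ {c v} → Fq c → FqVec v → FqVec (c ⊛ v)
  FqVec-⊛ c (d , e , f) = Fq-* c d , Fq-* c e , Fq-* c f

  FqVec-⨯ : ∀ {v w} → FqVec v → FqVec w → FqVec (v ⨯ w)
  FqVec-⨯ (a , b , c) (d , e , f) =
    Fq-- (Fq-* b f) (Fq-* c e) , Fq-- (Fq-* c d) (Fq-* a f) , Fq-- (Fq-* a e) (Fq-* b d)

  Fq-∙ : ∀ {v w} → FqVec v → FqVec w → Fq (v ∙ w)
  Fq-∙ (a , b , c) (d , e , f) = Fq-+ (Fq-+ (Fq-* a d) (Fq-* b e)) (Fq-* c f)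

  FqVec-𝟎 : FqVec 𝟎
  FqVec-𝟎 = Fq-0 , Fq-0 , Fq-0

  ⊛-zeroˡ : ∀ v → 0# ⊛ v ≡ 𝟎
  ⊛-zeroˡ v = vec-≡ (zeroˡ _) (zeroˡ _) (zeroˡ _)

  ⊛-zeroʳ : ∀ c → c ⊛ 𝟎 ≡ 𝟎
  ⊛-zeroʳ c = vec-≡ (zeroʳ _) (zeroʳ _) (zeroʳ _)

  ⊛-identity : ∀ v → 1# ⊛ v ≡ v
  ⊛-identity v = vec-≡ (*-identityˡ _) (*-identityˡ _) (*-identityˡ _)

  ⊛-assoc : ∀ c d v → (c * d) ⊛ v ≡ c ⊛ d ⊛ v
  ⊛-assoc c d v = vec-≡ (*-assoc _ _ _) (*-assoc _ _ _) (*-assoc _ _ _)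

  ⊞-identityʳ : ∀ v → v ⊞ 𝟎 ≡ v
  ⊞-identityʳ v = vec-≡ (+-identityʳ _) (+-identityʳ _) (+-identityʳ _)

  ⊛-cancel : ∀ {c v w} → c ≢ 0# → c ⊛ v ≡ w → v ≡ c ⁻¹ ⊛ w
  ⊛-cancel c≢0 refl = vec-≡ (sym (x⁻¹*[x*y]≡y c≢0)) (sym (x⁻¹*[x*y]≡y c≢0)) (sym (x⁻¹*[x*y]≡y c≢0))

  ∙-⊛ : ∀ c v w → (c ⊛ v) ∙ w ≡ c * (v ∙ w)
  ∙-⊛ c ⟨ a , b , d ⟩ ⟨ x , y , z ⟩ = solve 7 (λ c a b d x y z → (c :* a) :* x :+ (c :* b) :* y :+ (c :* d) :* z := c :*
      (a :* x :+ b :* y :+ d :* z)) refl c a b d x y z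

  ∙-comm : ∀ v w → v ∙ w ≡ w ∙ v
  ∙-comm v w = cong₂ _+_ (cong₂ _+_ (*-comm _ _) (*-comm _ _)) (*-comm _ _)

  ∙-zeroʳ : ∀ v → v ∙ 𝟎 ≡ 0#
  ∙-zeroʳ v = trans (∙-comm v 𝟎) (trans (cong (_∙ v) (sym (⊛-zeroˡ v))) (trans (∙-⊛ 0# v v) (zeroˡ _)))

  ∙-⊞ : ∀ u v w → (u ⊞ v) ∙ w ≡ u ∙ w + v ∙ w
  ∙-⊞ ⟨ a , b , c ⟩ ⟨ d , e , f ⟩ ⟨ x , y , z ⟩ = solve 9 (λ a b c d e f x y z →
    (a :+ d) :* x :+ (b :+ e) :* y :+ (c :+ f) :* z := (a :* x :+ b :* y :+ c :* z) :+ (d :* x :+ e :* y :+ f :* z)) refl a b c d e f x y z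

  ⨯-orthogonalˡ : ∀ v w → v ⨯ w ∙ v ≡ 0#
  ⨯-orthogonalˡ ⟨ a , b , c ⟩ ⟨ x , y , z ⟩ = solve 6 (λ a b c x y z →
    (b :* z :- c :* y) :* a :+ (c :* x :- a :* z) :* b :+ (a :* y :- b :* x) :* c := con (ℤ.+ 0)) refl a b c x y z

  ⨯-orthogonalʳ : ∀ v w → v ⨯ w ∙ w ≡ 0#
  ⨯-orthogonalʳ ⟨ a , b , c ⟩ ⟨ x , y , z ⟩ = solve 6 (λ a b c x y z →
    (b :* z :- c :* y) :* x :+ (c :* x :- a :* z) :* y :+ (a :* y :- b :* x) :* z := con (ℤ.+ 0)) refl a b c x y z

  ⨯-⊛ˡ : ∀ c v w → (c ⊛ v) ⨯ w ≡ c ⊛ (v ⨯ w)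
  ⨯-⊛ˡ c ⟨ a , b , d ⟩ ⟨ x , y , z ⟩ = vec-≡ (eq b z d y) (eq d x a z) (eq a y b x)
    where
    eq : ∀ p q r s → (c * p) * q - (c * r) * s ≡ c * (p * q - r * s)
    eq = solve 5 (λ c p q r s → (c :* p) :* q :- (c :* r) :* s := c :* (p :* q :- r :* s)) refl c

  ⨯-⊛ʳ : ∀ c v w → v ⨯ (c ⊛ w) ≡ c ⊛ (v ⨯ w)
  ⨯-⊛ʳ c ⟨ a , b , d ⟩ ⟨ x , y , z ⟩ = vec-≡ (eq b z d y) (eq d x a z) (eq a y b x)
    where
    eq : ∀ p q r s → p * (c * q) - r * (c * s) ≡ c * (p * q - r * s)
    eq = solve 5 (λ c p q r s → p :* (c :* q) :- r :* (c :* s) := c :* (p :* q :- r :* s)) refl c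

  ⨯-self : ∀ v → v ⨯ v ≡ 𝟎
  ⨯-self v = vec-≡ (eq _ _) (eq _ _) (eq _ _)
    where
    eq : ∀ a b → a * b - b * a ≡ 0#
    eq = solve 2 (λ a b → a :* b :- b :* a := con (ℤ.+ 0)) refl

  -- Lagrange's formula (u × v) × w = (u · w) v − (v · w) u, with both sides moved so that no negation occurs.
  lagrange : ∀ u v w → (u ∙ w) ⊛ v ≡ (u ⨯ v) ⨯ w ⊞ (v ∙ w) ⊛ u
  lagrange ⟨ a , b , c ⟩ ⟨ d , e , f ⟩ ⟨ x , y , z ⟩ = vec-≡
    (solve 9 (λ a b c d e f x y z → (a :* x :+ b :* y :+ c :* z) :* d := ((c :* d :- a :* f) :* z :-
        (a :* e :- b :* d) :* y) :+ (d :* x :+ e :* y :+ f :* z) :* a) refl a b c d e f x y z)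
    (solve 9 (λ a b c d e f x y z → (a :* x :+ b :* y :+ c :* z) :* e := ((a :* e :- b :* d) :* x :-
        (b :* f :- c :* e) :* z) :+ (d :* x :+ e :* y :+ f :* z) :* b) refl a b c d e f x y z)
    (solve 9 (λ a b c d e f x y z → (a :* x :+ b :* y :+ c :* z) :* f := ((b :* f :- c :* e) :* y :-
        (c :* d :- a :* f) :* x) :+ (d :* x :+ e :* y :+ f :* z) :* c) refl a b c d e f x y z)

  -- Cramer's rule without division: each coefficient is the determinant of `a`, `b`, `j` with one
  -- of them replaced by `v`.
  cramer : ∀ a b j v → (a ⨯ b ∙ j) ⊛ v ≡ ((v ⨯ b ∙ j) ⊛ a ⊞ (a ⨯ v ∙ j) ⊛ b) ⊞ (a ⨯ b ∙ v) ⊛ j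
  cramer ⟨ a , b , c ⟩ ⟨ d , e , f ⟩ ⟨ x , y , z ⟩ ⟨ r , s , t ⟩ = vec-≡
    (solve 12 (λ a b c d e f x y z r s t →
      ((b :* f :- c :* e) :* x :+ (c :* d :- a :* f) :* y :+ (a :* e :- b :* d) :* z) :* r :=
      (((s :* f :- t :* e) :* x :+ (t :* d :- r :* f) :* y :+ (r :* e :- s :* d) :* z) :* a :+
       ((b :* t :- c :* s) :* x :+ (c :* r :- a :* t) :* y :+ (a :* s :- b :* r) :* z) :* d) :+
      ((b :* f :- c :* e) :* r :+ (c :* d :- a :* f) :* s :+ (a :* e :- b :* d) :* t) :* x) refl a b c d e f x y z r s t)
    (solve 12 (λ a b c d e f x y z r s t →
      ((b :* f :- c :* e) :* x :+ (c :* d :- a :* f) :* y :+ (a :* e :- b :* d) :* z) :* s :=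
      (((s :* f :- t :* e) :* x :+ (t :* d :- r :* f) :* y :+ (r :* e :- s :* d) :* z) :* b :+
       ((b :* t :- c :* s) :* x :+ (c :* r :- a :* t) :* y :+ (a :* s :- b :* r) :* z) :* e) :+
      ((b :* f :- c :* e) :* r :+ (c :* d :- a :* f) :* s :+ (a :* e :- b :* d) :* t) :* y) refl a b c d e f x y z r s t)
    (solve 12 (λ a b c d e f x y z r s t →
      ((b :* f :- c :* e) :* x :+ (c :* d :- a :* f) :* y :+ (a :* e :- b :* d) :* z) :* t :=
      (((s :* f :- t :* e) :* x :+ (t :* d :- r :* f) :* y :+ (r :* e :- s :* d) :* z) :* c :+
       ((b :* t :- c :* s) :* x :+ (c :* r :- a :* t) :* y :+ (a :* s :- b :* r) :* z) :* f) :+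
      ((b :* f :- c :* e) :* r :+ (c :* d :- a :* f) :* s :+ (a :* e :- b :* d) :* t) :* z) refl a b c d e f x y z r s t)

  -- In Lagrange's formula the term with h × v drops out. The vector `j` replaces the choice of a
  -- nonzero coordinate of `h` and makes the scalar explicit.
  parallel : ∀ {h j} → h ∙ j ≡ 1# → ∀ {v} → h ⨯ v ≡ 𝟎 → v ≡ (v ∙ j) ⊛ h
  parallel {h} {j} h∙j≡1 {v} h⨯v≡𝟎 = begin
    v                               ≡⟨ ⊛-identity v ⟨
    1# ⊛ v                          ≡⟨ cong (_⊛ v) h∙j≡1 ⟨
    (h ∙ j) ⊛ v                     ≡⟨ lagrange h v j ⟩
    (h ⨯ v) ⨯ j ⊞ (v ∙ j) ⊛ h       ≡⟨ cong (λ z → z ⨯ j ⊞ (v ∙ j) ⊛ h) h⨯v≡𝟎 ⟩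
    𝟎 ⨯ j ⊞ (v ∙ j) ⊛ h             ≡⟨ vec-≡ (eq _ _ _) (eq _ _ _) (eq _ _ _) ⟩
    (v ∙ j) ⊛ h                     ∎
    where
    open ≡-Reasoning
    eq : ∀ x y z → (0# * x - 0# * y) + z ≡ z
    eq = solve 3 (λ x y z → (con (ℤ.+ 0) :* x :- con (ℤ.+ 0) :* y) :+ z := z) refl

  -- By the triple product h × (v × w) = (h · w) v - (h · v) w = 0. In terms of W: the exterior
  -- square of a 2-dimensional Z is a line.
  orthogonal⇒⨯-parallel : ∀ {h j} → h ∙ j ≡ 1# → ∀ {v w} → h ∙ v ≡ 0# → h ∙ w ≡ 0# → v ⨯ w ≡ (v ⨯ w ∙ j) ⊛ h
  orthogonal⇒⨯-parallel {h} h∙j≡1 {v} {w} h∙v≡0 h∙w≡0 = parallel h∙j≡1 (vec-≡ (eq x₁) (eq x₂) (eq x₃))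
    where
    triple : ∀ h v w → h ⨯ (v ⨯ w) ≡ (h ∙ w) ⊛ v ⊞ (- (h ∙ v)) ⊛ w
    triple ⟨ a , b , c ⟩ ⟨ d , e , f ⟩ ⟨ x , y , z ⟩ = vec-≡
      (solve 9 (λ a b c d e f x y z → b :* (d :* y :- e :* x) :- c :* (f :* x :- d :* z) :=
          (a :* x :+ b :* y :+ c :* z) :* d :+ (:- (a :* d :+ b :* e :+ c :* f)) :* x) refl a b c d e f x y z)
      (solve 9 (λ a b c d e f x y z → c :* (e :* z :- f :* y) :- a :* (d :* y :- e :* x) :=
          (a :* x :+ b :* y :+ c :* z) :* e :+ (:- (a :* d :+ b :* e :+ c :* f)) :* y) refl a b c d e f x y z)
      (solve 9 (λ a b c d e f x y z → a :* (f :* x :- d :* z) :- b :* (e :* z :- f :* y) :=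
          (a :* x :+ b :* y :+ c :* z) :* f :+ (:- (a :* d :+ b :* e :+ c :* f)) :* z) refl a b c d e f x y z)
    eq : ∀ (π : Vec → Carrier) → π (h ⨯ (v ⨯ w)) ≡ π 𝟎
    eq π = cong π (trans (triple h v w) (trans (cong₂ (λ s t → s ⊛ v ⊞ (- t) ⊛ w) h∙w≡0 h∙v≡0)
      (vec-≡ (z _ _) (z _ _) (z _ _))))
      where
      z : ∀ x y → 0# * x + (- 0#) * y ≡ 0#
      z = solve 2 (λ x y → con (ℤ.+ 0) :* x :+ (:- con (ℤ.+ 0)) :* y := con (ℤ.+ 0)) refl

  -- The triple product h × (κ × j) = (h · j) κ - (h · κ) j. It exhibits each κ in h^⊥ as a multiple
  -- of h in the exterior algebra.
  orthogonal⇒⨯ : ∀ {h j} → h ∙ j ≡ 1# → ∀ {κ} → κ ∙ h ≡ 0# → κ ≡ h ⨯ (κ ⨯ j)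
  orthogonal⇒⨯ {⟨ a , b , c ⟩} {⟨ d , e , f ⟩} h∙j≡1 {⟨ x , y , z ⟩} κ∙h≡0 = vec-≡
    (eq (solve 9 (λ a b c d e f x y z → x :* (a :* d :+ b :* e :+ c :* f) := (b :* (x :* e :- y :* d) :- c :*
        (z :* d :- x :* f)) :+ d :* (x :* a :+ y :* b :+ z :* c)) refl a b c d e f x y z))
    (eq (solve 9 (λ a b c d e f x y z → y :* (a :* d :+ b :* e :+ c :* f) := (c :* (y :* f :- z :* e) :- a :*
        (x :* e :- y :* d)) :+ e :* (x :* a :+ y :* b :+ z :* c)) refl a b c d e f x y z))
    (eq (solve 9 (λ a b c d e f x y z → z :* (a :* d :+ b :* e :+ c :* f) := (a :* (z :* d :- x :* f) :- b :*
        (y :* f :- z :* e)) :+ f :* (x :* a :+ y :* b :+ z :* c)) refl a b c d e f x y z))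
    where
    eq : ∀ {p r s} → p * (a * d + b * e + c * f) ≡ r + s * (x * a + y * b + z * c) → p ≡ r
    eq {p} {r} {s} e = trans (trans (sym (*-identityʳ p)) (cong (p *_) (sym h∙j≡1)))
      (trans e (trans (cong (λ t → r + s * t) κ∙h≡0) (trans (cong (r +_) (zeroʳ s)) (+-identityʳ r))))

  -- Points of PG(2,q), with normalised coordinate vector h, a vector j with h · j = 1, and a basis a, b of h^⊥ with a × b = h.
  Point : Set
  Point = (𝔽 × 𝔽) ⊎ 𝔽 ⊎ ⊤

  δ : Carrier
  δ = proj₁ rootless

  h j a b g : Point → Vec
  h (inj₁ ((α , _) , (β , _))) = ⟨ 1# , α , β ⟩
  h (inj₂ (inj₁ (α , _)))      = ⟨ 0# , 1# , α ⟩
  h (inj₂ (inj₂ _))            = ⟨ 0# , 0# , 1# ⟩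

  j (inj₁ _)        = ⟨ 1# , 0# , 0# ⟩
  j (inj₂ (inj₁ _)) = ⟨ 0# , 1# , 0# ⟩
  j (inj₂ (inj₂ _)) = ⟨ 0# , 0# , 1# ⟩

  a (inj₁ ((α , _) , _))  = ⟨ - α , 1# , 0# ⟩
  a (inj₂ (inj₁ (α , _))) = ⟨ - 1# , 0# , 0# ⟩
  a (inj₂ (inj₂ _))       = ⟨ 1# , 0# , 0# ⟩

  b (inj₁ (_ , (β , _)))  = ⟨ - β , 0# , 1# ⟩
  b (inj₂ (inj₁ (α , _))) = ⟨ 0# , - α , 1# ⟩
  b (inj₂ (inj₂ _))       = ⟨ 0# , 1# , 0# ⟩

  -- An injection from points to lines (in dual coordinates) that sends no point to a line through it.
  g (inj₁ ((α , _) , (β , _))) = ⟨ 1# , - β , α ⟩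
  g (inj₂ (inj₁ (α , _)))      = ⟨ 0# , - δ - α , α ⟩
  g (inj₂ (inj₂ _))            = ⟨ 0# , - 1# , 1# ⟩

  FqVec-h : ∀ i → FqVec (h i)
  FqVec-h (inj₁ ((_ , fα) , (_ , fβ))) = Fq-1 , fα , fβ
  FqVec-h (inj₂ (inj₁ (_ , fα)))       = Fq-0 , Fq-1 , fα
  FqVec-h (inj₂ (inj₂ _))              = Fq-0 , Fq-0 , Fq-1

  FqVec-j : ∀ i → FqVec (j i)
  FqVec-j (inj₁ _)        = Fq-1 , Fq-0 , Fq-0
  FqVec-j (inj₂ (inj₁ _)) = Fq-0 , Fq-1 , Fq-0
  FqVec-j (inj₂ (inj₂ _)) = Fq-0 , Fq-0 , Fq-1

  FqVec-a : ∀ i → FqVec (a i)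
  FqVec-a (inj₁ ((_ , fα) , _)) = Fq-neg fα , Fq-1 , Fq-0
  FqVec-a (inj₂ (inj₁ _))       = Fq-neg Fq-1 , Fq-0 , Fq-0
  FqVec-a (inj₂ (inj₂ _))       = Fq-1 , Fq-0 , Fq-0

  FqVec-b : ∀ i → FqVec (b i)
  FqVec-b (inj₁ (_ , (_ , fβ)))  = Fq-neg fβ , Fq-0 , Fq-1
  FqVec-b (inj₂ (inj₁ (_ , fα))) = Fq-0 , Fq-neg fα , Fq-1
  FqVec-b (inj₂ (inj₂ _))        = Fq-0 , Fq-1 , Fq-0

  Fq-δ : Fq δ
  Fq-δ = proj₁ (proj₂ rootless)

  FqVec-g : ∀ i → FqVec (g i)
  FqVec-g (inj₁ ((_ , fα) , (_ , fβ))) = Fq-1 , Fq-neg fβ , fα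
  FqVec-g (inj₂ (inj₁ (_ , fα)))       = Fq-0 , Fq-- (Fq-neg Fq-δ) fα , fα
  FqVec-g (inj₂ (inj₂ _))              = Fq-0 , Fq-neg Fq-1 , Fq-1

  private
    𝟘 𝟙 : ∀ {m} → Polynomial m
    𝟘 = con (ℤ.+ 0)
    𝟙 = con (ℤ.+ 1)

  h∙j≡1 : ∀ i → h i ∙ j i ≡ 1#
  h∙j≡1 (inj₁ ((α , _) , (β , _))) = solve 2 (λ α β → 𝟙 :* 𝟙 :+ α :* 𝟘 :+ β :* 𝟘 := 𝟙) refl α β
  h∙j≡1 (inj₂ (inj₁ (α , _))) = solve 1 (λ α → 𝟘 :* 𝟘 :+ 𝟙 :* 𝟙 :+ α :* 𝟘 := 𝟙) refl α
  h∙j≡1 (inj₂ (inj₂ _)) = solve 1 (λ α → 𝟘 :* 𝟘 :+ 𝟘 :* 𝟘 :+ 𝟙 :* 𝟙 := 𝟙) refl 0#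

  a⨯b≡h : ∀ i → a i ⨯ b i ≡ h i
  a⨯b≡h (inj₁ ((α , _) , (β , _))) = vec-≡
    (solve 2 (λ α β → 𝟙 :* 𝟙 :- 𝟘 :* 𝟘 := 𝟙) refl α β)
    (solve 2 (λ α β → 𝟘 :* (:- β) :- (:- α) :* 𝟙 := α) refl α β)
    (solve 2 (λ α β → (:- α) :* 𝟘 :- 𝟙 :* (:- β) := β) refl α β)
  a⨯b≡h (inj₂ (inj₁ (α , _))) = vec-≡
    (solve 1 (λ α → 𝟘 :* 𝟙 :- 𝟘 :* (:- α) := 𝟘) refl α)
    (solve 1 (λ α → 𝟘 :* 𝟘 :- (:- 𝟙) :* 𝟙 := 𝟙) refl α)
    (solve 1 (λ α → (:- 𝟙) :* (:- α) :- 𝟘 :* 𝟘 := α) refl α)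
  a⨯b≡h (inj₂ (inj₂ _)) = vec-≡
    (solve 1 (λ α → 𝟘 :* 𝟘 :- 𝟘 :* 𝟙 := 𝟘) refl 0#)
    (solve 1 (λ α → 𝟘 :* 𝟘 :- 𝟙 :* 𝟘 := 𝟘) refl 0#)
    (solve 1 (λ α → 𝟙 :* 𝟙 :- 𝟘 :* 𝟘 := 𝟙) refl 0#)

  -- This explains the shape of `g`. For h = (1, α, β) the terms in αβ cancel and leave 1. For h =
  -- (0, 1, α) the value is α² - α - δ, which is nonzero by the choice of δ. For the last point it
  -- is 1.
  g∙h≢0 : ∀ i → g i ∙ h i ≢ 0#
  g∙h≢0 (inj₁ ((α , _) , (β , _))) eq = 0≢1 (trans (sym eq)
    (solve 2 (λ α β → 𝟙 :* 𝟙 :+ (:- β) :* α :+ α :* β := 𝟙) refl α β))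
  g∙h≢0 (inj₂ (inj₁ (α , fα))) eq = proj₂ (proj₂ rootless) fα (x-y≡0⇒x≡y (trans
    (solve 2 (λ α d → (α :* α :- α) :- d := 𝟘 :* 𝟘 :+ ((:- d) :- α) :* 𝟙 :+ α :* α) refl α δ) eq))
  g∙h≢0 (inj₂ (inj₂ _)) eq = 0≢1 (trans (sym eq)
    (solve 1 (λ α → 𝟘 :* 𝟘 :+ (:- 𝟙) :* 𝟘 :+ 𝟙 :* 𝟙 := 𝟙) refl 0#))

  private
    c*1≡1⇒c≡1 : ∀ {c} → 1# ≡ c * 1# → c ≡ 1#
    c*1≡1⇒c≡1 eq = trans (sym (*-identityʳ _)) (sym eq)

    scaled-≡ : ∀ {c x y} → 1# ≡ c * 1# → x ≡ c * y → x ≡ y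
    scaled-≡ {c} {x} {y} 1≡c eq = trans eq (trans (cong (_* y) (c*1≡1⇒c≡1 1≡c)) (*-identityˡ y))

    1≢c*0 : ∀ {c} → 1# ≢ c * 0#
    1≢c*0 eq = 0≢1 (sym (trans eq (zeroʳ _)))

    0≡c*1⇒c≡0 : ∀ {c} → 0# ≡ c * 1# → c ≡ 0#
    0≡c*1⇒c≡0 eq = sym (trans eq (*-identityʳ _))

    0≡c*1⇒1≢c*x : ∀ {c x} → 0# ≡ c * 1# → 1# ≢ c * x
    0≡c*1⇒1≢c*x {c} {x} 0≡c eq = 0≢1 (sym (trans eq (trans (cong (_* x) (0≡c*1⇒c≡0 0≡c)) (zeroˡ x))))

    -‿injective : ∀ {x y} → - x ≡ - y → x ≡ y
    -‿injective {x} {y} eq = trans (solve 1 (λ x → x := :- (:- x)) refl x) (trans (cong -_ eq) (solve 1 (λ x → :- (:- x) := x) refl y))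

    inj₁-≡ : {s s′ t t′ : 𝔽} → proj₁ s ≡ proj₁ s′ → proj₁ t ≡ proj₁ t′ → _≡_ {A = Point} (inj₁ (s , t)) (inj₁ (s′ , t′))
    inj₁-≡ p q = cong₂ (λ s t → inj₁ (s , t)) (𝔽-≡ p) (𝔽-≡ q)

    δ≢0 : δ ≢ 0#
    δ≢0 eq = proj₂ (proj₂ rootless) Fq-0 (trans (x≡y⇒x-y≡0 (zeroˡ 0#)) (sym eq))

  h-injective : ∀ i k {c} → h i ≡ c ⊛ h k → i ≡ k
  h-injective (inj₁ _) (inj₁ _) eq = inj₁-≡ (scaled-≡ (cong x₁ eq) (cong x₂ eq)) (scaled-≡ (cong x₁ eq) (cong x₃ eq))
  h-injective (inj₁ _) (inj₂ (inj₁ _)) eq = contradiction (cong x₁ eq) 1≢c*0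
  h-injective (inj₁ _) (inj₂ (inj₂ _)) eq = contradiction (cong x₁ eq) 1≢c*0
  h-injective (inj₂ (inj₁ _)) (inj₁ _) eq = contradiction (cong x₂ eq) (0≡c*1⇒1≢c*x (cong x₁ eq))
  h-injective (inj₂ (inj₁ _)) (inj₂ (inj₁ _)) eq = cong (inj₂ ∘ inj₁) (𝔽-≡ (scaled-≡ (cong x₂ eq) (cong x₃ eq)))
  h-injective (inj₂ (inj₁ _)) (inj₂ (inj₂ _)) eq = contradiction (cong x₂ eq) 1≢c*0
  h-injective (inj₂ (inj₂ _)) (inj₁ _) eq = contradiction (cong x₃ eq) (0≡c*1⇒1≢c*x (cong x₁ eq))
  h-injective (inj₂ (inj₂ _)) (inj₂ (inj₁ _)) eq = contradiction (cong x₃ eq) (0≡c*1⇒1≢c*x (cong x₂ eq))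
  h-injective (inj₂ (inj₂ _)) (inj₂ (inj₂ _)) eq = refl

  g≢𝟎 : ∀ i → g i ≢ 𝟎
  g≢𝟎 i eq = g∙h≢0 i (trans (cong (_∙ h i) eq) (trans (∙-comm 𝟎 (h i)) (∙-zeroʳ (h i))))

  -- The first coordinate separates the first kind of points from the others. For the remaining ones
  -- the sum of the last two coordinates is -δ or 0, respectively; as δ ≠ 0, it tells these kinds
  -- apart and fixes the scale.
  g-injective : ∀ i k {c} → g i ≡ c ⊛ g k → i ≡ k
  g-injective (inj₁ _) (inj₁ _) eq = inj₁-≡ (scaled-≡ (cong x₁ eq) (cong x₃ eq)) (-‿injective (scaled-≡ (cong x₁ eq) (cong x₂ eq)))
  g-injective (inj₁ _) (inj₂ (inj₁ _)) eq = contradiction (cong x₁ eq) 1≢c*0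
  g-injective (inj₁ _) (inj₂ (inj₂ _)) eq = contradiction (cong x₁ eq) 1≢c*0
  g-injective i@(inj₂ (inj₁ _)) k@(inj₁ _) {c} eq = contradiction
    (trans eq (trans (cong (_⊛ g k) (0≡c*1⇒c≡0 (cong x₁ eq))) (⊛-zeroˡ (g k)))) (g≢𝟎 i)
  g-injective i@(inj₂ (inj₂ _)) k@(inj₁ _) {c} eq = contradiction
    (trans eq (trans (cong (_⊛ g k) (0≡c*1⇒c≡0 (cong x₁ eq))) (⊛-zeroˡ (g k)))) (g≢𝟎 i)
  g-injective (inj₂ (inj₁ (α , _))) (inj₂ (inj₁ (β , _))) {c} eq = cong (inj₂ ∘ inj₁) (𝔽-≡ (*-cancelˡ δ≢0 (begin
    δ * α                          ≡⟨ cong (δ *_) (cong x₃ eq) ⟩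
    δ * (c * β)                    ≡⟨ solve 3 (λ d c β → d :* (c :* β) := :- ((c :* (:- d :- β) :+ c :* β) :* β)) refl δ c β ⟩
    - ((c * (- δ - β) + c * β) * β) ≡⟨ cong (λ z → - (z * β)) (cong₂ _+_ (cong x₂ eq) (cong x₃ eq)) ⟨
    - (((- δ - α) + α) * β)        ≡⟨ solve 3 (λ d α β → :- (((:- d :- α) :+ α) :* β) := d :* β) refl δ α β ⟩
    δ * β                          ∎)))
    where open ≡-Reasoning
  g-injective (inj₂ (inj₁ (α , _))) (inj₂ (inj₂ _)) {c} eq = contradiction (begin
    δ                              ≡⟨ solve 2 (λ d α → d := :- ((:- d :- α) :+ α)) refl δ α ⟩
    - ((- δ - α) + α)              ≡⟨ cong -_ (cong₂ _+_ (cong x₂ eq) (cong x₃ eq)) ⟩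
    - (c * (- 1#) + c * 1#)        ≡⟨ solve 1 (λ c → :- (c :* (:- 𝟙) :+ c :* 𝟙) := 𝟘) refl c ⟩
    0#                             ∎) δ≢0
    where open ≡-Reasoning
  g-injective (inj₂ (inj₂ _)) (inj₂ (inj₁ (β , _))) {c} eq = contradiction (trans (sym (trans (cong (_* β) c≡0) (zeroˡ β)))
      (sym (cong x₃ eq))) 0≢1
    where
    open ≡-Reasoning
    c≡0 : c ≡ 0#
    c≡0 = x*y≡0⇒y≡0 δ≢0 (begin
      δ * c                          ≡⟨ solve 3 (λ d c β → d :* c := :- (c :* (:- d :- β) :+ c :* β)) refl δ c β ⟩
      - (c * (- δ - β) + c * β)      ≡⟨ cong -_ (cong₂ _+_ (cong x₂ eq) (cong x₃ eq)) ⟨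
      - (- 1# + 1#)                  ≡⟨ solve 1 (λ c → :- (:- 𝟙 :+ 𝟙) := 𝟘) refl c ⟩
      0#                             ∎)
  g-injective (inj₂ (inj₂ _)) (inj₂ (inj₂ _)) eq = refl

  normalise : ∀ {v} → FqVec v → v ≢ 𝟎 → ∃ λ i → ∃ λ c → Fq c × c ≢ 0# × v ≡ c ⊛ h i
  normalise {⟨ x , y , z ⟩} (fx , fy , fz) v≢𝟎 = go (x ≟ 0#) (y ≟ 0#) (z ≟ 0#)
    where
    Goal = ∃ λ i → ∃ λ c → Fq c × c ≢ 0# × ⟨ x , y , z ⟩ ≡ c ⊛ h i
    go : Dec (x ≡ 0#) → Dec (y ≡ 0#) → Dec (z ≡ 0#) → Goal
    go (no x≢0) _ _ = inj₁ ((x ⁻¹ * y , Fq-* (Fq-⁻¹ x≢0 fx) fy) , (x ⁻¹ * z , Fq-* (Fq-⁻¹ x≢0 fx) fz)) , x , fx , x≢0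
      , vec-≡ (sym (*-identityʳ x)) (sym (x*[x⁻¹*y]≡y x≢0)) (sym (x*[x⁻¹*y]≡y x≢0))
    go (yes x≡0) (no y≢0) _ = inj₂ (inj₁ (y ⁻¹ * z , Fq-* (Fq-⁻¹ y≢0 fy) fz)) , y , fy , y≢0
      , vec-≡ (trans x≡0 (sym (zeroʳ y))) (sym (*-identityʳ y)) (sym (x*[x⁻¹*y]≡y y≢0))
    go (yes x≡0) (yes y≡0) (no z≢0) = inj₂ (inj₂ tt) , z , fz , z≢0
      , vec-≡ (trans x≡0 (sym (zeroʳ z))) (trans y≡0 (sym (zeroʳ z))) (sym (*-identityʳ z))
    go (yes x≡0) (yes y≡0) (yes z≡0) = contradiction (vec-≡ x≡0 y≡0 z≡0) v≢𝟎

  count-Point : Fin (q ℕ.* q ℕ.+ (q ℕ.+ 1)) ↔ Point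
  count-Point = (count-𝔽 ×-count count-𝔽) ⊎-count (count-𝔽 ⊎-count Fin.1↔⊤)

-- The embedding of the exterior square of W into K.

module Coordinates (q : ℕ) (q-primePower : IsPrimePower q) (K : FiniteField (q ℕ.^ 4)) where
  open Vectors q q-primePower K public
  open Basis basis public

  private
    𝟘 : ∀ {m} → Polynomial m
    𝟘 = con (ℤ.+ 0)

  φ-injective-0 : ∀ {x} → φ x ≡ 0# → x ≡ 0#
  φ-injective-0 {x} eq = trans (sym (φ⁴≡id x)) (trans (cong (φ ∘ φ ∘ φ) eq) (trans (cong (φ ∘ φ) φ-0) (trans (cong φ φ-0) φ-0)))

  -- As a function of both arguments `rmap` is an alternating form, bilinear over F_q; antisymmetry
  -- transfers the left laws to the right.
  rmap-anti : ∀ x y → rmap x y ≡ - rmap y x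
  rmap-anti x y = solve 4 (λ x x′ y y′ → x :* y′ :- x′ :* y := :- (y :* x′ :- y′ :* x)) refl x (φ x) y (φ y)

  rmap-+ˡ : ∀ x y z → rmap (x + y) z ≡ rmap x z + rmap y z
  rmap-+ˡ x y z = trans (cong (λ t → (x + y) * φ z - t * z) (φ-+ x y))
    (solve 6 (λ x x′ y y′ z z′ → (x :+ y) :* z′ :- (x′ :+ y′) :* z := (x :* z′ :- x′ :* z) :+ (y :* z′ :- y′ :* z)) refl x
        (φ x) y (φ y) z (φ z))

  rmap-*ˡ : ∀ {c} → Fq c → ∀ x z → rmap (c * x) z ≡ c * rmap x z
  rmap-*ˡ {c} fc x z = trans (cong (λ t → (c * x) * φ z - t * z) (trans (φ-* c x) (cong (_* φ x) fc)))
    (solve 5 (λ c x x′ z z′ → (c :* x) :* z′ :- (c :* x′) :* z := c :* (x :* z′ :- x′ :* z)) refl c x (φ x) z (φ z))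

  rmap-+ʳ : ∀ x y z → rmap x (y + z) ≡ rmap x y + rmap x z
  rmap-+ʳ x y z = trans (rmap-anti x (y + z)) (trans (cong -_ (rmap-+ˡ y z x)) (trans
    (solve 2 (λ a b → :- (a :+ b) := (:- a) :+ (:- b)) refl (rmap y x) (rmap z x))
    (cong₂ _+_ (sym (rmap-anti x y)) (sym (rmap-anti x z)))))

  rmap-*ʳ : ∀ {c} → Fq c → ∀ x z → rmap x (c * z) ≡ c * rmap x z
  rmap-*ʳ {c} fc x z = trans (rmap-anti x (c * z)) (trans (cong -_ (rmap-*ˡ fc z x)) (trans
    (solve 2 (λ c a → :- (c :* a) := c :* (:- a)) refl c (rmap z x)) (cong (c *_) (sym (rmap-anti x z)))))

  rmap-self : ∀ x → rmap x x ≡ 0#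
  rmap-self x = solve 2 (λ x y → x :* y :- y :* x := 𝟘) refl x (φ x)

  -- The equation x y^q = x^q y says that y / x is fixed by Frobenius.
  rmap≡0⇒proportional : ∀ {x y} → x ≢ 0# → rmap x y ≡ 0# → ∃ λ c → Fq c × y ≡ c * x
  rmap≡0⇒proportional {x} {y} x≢0 eq = c , *-cancelˡ φx≢0 (*-cancelˡ x≢0 (begin
      x * (φ x * φ c)       ≡⟨ cong (x *_) (trans (sym (φ-* x c)) (cong φ (sym y≡xc))) ⟩
      x * φ y               ≡⟨ x-y≡0⇒x≡y eq ⟩
      φ x * y               ≡⟨ cong (φ x *_) y≡xc ⟩
      φ x * (x * c)         ≡⟨ solve 3 (λ x y c → y :* (x :* c) := x :* (y :* c)) refl x (φ x) c ⟩
      x * (φ x * c)         ∎))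
    , trans y≡xc (*-comm x c)
    where
    open ≡-Reasoning
    c = x ⁻¹ * y
    y≡xc : y ≡ x * c
    y≡xc = sym (x*[x⁻¹*y]≡y x≢0)
    φx≢0 : φ x ≢ 0#
    φx≢0 = x≢0 ∘ φ-injective-0

  -- The 2 × 2 determinant of (x, x^q) and (y, y^q) is rmap x y.
  moore : ∀ {α β x y} → rmap x y ≢ 0# → α * x + β * φ x ≡ 0# → α * y + β * φ y ≡ 0# → α ≡ 0# × β ≡ 0#
  moore {α} {β} {x} {y} d≢0 eq-x eq-y = x*y≡0⇒y≡0 d≢0 α-eq , x*y≡0⇒y≡0 d≢0 β-eq
    where
    α-eq : rmap x y * α ≡ 0#
    α-eq = trans (solve 6 (λ α β x x′ y y′ → (x :* y′ :- x′ :* y) :* α := y′ :* (α :* x :+ β :* x′) :- x′ :*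
        (α :* y :+ β :* y′)) refl α β x (φ x) y (φ y))
      (trans (cong₂ (λ s t → φ y * s - φ x * t) eq-x eq-y) (solve 2 (λ s t → s :* 𝟘 :- t :* 𝟘 := 𝟘) refl (φ y) (φ x)))
    β-eq : rmap x y * β ≡ 0#
    β-eq = trans (solve 6 (λ α β x x′ y y′ → (x :* y′ :- x′ :* y) :* β := x :* (α :* y :+ β :* y′) :- y :*
        (α :* x :+ β :* x′)) refl α β x (φ x) y (φ y))
      (trans (cong₂ (λ s t → x * s - y * t) eq-y eq-x) (solve 2 (λ s t → s :* 𝟘 :- t :* 𝟘 := 𝟘) refl x y))

  comb-⊞ : ∀ v w → comb (v ⊞ w) ≡ comb v + comb w
  comb-⊞ ⟨ a , b , c ⟩ ⟨ x , y , z ⟩ = solve 9 (λ a b c x y z e f g →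
    (a :+ x) :* e :+ (b :+ y) :* f :+ (c :+ z) :* g := (a :* e :+ b :* f :+ c :* g) :+
        (x :* e :+ y :* f :+ z :* g)) refl a b c x y z e₁ e₂ e₃

  comb-⊛ : ∀ c v → comb (c ⊛ v) ≡ c * comb v
  comb-⊛ c ⟨ x , y , z ⟩ = solve 7 (λ c x y z e f g →
    (c :* x) :* e :+ (c :* y) :* f :+ (c :* z) :* g := c :* (x :* e :+ y :* f :+ z :* g)) refl c x y z e₁ e₂ e₃

  comb-𝟎 : comb 𝟎 ≡ 0#
  comb-𝟎 = solve 3 (λ e f g → 𝟘 :* e :+ 𝟘 :* f :+ 𝟘 :* g := 𝟘) refl e₁ e₂ e₃

  infixl 6 _⊟_
  _⊟_ : Vec → Vec → Vec
  v ⊟ w = v ⊞ (- 1#) ⊛ w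

  FqVec-⊟ : ∀ {v w} → FqVec v → FqVec w → FqVec (v ⊟ w)
  FqVec-⊟ fv fw = FqVec-⊞ fv (FqVec-⊛ (Fq-neg Fq-1) fw)

  ⊟≡𝟎 : ∀ {v w} → v ⊟ w ≡ 𝟎 → v ≡ w
  ⊟≡𝟎 {v} {w} eq = vec-≡ (p _ _ (cong x₁ eq)) (p _ _ (cong x₂ eq)) (p _ _ (cong x₃ eq))
    where
    p : ∀ x y → x + - 1# * y ≡ 0# → x ≡ y
    p x y e = x-y≡0⇒x≡y (trans (solve 2 (λ x y → x :- y := x :+ (:- con (ℤ.+ 1)) :* y) refl x y) e)

  private
    minus-1 : ∀ x → - 1# * x ≡ - x
    minus-1 = solve 1 (λ x → (:- con (ℤ.+ 1)) :* x := :- x) refl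

  ∙-⊟ : ∀ v w z → (v ⊟ w) ∙ z ≡ v ∙ z - w ∙ z
  ∙-⊟ v w z = trans (∙-⊞ v _ z) (cong (v ∙ z +_) (trans (∙-⊛ (- 1#) w z) (minus-1 _)))

  comb-⊟ : ∀ v w → comb (v ⊟ w) ≡ comb v - comb w
  comb-⊟ v w = trans (comb-⊞ v _) (cong (comb v +_) (trans (comb-⊛ _ w) (minus-1 _)))

  comb-injective : ∀ {v w} → FqVec v → FqVec w → comb v ≡ comb w → v ≡ w
  comb-injective fv fw eq = ⊟≡𝟎 (independent (FqVec-⊟ fv fw) (trans (comb-⊟ _ _) (x≡y⇒x-y≡0 eq)))

  -- The linear map Λ²W → K, v ∧ w ↦ v w^q − v^q w, with Λ²W identified with 𝔽³ by the cross product.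
  u : Vec → Carrier
  u v = x₁ v * rmap e₂ e₃ + x₂ v * rmap e₃ e₁ + x₃ v * rmap e₁ e₂

  u-⊞ : ∀ v w → u (v ⊞ w) ≡ u v + u w
  u-⊞ ⟨ a , b , c ⟩ ⟨ x , y , z ⟩ = solve 9 (λ a b c x y z e f g →
    (a :+ x) :* e :+ (b :+ y) :* f :+ (c :+ z) :* g := (a :* e :+ b :* f :+ c :* g) :+
        (x :* e :+ y :* f :+ z :* g)) refl a b c x y z (rmap e₂ e₃) (rmap e₃ e₁) (rmap e₁ e₂)

  u-⊛ : ∀ c v → u (c ⊛ v) ≡ c * u v
  u-⊛ c ⟨ x , y , z ⟩ = solve 7 (λ c x y z e f g →
    (c :* x) :* e :+ (c :* y) :* f :+ (c :* z) :* g := c :* (x :* e :+ y :* f :+ z :* g)) refl c x y z (rmap e₂ e₃)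
        (rmap e₃ e₁) (rmap e₁ e₂)

  u-⊟ : ∀ v w → u (v ⊟ w) ≡ u v - u w
  u-⊟ v w = trans (u-⊞ v _) (cong (u v +_) (trans (u-⊛ _ w) (minus-1 _)))

  φ-comb : ∀ {v} → FqVec v → φ (comb v) ≡ x₁ v * φ e₁ + x₂ v * φ e₂ + x₃ v * φ e₃
  φ-comb (f₁ , f₂ , f₃) = trans (φ-+ _ _) (cong₂ _+_ (trans (φ-+ _ _) (cong₂ _+_ (φ-c* f₁) (φ-c* f₂))) (φ-c* f₃))
    where
    φ-c* : ∀ {c x} → Fq c → φ (c * x) ≡ c * φ x
    φ-c* {c} {x} fc = trans (φ-* c x) (cong (_* φ x) fc)

  -- The Binet-Cauchy identity (v · e)(w · f) - (v · f)(w · e) = (v × w) · (e × f), with f the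
  -- Frobenius image of the basis e.
  rmap-comb : ∀ {v w} → FqVec v → FqVec w → rmap (comb v) (comb w) ≡ u (v ⨯ w)
  rmap-comb {⟨ a , b , c ⟩} {⟨ x , y , z ⟩} fv fw = trans
    (cong₂ (λ s t → comb ⟨ a , b , c ⟩ * s - t * comb ⟨ x , y , z ⟩) (φ-comb fw) (φ-comb fv))
    (solve 12 (λ a b c x y z e f g e′ f′ g′ →
      (a :* e :+ b :* f :+ c :* g) :* (x :* e′ :+ y :* f′ :+ z :* g′) :- (a :* e′ :+ b :* f′ :+ c :* g′) :* (x :* e :+ y :* f :+ z :* g) :=
      (b :* z :- c :* y) :* (f :* g′ :- f′ :* g) :+ (c :* x :- a :* z) :* (g :* e′ :- g′ :* e) :+ (a :* y :- b :* x) :*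
          (e :* f′ :- e′ :* f))
      refl a b c x y z e₁ e₂ e₃ (φ e₁) (φ e₂) (φ e₃))

  h≢𝟎 : ∀ i → h i ≢ 𝟎
  h≢𝟎 i eq = 0≢1 (trans (sym (trans (∙-comm 𝟎 (j i)) (∙-zeroʳ (j i)))) (trans (cong (_∙ j i) (sym eq)) (h∙j≡1 i)))

  -- Every element of Λ²W is decomposable, since dim W = 3.
  u-h≢0 : ∀ i → u (h i) ≢ 0#
  u-h≢0 i eq = go (rmap≡0⇒proportional comb-a≢0 (trans (rmap-comb (FqVec-a i) (FqVec-b i)) (trans (cong u (a⨯b≡h i)) eq)))
    where
    comb-a≢0 : comb (a i) ≢ 0#
    comb-a≢0 e = h≢𝟎 i (trans (sym (a⨯b≡h i)) (trans (cong (_⨯ b i) (trans (independent (FqVec-a i) e) (sym (⊛-zeroˡ 𝟎))))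
      (trans (⨯-⊛ˡ 0# 𝟎 (b i)) (⊛-zeroˡ (𝟎 ⨯ b i)))))
    go : ¬ (∃ λ c → Fq c × comb (b i) ≡ c * comb (a i))
    go (c , fc , e) = h≢𝟎 i (begin
      h i                ≡⟨ a⨯b≡h i ⟨
      a i ⨯ b i          ≡⟨ cong (a i ⨯_) (comb-injective (FqVec-b i) (FqVec-⊛ fc (FqVec-a i)) (trans e (sym (comb-⊛ c (a i))))) ⟩
      a i ⨯ (c ⊛ a i)    ≡⟨ ⨯-⊛ʳ c (a i) (a i) ⟩
      c ⊛ (a i ⨯ a i)    ≡⟨ cong (c ⊛_) (⨯-self (a i)) ⟩
      c ⊛ 𝟎              ≡⟨ ⊛-zeroʳ c ⟩
      𝟎                  ∎)
      where open ≡-Reasoning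

  _≟ⱽ_ : (v w : Vec) → Dec (v ≡ w)
  ⟨ a , b , c ⟩ ≟ⱽ ⟨ x , y , z ⟩ = map′ (λ (p , r , s) → vec-≡ p r s)
    (λ e → cong x₁ e , cong x₂ e , cong x₃ e) (a ≟ x ×-dec (b ≟ y ×-dec c ≟ z))

  -- A nonzero vector over F_q is a multiple of some `h i`, which reduces this to `u-h≢0`. The
  -- restriction to F_q is essential: on all of K³ the map has a kernel.
  u-kernel : ∀ {v} → FqVec v → u v ≡ 0# → v ≡ 𝟎
  u-kernel {v} fv eq = decidable-stable (v ≟ⱽ 𝟎) λ v≢𝟎 → go (normalise fv v≢𝟎)
    where
    go : ¬ (∃ λ i → ∃ λ c → Fq c × c ≢ 0# × v ≡ c ⊛ h i)
    go (i , c , fc , c≢0 , e) = u-h≢0 i (x*y≡0⇒y≡0 c≢0 (trans (sym (u-⊛ c (h i))) (trans (cong u (sym e)) eq)))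

  u-injective : ∀ {v w} → FqVec v → FqVec w → u v ≡ u w → v ≡ w
  u-injective fv fw eq = ⊟≡𝟎 (u-kernel (FqVec-⊟ fv fw) (trans (u-⊟ _ _) (x≡y⇒x-y≡0 eq)))

  abstract
    outside-u : ∃ λ e → ∀ {v} → FqVec v → u v ≢ e
    outside-u = go (<⇒missed count-𝔽³ count-K (ℕ-^-<) f)
      where
      f : 𝔽³ → Carrier
      f ((a , _) , (b , _) , (c , _)) = u ⟨ a , b , c ⟩
      ℕ-^-< : q ℕ.^ 3 ℕ.< q ℕ.^ 4
      ℕ-^-< = ℕ.^-monoʳ-< q 1<q {3} {4} ℕ.≤-refl
      go : (∃ λ e → ∀ x → f x ≢ e) → ∃ λ e → ∀ {v} → FqVec v → u v ≢ e
      go (e , miss) = e , λ (fa , fb , fc) → miss ((_ , fa) , (_ , fb) , (_ , fc))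

  e′ : Carrier
  e′ = proj₁ outside-u

  e′-independent : ∀ {β v} → Fq β → FqVec v → β * e′ ≡ u v → β ≡ 0#
  e′-independent {β} {v} fβ fv eq = decidable-stable (β ≟ 0#) λ β≢0 →
    proj₂ outside-u (FqVec-⊛ (Fq-⁻¹ β≢0 fβ) fv) (trans (u-⊛ _ v) (trans (cong (β ⁻¹ *_) (sym eq)) (x⁻¹*[x*y]≡y β≢0)))

  -- z ↦ z − z^q has image in the trace-zero elements, and r x^q − r^q x = x^{q+1} (z − z^q) for z = r / x.
  e₀x^q+1≢rmap : ∀ {x} → x ≢ 0# → ∀ r → e₀ * (x * φ x) ≢ rmap r x
  e₀x^q+1≢rmap {x} x≢0 r eq = Tr-e₀≢0 (begin
    Tr e₀                ≡⟨ cong Tr (*-cancelˡ xφx≢0 e₀-eq) ⟩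
    Tr (z - φ z)         ≡⟨ Tr-+ z (- φ z) ⟩
    Tr z + Tr (- φ z)    ≡⟨ cong (Tr z +_) (trans (Tr-neg (φ z)) (cong -_ (Tr-φ z))) ⟩
    Tr z - Tr z          ≡⟨ -‿inverseʳ _ ⟩
    0#                   ∎)
    where
    open ≡-Reasoning
    z = x ⁻¹ * r
    r≡xz : r ≡ x * z
    r≡xz = sym (x*[x⁻¹*y]≡y x≢0)
    xφx≢0 : x * φ x ≢ 0#
    xφx≢0 = x*y≢0 x≢0 (x≢0 ∘ φ-injective-0)
    e₀-eq : (x * φ x) * e₀ ≡ (x * φ x) * (z - φ z)
    e₀-eq = begin
      (x * φ x) * e₀                  ≡⟨ *-comm _ e₀ ⟩
      e₀ * (x * φ x)                  ≡⟨ eq ⟩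
      r * φ x - φ r * x               ≡⟨ cong₂ (λ s t → s * φ x - t * x) r≡xz (trans (cong φ r≡xz) (φ-* x z)) ⟩
      (x * z) * φ x - (φ x * φ z) * x
        ≡⟨ solve 4 (λ x x′ z z′ → (x :* z) :* x′ :- (x′ :* z′) :* x := (x :* x′) :* (z :- z′)) refl x (φ x) z (φ z) ⟩
      (x * φ x) * (z - φ z)           ∎

-- Planes, their intersections and codes given by indexed families.

module Planes (q : ℕ) (q-primePower : IsPrimePower q) (K : FiniteField (q ℕ.^ 4)) where
  open Coordinates q q-primePower K public
  open Construction K q public using (Vec2; VSet; _⊕_; _·_; 𝟘; lincomb; Independent; InSpan; _≐_; _∩_;
    IsSubspaceOfDim; Plane; S; Family; IsPlaneCode; HasSize; Γ; gmap; InR; Indep₂; Span₂; Line; N; 𝒞; augment)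

  open Equivalence using (to; from)

  ≐-refl : ∀ {P} → P ≐ P
  ≐-refl _ = mk⇔ id id

  ≐-sym : ∀ {P Q} → P ≐ Q → Q ≐ P
  ≐-sym P≐Q w = mk⇔ (from (P≐Q w)) (to (P≐Q w))

  ≐-trans : ∀ {P Q R} → P ≐ Q → Q ≐ R → P ≐ R
  ≐-trans P≐Q Q≐R w = mk⇔ (to (Q≐R w) ∘ to (P≐Q w)) (from (P≐Q w) ∘ from (Q≐R w))

  dimension-≐ : ∀ {P Q m} → P ≐ Q → IsSubspaceOfDim Q m → IsSubspaceOfDim P m
  dimension-≐ P≐Q (b , b∈W , ind , Q≐) = b , b∈W , ind , ≐-trans P≐Q Q≐

  triple : {A : Set} → A → A → A → Fin 3 → A
  triple x y z zero             = x
  triple x y z (suc zero)       = y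
  triple x y z (suc (suc zero)) = z

  ∀-triple : {P : Fin 3 → Set} → P zero → P (suc zero) → P (suc (suc zero)) → ∀ i → P i
  ∀-triple p₀ p₁ p₂ zero             = p₀
  ∀-triple p₀ p₁ p₂ (suc zero)       = p₁
  ∀-triple p₀ p₁ p₂ (suc (suc zero)) = p₂

  lincomb₃ : ∀ c₁ c₂ c₃ a₁ b₁ a₂ b₂ a₃ b₃ →
    lincomb 3 (triple c₁ c₂ c₃) (triple (a₁ , b₁) (a₂ , b₂) (a₃ , b₃)) ≡
    (⟨ c₁ , c₂ , c₃ ⟩ ∙ ⟨ a₁ , a₂ , a₃ ⟩ , ⟨ c₁ , c₂ , c₃ ⟩ ∙ ⟨ b₁ , b₂ , b₃ ⟩)
  lincomb₃ c₁ c₂ c₃ a₁ b₁ a₂ b₂ a₃ b₃ = cong₂ _,_ (eq a₁ a₂ a₃) (eq b₁ b₂ b₃)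
    where
    eq : ∀ x y z → c₁ * x + (c₂ * y + (c₃ * z + 0#)) ≡ c₁ * x + c₂ * y + c₃ * z
    eq x y z = solve 6 (λ a b c x y z → a :* x :+ (b :* y :+ (c :* z :+ con (ℤ.+ 0))) := a :* x :+ b :* y :+ c :* z) refl c₁ c₂ c₃ x y z

  -- `a` and `b` collect the first and the second components of the three basis vectors, so that a
  -- linear combination becomes a pair of dot products.
  plane-from-basis : ∀ {P : VSet} (a b : Vec) → W (x₁ a) → W (x₂ a) → W (x₃ a) →
    (∀ {c} → FqVec c → c ∙ a ≡ 0# → c ∙ b ≡ 0# → c ≡ 𝟎) →
    (∀ {x y} → P (x , y) → Σ Vec λ c → FqVec c × x ≡ c ∙ a × y ≡ c ∙ b) →
    (∀ {x y c} → FqVec c → x ≡ c ∙ a → y ≡ c ∙ b → P (x , y)) →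
    Plane P
  plane-from-basis {P} ⟨ a₁ , a₂ , a₃ ⟩ ⟨ b₁ , b₂ , b₃ ⟩ w₁ w₂ w₃ ind coords member =
    basis-vectors , ∀-triple w₁ w₂ w₃ , independent-vectors , λ w → mk⇔ (forward w) (backward w)
    where
    a⃗ = ⟨ a₁ , a₂ , a₃ ⟩
    b⃗ = ⟨ b₁ , b₂ , b₃ ⟩
    basis-vectors = triple (a₁ , b₁) (a₂ , b₂) (a₃ , b₃)
    collect : ∀ (c : Fin 3 → Carrier) → let c⃗ = ⟨ c zero , c (suc zero) , c (suc (suc zero)) ⟩ in
      lincomb 3 c basis-vectors ≡ (c⃗ ∙ a⃗ , c⃗ ∙ b⃗)
    collect c = lincomb₃ (c zero) (c (suc zero)) (c (suc (suc zero))) a₁ b₁ a₂ b₂ a₃ b₃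
    independent-vectors : Independent 3 basis-vectors
    independent-vectors c fc eq = ∀-triple (cong x₁ c≡𝟎) (cong x₂ c≡𝟎) (cong x₃ c≡𝟎)
      where
      c≡𝟎 = ind (fc zero , fc (suc zero) , fc (suc (suc zero)))
        (trans (sym (cong proj₁ (collect c))) (cong proj₁ eq)) (trans (sym (cong proj₂ (collect c))) (cong proj₂ eq))
    forward : ∀ w → P w → InSpan 3 basis-vectors w
    forward (x , y) p with coords p
    ... | ⟨ c₁ , c₂ , c₃ ⟩ , (f₁ , f₂ , f₃) , x≡ , y≡ = triple c₁ c₂ c₃ , ∀-triple f₁ f₂ f₃ ,
      trans (cong₂ _,_ x≡ y≡) (sym (lincomb₃ c₁ c₂ c₃ a₁ b₁ a₂ b₂ a₃ b₃))
    backward : ∀ w → InSpan 3 basis-vectors w → P w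
    backward (x , y) (c , fc , eq) = member (fc zero , fc (suc zero) , fc (suc (suc zero)))
      (trans (cong proj₁ eq) (cong proj₁ (collect c))) (trans (cong proj₂ eq) (cong proj₂ (collect c)))

  lincomb-⊕ : ∀ m (c d : Fin m → Carrier) v → lincomb m (λ i → c i + d i) v ≡ lincomb m c v ⊕ lincomb m d v
  lincomb-⊕ zero c d v = cong₂ _,_ (sym (+-identityˡ 0#)) (sym (+-identityˡ 0#))
  lincomb-⊕ (suc m) c d v = trans (cong (((c zero + d zero) · v zero) ⊕_) (lincomb-⊕ m (c ∘ suc) (d ∘ suc) (v ∘ suc)))
      (cong₂ _,_ (eq _ _ _) (eq _ _ _))
    where
    eq : ∀ x y z → (c zero + d zero) * x + (y + z) ≡ (c zero * x + y) + (d zero * x + z)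
    eq x y z = solve 5 (λ c d x y z → (c :+ d) :* x :+ (y :+ z) := (c :* x :+ y) :+ (d :* x :+ z)) refl (c zero) (d zero) x y z

  lincomb-· : ∀ m a (c : Fin m → Carrier) v → lincomb m (λ i → a * c i) v ≡ a · lincomb m c v
  lincomb-· zero a c v = cong₂ _,_ (sym (zeroʳ a)) (sym (zeroʳ a))
  lincomb-· (suc m) a c v = trans (cong (((a * c zero) · v zero) ⊕_) (lincomb-· m a (c ∘ suc) (v ∘ suc))) (cong₂ _,_ (eq _ _) (eq _ _))
    where
    eq : ∀ x y → (a * c zero) * x + a * y ≡ a * (c zero * x + y)
    eq x y = solve 4 (λ a c x y → (a :* c) :* x :+ a :* y := a :* (c :* x :+ y)) refl a (c zero) x y

  lincomb-W : ∀ m {c : Fin m → Carrier} {v} → (∀ i → Fq (c i)) → (∀ i → W (proj₁ (v i))) → W (proj₁ (lincomb m c v))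
  lincomb-W zero fc wv = W-0
  lincomb-W (suc m) fc wv = W-+ (W-* (fc zero) (wv zero)) (lincomb-W m (fc ∘ suc) (wv ∘ suc))

  closed-⊕ : ∀ {P m} → IsSubspaceOfDim P m → ∀ {v w} → P v → P w → P (v ⊕ w)
  closed-⊕ {m = m} (b , _ , _ , P≐) {v} {w} pv pw with to (P≐ v) pv | to (P≐ w) pw
  ... | c , fc , eq | d , fd , eq′ = from (P≐ _) (_ , (λ i → Fq-+ (fc i) (fd i)) , trans (cong₂ _⊕_ eq eq′) (sym (lincomb-⊕ m c d b)))

  closed-· : ∀ {P m} → IsSubspaceOfDim P m → ∀ {c v} → Fq c → P v → P (c · v)
  closed-· {m = m} (b , _ , _ , P≐) {a} {v} fa pv with to (P≐ v) pv
  ... | c , fc , eq = from (P≐ _) (_ , (λ i → Fq-* fa (fc i)) , trans (cong (a ·_) eq) (sym (lincomb-· m a c b)))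

  contains-𝟘 : ∀ {P m} → IsSubspaceOfDim P m → P 𝟘
  contains-𝟘 {P} {m} (b , _ , _ , P≐) = from (P≐ 𝟘) ((λ _ → 0#) , (λ _ → Fq-0) , sym (zero-comb m b))
    where
    zero-comb : ∀ m (b : Fin m → Vec2) → lincomb m (λ _ → 0#) b ≡ 𝟘
    zero-comb zero b = refl
    zero-comb (suc m) b = trans (cong ((0# · b zero) ⊕_) (zero-comb m (b ∘ suc))) (cong₂ _,_ (eq _) (eq _))
      where
      eq : ∀ x → 0# * x + 0# ≡ 0#
      eq x = trans (+-identityʳ _) (zeroˡ x)

  inside-V : ∀ {P m} → IsSubspaceOfDim P m → ∀ {v} → P v → W (proj₁ v)
  inside-V {m = m} (b , bW , _ , P≐) {v} pv with to (P≐ v) pv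
  ... | c , fc , refl = lincomb-W m fc bW

  _≟²_ : (v w : Vec2) → Dec (v ≡ w)
  (a , b) ≟² (c , d) = map′ (λ (p , r) → cong₂ _,_ p r) (λ e → cong proj₁ e , cong proj₂ e) (a ≟ c ×-dec b ≟ d)

  exists²? : {P : Vec2 → Set} → (∀ v → Dec (P v)) → Dec (∃ P)
  exists²? P? = map′ (λ (x , y , p) → (x , y) , p) (λ ((x , y) , p) → x , y , p) (exists? λ x → exists? λ y → P? (x , y))

  -- A finite search over coefficients; it allows common vectors of two planes to be found
  -- constructively.
  plane? : ∀ {P} → Plane P → ∀ w → Dec (P w)
  plane? (b , _ , _ , P≐) w = map′
    (λ (c₁ , c₂ , c₃ , f₁ , f₂ , f₃ , eq) → from (P≐ w) (triple c₁ c₂ c₃ , ∀-triple f₁ f₂ f₃ , eq))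
    (λ p → let (c , fc , eq) = to (P≐ w) p in _ , _ , _ , fc zero , fc (suc zero) , fc (suc (suc zero)) , eq)
    (exists? λ c₁ → exists? λ c₂ → exists? λ c₃ →
      Fq? c₁ ×-dec (Fq? c₂ ×-dec (Fq? c₃ ×-dec (w ≟² lincomb 3 (triple c₁ c₂ c₃) b))))

  Proportional : Vec2 → Vec2 → Set
  Proportional v w = ∃ λ c → Fq c × w ≡ c · v

  proportional? : ∀ v w → Dec (Proportional v w)
  proportional? v w = exists? λ c → Fq? c ×-dec (w ≟² (c · v))

  -- dim (P ∩ Q) ≥ 2
  Common : VSet → VSet → Set
  Common P Q = Σ Vec2 λ v → Σ Vec2 λ w → (P v × Q v) × (P w × Q w) × v ≢ 𝟘 × ¬ Proportional v w

  ·-identity : ∀ v → 1# · v ≡ v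
  ·-identity v = cong₂ _,_ (*-identityˡ _) (*-identityˡ _)

  ·-zero : ∀ v → 0# · v ≡ 𝟘
  ·-zero v = cong₂ _,_ (zeroˡ _) (zeroˡ _)

  scale-nonzero : ∀ {c v} → v ≢ 𝟘 → c · v ≡ 𝟘 → c ≡ 0#
  scale-nonzero {c} {v} v≢𝟘 eq = decidable-stable (c ≟ 0#) λ c≢0 →
    v≢𝟘 (cong₂ _,_ (x*y≡0⇒y≡0 c≢0 (cong proj₁ eq)) (x*y≡0⇒y≡0 c≢0 (cong proj₂ eq)))

  -- A nonzero common vector is searched for. If there is one, it spans the intersection, since a
  -- common vector outside its span would produce `Common`.
  small-intersection : ∀ {P Q} → Plane P → Plane Q → ¬ Common P Q → Σ ℕ λ k → k ℕ.≤ 1 × IsSubspaceOfDim (P ∩ Q) k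
  small-intersection {P} {Q} plane-P plane-Q none = go (exists²? λ v → (plane? plane-P v ×-dec plane? plane-Q v) ×-dec ¬? (v ≟² 𝟘))
    where
    go : Dec (∃ λ v → (P v × Q v) × v ≢ 𝟘) → Σ ℕ λ k → k ℕ.≤ 1 × IsSubspaceOfDim (P ∩ Q) k
    go (no only-𝟘) = 0 , ℕ.z≤n , (λ ()) , (λ ()) , (λ _ _ _ ()) , λ w → mk⇔
      (λ p → (λ ()) , (λ ()) , decidable-stable (w ≟² 𝟘) λ w≢𝟘 → only-𝟘 (w , p , w≢𝟘))
      (λ { (_ , _ , refl) → contains-𝟘 plane-P , contains-𝟘 plane-Q })
    go (yes (v , (pv , qv) , v≢𝟘)) = 1 , ℕ.s≤s ℕ.z≤n , (λ _ → v) , (λ _ → inside-V plane-P pv) , ind , λ w → mk⇔ forward backward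
      where
      one : ∀ c → lincomb 1 c (λ _ → v) ≡ c zero · v
      one c = cong₂ _,_ (+-identityʳ _) (+-identityʳ _)
      ind : Independent 1 (λ _ → v)
      ind c fc eq zero = scale-nonzero v≢𝟘 (trans (sym (one c)) eq)
      forward : ∀ {w} → P w × Q w → InSpan 1 (λ _ → v) w
      forward {w} pw = let (c , fc , eq) = decidable-stable (proportional? v w) (λ ¬prop → none (v , w , (pv , qv) , pw , v≢𝟘 , ¬prop))
        in (λ _ → c) , (λ _ → fc) , trans eq (sym (one (λ _ → c)))
      backward : ∀ {w} → InSpan 1 (λ _ → v) w → P w × Q w
      backward (c , fc , refl) rewrite one c = closed-· plane-P (fc zero) pv , closed-· plane-Q (fc zero) qv

  plane-common : ∀ {P} → Plane P → Common P P
  plane-common {P} (b , bW , ind , P≐) = b₀ , b₁ , (Pb 0′ , Pb 0′) , (Pb 1′ , Pb 1′) , b₀≢𝟘 , ¬prop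
    where
    0′ 1′ 2′ : Fin 3
    0′ = zero
    1′ = suc zero
    2′ = suc (suc zero)
    b₀ = b 0′
    b₁ = b 1′
    expand : ∀ c₁ c₂ → lincomb 3 (triple c₁ c₂ 0#) b ≡ ((c₁ · b₀) ⊕ (c₂ · b₁))
    expand c₁ c₂ = cong₂ _,_ (eq _ _ _) (eq _ _ _)
      where
      eq : ∀ x y z → c₁ * x + (c₂ * y + (0# * z + 0#)) ≡ c₁ * x + c₂ * y
      eq x y z = solve 5 (λ c d x y z → c :* x :+ (d :* y :+ (con (ℤ.+ 0) :* z :+ con (ℤ.+ 0))) := c :* x :+ d :* y) refl c₁ c₂ x y z
    in-P : ∀ {c₁ c₂ w} → Fq c₁ → Fq c₂ → (c₁ · b₀) ⊕ (c₂ · b₁) ≡ w → P w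
    in-P {c₁} {c₂} f₁ f₂ eq = from (P≐ _) (triple c₁ c₂ 0# , ∀-triple f₁ f₂ Fq-0 , trans (sym eq) (sym (expand c₁ c₂)))
    left : ∀ v w → (1# · v) ⊕ (0# · w) ≡ v
    left v w = trans (cong₂ _⊕_ (·-identity v) (·-zero w)) (cong₂ _,_ (+-identityʳ _) (+-identityʳ _))
    right : ∀ v w → (0# · v) ⊕ (1# · w) ≡ w
    right v w = trans (cong₂ _⊕_ (·-zero v) (·-identity w)) (cong₂ _,_ (+-identityˡ _) (+-identityˡ _))
    Pb : ∀ (i : Fin 3) → P (triple b₀ b₁ b₀ i)
    Pb = ∀-triple (in-P Fq-1 Fq-0 (left b₀ b₁)) (in-P Fq-0 Fq-1 (right b₀ b₁)) (in-P Fq-1 Fq-0 (left b₀ b₁))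
    b₀≢𝟘 : b₀ ≢ 𝟘
    b₀≢𝟘 e = 0≢1 (sym (ind (triple 1# 0# 0#) (∀-triple Fq-1 Fq-0 Fq-0) (trans (expand 1# 0#) (trans (left b₀ b₁) e)) 0′))
    ¬prop : ¬ Proportional b₀ b₁
    ¬prop (c , fc , e) = 0≢1 (sym (ind (triple (- c) 1# 0#) (∀-triple (Fq-neg fc) Fq-1 Fq-0)
      (trans (expand (- c) 1#) (trans (cong (λ z → ((- c) · b₀) ⊕ (1# · z)) e) (cong₂ _,_ (cancel _) (cancel _)))) 1′))
      where
      cancel : ∀ x → - c * x + 1# * (c * x) ≡ 0#
      cancel x = solve 2 (λ c x → (:- c) :* x :+ con (ℤ.+ 1) :* (c :* x) := con (ℤ.+ 0)) refl c x

  Common-≐ : ∀ {P P′ Q Q′} → P ≐ P′ → Q ≐ Q′ → Common P Q → Common P′ Q′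
  Common-≐ P≐ Q≐ (v , w , (pv , qv) , (pw , qw) , rest) =
    v , w , (to (P≐ v) pv , to (Q≐ v) qv) , (to (P≐ w) pw , to (Q≐ w) qw) , rest

  Common-sym : ∀ {P Q} → Common P Q → Common Q P
  Common-sym (v , w , (pv , qv) , (pw , qw) , rest) = v , w , (qv , pv) , (qw , pw) , rest

  ≐⇒Common : ∀ {P Q} → Plane P → P ≐ Q → Common P Q
  ≐⇒Common plane P≐Q = Common-≐ ≐-refl P≐Q (plane-common plane)

  -- The projection of a 2-dimensional common subspace to W has rank 2, 1 or 0, and the three
  -- constructors give a basis adapted to the rank.
  data CommonPair (P Q : VSet) : Set where
    graph : ∀ {x y x′ y′} → P (x , y) → Q (x , y) → P (x′ , y′) → Q (x′ , y′) → rmap x x′ ≢ 0# → CommonPair P Q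
    mixed : ∀ {s x y} → P (0# , s) → Q (0# , s) → s ≢ 0# → P (x , y) → Q (x , y) → x ≢ 0# → CommonPair P Q
    vertical : ∀ {s s′} → P (0# , s) → Q (0# , s) → s ≢ 0# → P (0# , s′) → Q (0# , s′) →
      (∀ {c} → Fq c → s′ ≢ c * s) → CommonPair P Q

  split : ∀ {P Q} → Plane P → Plane Q → Common P Q → CommonPair P Q
  split {P} {Q} plane-P plane-Q ((x , y) , (x′ , y′) , (pv , qv) , (pw , qw) , v≢𝟘 , ¬prop) = go (x ≟ 0#) (x′ ≟ 0#) (rmap x x′ ≟ 0#)
    where
    vertical-nonzero : ∀ {x y} → x ≡ 0# → (x , y) ≢ 𝟘 → y ≢ 0#
    vertical-nonzero x≡0 v≢𝟘 y≡0 = v≢𝟘 (cong₂ _,_ x≡0 y≡0)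
    go : Dec (x ≡ 0#) → Dec (x′ ≡ 0#) → Dec (rmap x x′ ≡ 0#) → CommonPair P Q
    go (yes refl) (yes refl) _ = vertical pv qv (vertical-nonzero refl v≢𝟘) pw qw
      λ {c} fc eq → ¬prop (c , fc , cong₂ _,_ (sym (zeroʳ c)) eq)
    go (yes refl) (no x′≢0) _ = mixed pv qv (vertical-nonzero refl v≢𝟘) pw qw x′≢0
    go (no x≢0) _ (no r≢0) = graph pv qv pw qw r≢0
    go (no x≢0) _ (yes r≡0) = proportional (rmap≡0⇒proportional x≢0 r≡0)
      where
      proportional : (∃ λ c → Fq c × x′ ≡ c * x) → CommonPair P Q
      -- Both vectors lie over one point of W. Subtracting c times the first from the second gives a
      -- vertical vector, nonzero because the two are not proportional.
      proportional (c , fc , eq) = mixed (subst P diff (combine plane-P pv pw)) (subst Q diff (combine plane-Q qv qw)) s≢0 pv qv x≢0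
        where
        combine : ∀ {R} → Plane R → R (x , y) → R (x′ , y′) → R ((x′ , y′) ⊕ ((- c) · (x , y)))
        combine plane-R rv rw = closed-⊕ plane-R rw (closed-· plane-R (Fq-neg fc) rv)
        diff : (x′ , y′) ⊕ ((- c) · (x , y)) ≡ (0# , y′ - c * y)
        diff = cong₂ _,_ (trans (cong (_+ - c * x) eq) (solve 2 (λ c x → c :* x :+ (:- c) :* x := con (ℤ.+ 0)) refl c x))
          (solve 3 (λ c y y′ → y′ :+ (:- c) :* y := y′ :- c :* y) refl c y y′)
        s≢0 : y′ - c * y ≢ 0#
        s≢0 e = ¬prop (c , fc , cong₂ _,_ eq (x-y≡0⇒x≡y e))

  -- The hypothesis `separated` serves twice: contraposed it is the distance condition, and since a
  -- plane shares a 2-dimensional space with itself, it also makes the listing free of repetitions.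
  module IndexedCode {I : Set} {m : ℕ} (count : Fin m ↔ I) (L : I → VSet) (plane : ∀ i → Plane (L i))
    (separated : ∀ {i k} → Common (L i) (L k) → i ≡ k)
    (F : Family) (L∈F : ∀ i → F (L i)) (cover : ∀ P → F P → ∃ λ i → P ≐ L i) where

    isPlaneCode : IsPlaneCode F
    isPlaneCode = plane-F , meet
      where
      plane-F : ∀ P → F P → Plane P
      plane-F P p with cover P p
      ... | i , P≐ = dimension-≐ P≐ (plane i)
      meet : ∀ P Q → F P → F Q → ¬ (P ≐ Q) → Σ ℕ λ k → k ℕ.≤ 1 × IsSubspaceOfDim (P ∩ Q) k
      meet P Q p r P≢Q with cover P p | cover Q r
      ... | i , P≐ | k , Q≐ = small-intersection (plane-F P p) (plane-F Q r) λ common →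
        P≢Q (≐-trans P≐ (subst (λ l → L l ≐ Q) (sym (separated (Common-≐ P≐ Q≐ common))) (≐-sym Q≐)))

    hasSize : HasSize F m
    hasSize = L ∘ Inverse.to count , (λ i → L∈F _)
      , (λ i k e → FiniteType.to-injective count (separated (≐⇒Common (plane _) e)))
      , λ P p → let (i , P≐) = cover P p in Inverse.from count i , subst (λ k → P ≐ L k) (sym (Inverse.strictlyInverseˡ count i)) P≐

-- The planes of 𝒞 and their intersections.

module Families (q : ℕ) (q-primePower : IsPrimePower q) (K : FiniteField (q ℕ.^ 4)) where
  open Planes q q-primePower K public
  open ≡-Reasoning

  private
    O : ∀ {m} → Polynomial m
    O = con (ℤ.+ 0)

  -- An index `i` plays several roles. The vectors orthogonal to `h i`, parametrised here, are the
  -- coordinates of a 2-dimensional Z in W; its T_Z is spanned by `u (h i)`; and `comb (h i)` spans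
  -- a point of W.
  ab : Point → Carrier → Carrier → Vec
  ab i s t = s ⊛ a i ⊞ t ⊛ b i

  FqVec-ab : ∀ i {s t} → Fq s → Fq t → FqVec (ab i s t)
  FqVec-ab i fs ft = FqVec-⊞ (FqVec-⊛ fs (FqVec-a i)) (FqVec-⊛ ft (FqVec-b i))

  ab-∙ : ∀ i s t v → ab i s t ∙ v ≡ s * (a i ∙ v) + t * (b i ∙ v)
  ab-∙ i s t v = trans (∙-⊞ (s ⊛ a i) (t ⊛ b i) v) (cong₂ _+_ (∙-⊛ s (a i) v) (∙-⊛ t (b i) v))

  ab-orthogonal : ∀ i s t → h i ∙ ab i s t ≡ 0#
  ab-orthogonal i s t = begin
    h i ∙ ab i s t                          ≡⟨ ∙-comm (h i) (ab i s t) ⟩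
    ab i s t ∙ h i                          ≡⟨ ab-∙ i s t (h i) ⟩
    s * (a i ∙ h i) + t * (b i ∙ h i)       ≡⟨ cong₂ (λ x y → s * x + t * y) a∙h b∙h ⟩
    s * 0# + t * 0#                         ≡⟨ solve 2 (λ s t → s :* O :+ t :* O := O) refl s t ⟩
    0#                                      ∎
    where
    a∙h : a i ∙ h i ≡ 0#
    a∙h = trans (∙-comm (a i) (h i)) (trans (cong (_∙ a i) (sym (a⨯b≡h i))) (⨯-orthogonalˡ (a i) (b i)))
    b∙h : b i ∙ h i ≡ 0#
    b∙h = trans (∙-comm (b i) (h i)) (trans (cong (_∙ b i) (sym (a⨯b≡h i))) (⨯-orthogonalʳ (a i) (b i)))

  mixed-product : ∀ u v w → u ∙ (v ⨯ w) ≡ u ⨯ v ∙ w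
  mixed-product ⟨ a , b , c ⟩ ⟨ d , e , f ⟩ ⟨ x , y , z ⟩ = solve 9 (λ a b c d e f x y z →
    a :* (e :* z :- f :* y) :+ b :* (f :* x :- d :* z) :+ c :* (d :* y :- e :* x) :=
    (b :* f :- c :* e) :* x :+ (c :* d :- a :* f) :* y :+ (a :* e :- b :* d) :* z) refl a b c d e f x y z

  a⨯b∙j≡1 : ∀ i → a i ⨯ b i ∙ j i ≡ 1#
  a⨯b∙j≡1 i = trans (cong (_∙ j i) (a⨯b≡h i)) (h∙j≡1 i)

  -- Pairing with b × j and with a × j isolates s and -t, because a × b · j = 1.
  ab≡𝟎 : ∀ i {s t} → ab i s t ≡ 𝟎 → s ≡ 0# × t ≡ 0#
  ab≡𝟎 i {s} {t} eq = s≡0 , t≡0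
    where
    annihilated : ∀ v → s * (a i ∙ v) + t * (b i ∙ v) ≡ 0#
    annihilated v = trans (sym (ab-∙ i s t v)) (trans (cong (_∙ v) eq) (trans (∙-comm 𝟎 v) (∙-zeroʳ v)))
    self : ∀ v w → v ∙ (v ⨯ w) ≡ 0#
    self v w = trans (∙-comm v (v ⨯ w)) (⨯-orthogonalˡ v w)
    s≡0 : s ≡ 0#
    s≡0 = trans (solve 2 (λ s t → s := s :* con (ℤ.+ 1) :+ t :* O) refl s t) (trans
      (sym (cong₂ (λ x y → s * x + t * y) (trans (mixed-product (a i) (b i) (j i)) (a⨯b∙j≡1 i)) (self (b i) (j i))))
      (annihilated (b i ⨯ j i)))
    t≡0 : t ≡ 0#
    t≡0 = trans (solve 2 (λ s t → t := :- (s :* O :+ t :* (:- con (ℤ.+ 1)))) refl s t) (trans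
      (cong -_ (trans (sym (cong₂ (λ x y → s * x + t * y) (self (a i) (j i)) (trans (mixed-product (b i) (a i) (j i)) swap)))
        (annihilated (a i ⨯ j i))))
      (solve 1 (λ x → :- O := O) refl 0#))
      where
      swap : b i ⨯ a i ∙ j i ≡ - 1#
      swap = trans (anti (b i) (a i) (j i)) (cong -_ (a⨯b∙j≡1 i))
        where
        anti : ∀ v w z → v ⨯ w ∙ z ≡ - (w ⨯ v ∙ z)
        anti ⟨ a , b , c ⟩ ⟨ d , e , f ⟩ ⟨ x , y , z ⟩ = solve 9 (λ a b c d e f x y z →
          (b :* f :- c :* e) :* x :+ (c :* d :- a :* f) :* y :+ (a :* e :- b :* d) :* z :=
          :- ((e :* c :- f :* b) :* x :+ (f :* a :- d :* c) :* y :+ (d :* b :- e :* a) :* z)) refl a b c d e f x y z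

  -- In Cramer's rule the coefficient of `j i` is the determinant of v₁, v₂ and v, which is c (h ·
  -- v) and vanishes.
  span-orthogonal : ∀ i {v₁ v₂ c} → FqVec v₁ → FqVec v₂ → Fq c → c ≢ 0# → v₁ ⨯ v₂ ≡ c ⊛ h i →
    ∀ {v} → FqVec v → h i ∙ v ≡ 0# → ∃ λ s → ∃ λ t → Fq s × Fq t × v ≡ s ⊛ v₁ ⊞ t ⊛ v₂
  span-orthogonal i {v₁} {v₂} {c} f₁ f₂ fc c≢0 v₁⨯v₂≡ {v} fv h∙v≡0 = c ⁻¹ * s , c ⁻¹ * t
    , Fq-* (Fq-⁻¹ c≢0 fc) (Fq-∙ (FqVec-⨯ fv f₂) (FqVec-j i)) , Fq-* (Fq-⁻¹ c≢0 fc) (Fq-∙ (FqVec-⨯ f₁ fv) (FqVec-j i)) , (begin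
    v                                                    ≡⟨ ⊛-cancel c≢0 scaled ⟩
    c ⁻¹ ⊛ (s ⊛ v₁ ⊞ t ⊛ v₂)                             ≡⟨ vec-≡ (eq _ _) (eq _ _) (eq _ _) ⟩
    (c ⁻¹ * s) ⊛ v₁ ⊞ (c ⁻¹ * t) ⊛ v₂                    ∎)
    where
    s = v ⨯ v₂ ∙ j i
    t = v₁ ⨯ v ∙ j i
    eq : ∀ x y → c ⁻¹ * (s * x + t * y) ≡ (c ⁻¹ * s) * x + (c ⁻¹ * t) * y
    eq = solve 5 (λ c s t x y → c :* (s :* x :+ t :* y) := (c :* s) :* x :+ (c :* t) :* y) refl (c ⁻¹) s t
    scaled-∙ : ∀ w → v₁ ⨯ v₂ ∙ w ≡ c * (h i ∙ w)
    scaled-∙ w = trans (cong (_∙ w) v₁⨯v₂≡) (∙-⊛ c (h i) w)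
    scaled : c ⊛ v ≡ s ⊛ v₁ ⊞ t ⊛ v₂
    scaled = begin
      c ⊛ v                                     ≡⟨ cong (_⊛ v) (trans (scaled-∙ (j i)) (trans (cong (c *_) (h∙j≡1 i)) (*-identityʳ c))) ⟨
      (v₁ ⨯ v₂ ∙ j i) ⊛ v                       ≡⟨ cramer v₁ v₂ (j i) v ⟩
      (s ⊛ v₁ ⊞ t ⊛ v₂) ⊞ (v₁ ⨯ v₂ ∙ v) ⊛ j i
        ≡⟨ cong (λ c → (s ⊛ v₁ ⊞ t ⊛ v₂) ⊞ c ⊛ j i) (trans (scaled-∙ v) (trans (cong (c *_) h∙v≡0) (zeroʳ c))) ⟩
      (s ⊛ v₁ ⊞ t ⊛ v₂) ⊞ 0# ⊛ j i              ≡⟨ cong ((s ⊛ v₁ ⊞ t ⊛ v₂) ⊞_) (⊛-zeroˡ (j i)) ⟩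
      (s ⊛ v₁ ⊞ t ⊛ v₂) ⊞ 𝟎                     ≡⟨ ⊞-identityʳ _ ⟩
      s ⊛ v₁ ⊞ t ⊛ v₂                           ∎

  ab-surjective : ∀ i {v} → FqVec v → h i ∙ v ≡ 0# → ∃ λ s → ∃ λ t → Fq s × Fq t × v ≡ ab i s t
  ab-surjective i = span-orthogonal i (FqVec-a i) (FqVec-b i) Fq-1 (0≢1 ∘ sym) (trans (a⨯b≡h i) (sym (⊛-identity (h i))))

  comb-ab : ∀ i s t → comb (ab i s t) ≡ s * comb (a i) + t * comb (b i)
  comb-ab i s t = trans (comb-⊞ _ _) (cong₂ _+_ (comb-⊛ s (a i)) (comb-⊛ t (b i)))

  u-ab : ∀ i s t → u (ab i s t) ≡ s * u (a i) + t * u (b i)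
  u-ab i s t = trans (u-⊞ _ _) (cong₂ _+_ (u-⊛ s (a i)) (u-⊛ t (b i)))

  -- On h^⊥ the cross product is h times a nondegenerate alternating form. For v = s a + t b the
  -- vector a / t works if t ≠ 0, and -b / s otherwise.
  partner : ∀ i {v} → FqVec v → v ≢ 𝟎 → h i ∙ v ≡ 0# → ∃ λ w → FqVec w × h i ∙ w ≡ 0# × w ⨯ v ≡ h i
  partner i {v} fv v≢𝟎 h∙v≡0 = go (ab-surjective i fv h∙v≡0)
    where
    ⨯-ab : ∀ w s t → w ⨯ ab i s t ≡ s ⊛ (w ⨯ a i) ⊞ t ⊛ (w ⨯ b i)
    ⨯-ab w s t = vec-≡ (eq (x₂ w) (x₃ (a i)) (x₃ (b i)) (x₃ w) (x₂ (a i)) (x₂ (b i)))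
      (eq (x₃ w) (x₁ (a i)) (x₁ (b i)) (x₁ w) (x₃ (a i)) (x₃ (b i)))
      (eq (x₁ w) (x₂ (a i)) (x₂ (b i)) (x₂ w) (x₁ (a i)) (x₁ (b i)))
      where
      eq : ∀ w a b w′ a′ b′ → w * (s * a + t * b) - w′ * (s * a′ + t * b′) ≡ s * (w * a - w′ * a′) + t * (w * b - w′ * b′)
      eq = solve 8 (λ s t w a b w′ a′ b′ → w :* (s :* a :+ t :* b) :- w′ :* (s :* a′ :+ t :* b′) := s :*
          (w :* a :- w′ :* a′) :+ t :* (w :* b :- w′ :* b′)) refl s t
    b⨯a : b i ⨯ a i ≡ (- 1#) ⊛ h i
    b⨯a = trans (vec-≡ (eq _ _ _ _) (eq _ _ _ _) (eq _ _ _ _)) (cong ((- 1#) ⊛_) (a⨯b≡h i))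
      where
      eq : ∀ x y z w → x * y - z * w ≡ (- 1#) * (w * z - y * x)
      eq = solve 4 (λ x y z w → x :* y :- z :* w := (:- con (ℤ.+ 1)) :* (w :* z :- y :* x)) refl
    go : (∃ λ s → ∃ λ t → Fq s × Fq t × v ≡ ab i s t) → ∃ λ w → FqVec w × h i ∙ w ≡ 0# × w ⨯ v ≡ h i
    go (s , t , fs , ft , refl) = go′ (s ≟ 0#) (t ≟ 0#)
      where
      a-orth : h i ∙ a i ≡ 0#
      a-orth = trans (cong (_∙ a i) (sym (a⨯b≡h i))) (⨯-orthogonalˡ (a i) (b i))
      b-orth : h i ∙ b i ≡ 0#
      b-orth = trans (cong (_∙ b i) (sym (a⨯b≡h i))) (⨯-orthogonalʳ (a i) (b i))
      scaled-orth : ∀ c w → h i ∙ w ≡ 0# → h i ∙ (c ⊛ w) ≡ 0#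
      scaled-orth c w e = trans (∙-comm (h i) _) (trans (∙-⊛ c w (h i)) (trans (cong (c *_) (trans (∙-comm w (h i)) e)) (zeroʳ c)))
      go′ : Dec (s ≡ 0#) → Dec (t ≡ 0#) → ∃ λ w → FqVec w × h i ∙ w ≡ 0# × w ⨯ v ≡ h i
      go′ _ (no t≢0) = t ⁻¹ ⊛ a i , FqVec-⊛ (Fq-⁻¹ t≢0 ft) (FqVec-a i) , scaled-orth _ (a i) a-orth , (begin
        (t ⁻¹ ⊛ a i) ⨯ v                          ≡⟨ ⨯-⊛ˡ (t ⁻¹) (a i) v ⟩
        t ⁻¹ ⊛ (a i ⨯ v)                          ≡⟨ cong (t ⁻¹ ⊛_) (⨯-ab (a i) s t) ⟩
        t ⁻¹ ⊛ (s ⊛ (a i ⨯ a i) ⊞ t ⊛ (a i ⨯ b i)) ≡⟨ cong₂ (λ x y → t ⁻¹ ⊛ (s ⊛ x ⊞ t ⊛ y)) (⨯-self (a i)) (a⨯b≡h i) ⟩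
        t ⁻¹ ⊛ (s ⊛ 𝟎 ⊞ t ⊛ h i)                  ≡⟨ vec-≡ (eq _) (eq _) (eq _) ⟩
        h i                                       ∎)
        where
        eq : ∀ x → t ⁻¹ * (s * 0# + t * x) ≡ x
        eq x = trans (cong (t ⁻¹ *_) (trans (cong (_+ t * x) (zeroʳ s)) (+-identityˡ _))) (x⁻¹*[x*y]≡y t≢0)
      go′ (no s≢0) _ = (- (s ⁻¹)) ⊛ b i , FqVec-⊛ (Fq-neg (Fq-⁻¹ s≢0 fs)) (FqVec-b i) , scaled-orth _ (b i) b-orth , (begin
        ((- (s ⁻¹)) ⊛ b i) ⨯ v                    ≡⟨ ⨯-⊛ˡ _ (b i) v ⟩
        (- (s ⁻¹)) ⊛ (b i ⨯ v)                    ≡⟨ cong ((- (s ⁻¹)) ⊛_) (⨯-ab (b i) s t) ⟩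
        (- (s ⁻¹)) ⊛ (s ⊛ (b i ⨯ a i) ⊞ t ⊛ (b i ⨯ b i)) ≡⟨ cong₂ (λ x y → (- (s ⁻¹)) ⊛ (s ⊛ x ⊞ t ⊛ y)) b⨯a (⨯-self (b i)) ⟩
        (- (s ⁻¹)) ⊛ (s ⊛ ((- 1#) ⊛ h i) ⊞ t ⊛ 𝟎) ≡⟨ vec-≡ (eq _) (eq _) (eq _) ⟩
        h i                                       ∎)
        where
        eq : ∀ x → (- (s ⁻¹)) * (s * ((- 1#) * x) + t * 0#) ≡ x
        eq x = trans (solve 4 (λ s i t x → (:- i) :* (s :* ((:- con (ℤ.+ 1)) :* x) :+ t :* O) := i :* (s :* x)) refl s
            (s ⁻¹) t x) (x⁻¹*[x*y]≡y s≢0)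
      go′ (yes refl) (yes refl) = contradiction (vec-≡ (eq _ _) (eq _ _) (eq _ _)) v≢𝟎
        where
        eq : ∀ x y → 0# * x + 0# * y ≡ 0#
        eq = solve 2 (λ x y → O :* x :+ O :* y := O) refl

  plane-Γ : ∀ a₀ a₁ → Plane (Γ (gmap a₀ a₁))
  plane-Γ a₀ a₁ = plane-from-basis ⟨ e₁ , e₂ , e₃ ⟩ ⟨ f e₁ , f e₂ , f e₃ ⟩
    (subst W (eq₁ e₁ e₂ e₃) (comb-W (Fq-1 , Fq-0 , Fq-0)))
    (subst W (eq₂ e₁ e₂ e₃) (comb-W (Fq-0 , Fq-1 , Fq-0)))
    (subst W (eq₃ e₁ e₂ e₃) (comb-W (Fq-0 , Fq-0 , Fq-1)))
    (λ fc eq _ → independent fc eq)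
    (λ (w , eq) → let (v , fv , x≡) = span w in v , fv , x≡ , trans eq (trans (cong f x≡) (f-comb fv)))
    (λ fc x≡ y≡ → subst W (sym x≡) (comb-W fc) , trans y≡ (trans (sym (f-comb fc)) (cong f (sym x≡))))
    where
    f = gmap a₀ a₁
    I : ∀ {m} → Polynomial m
    I = con (ℤ.+ 1)
    eq₁ : ∀ x y z → 1# * x + 0# * y + 0# * z ≡ x
    eq₁ = solve 3 (λ x y z → I :* x :+ O :* y :+ O :* z := x) refl
    eq₂ : ∀ x y z → 0# * x + 1# * y + 0# * z ≡ y
    eq₂ = solve 3 (λ x y z → O :* x :+ I :* y :+ O :* z := y) refl
    eq₃ : ∀ x y z → 0# * x + 0# * y + 1# * z ≡ z
    eq₃ = solve 3 (λ x y z → O :* x :+ O :* y :+ I :* z := z) refl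
    f-comb : ∀ {v} → FqVec v → f (comb v) ≡ v ∙ ⟨ f e₁ , f e₂ , f e₃ ⟩
    f-comb {⟨ x , y , z ⟩} fv = trans (cong (λ t → a₀ * comb ⟨ x , y , z ⟩ + a₁ * t) (φ-comb fv))
      (solve 11 (λ a₀ a₁ x y z e f g e′ f′ g′ →
        a₀ :* (x :* e :+ y :* f :+ z :* g) :+ a₁ :* (x :* e′ :+ y :* f′ :+ z :* g′) :=
        x :* (a₀ :* e :+ a₁ :* e′) :+ y :* (a₀ :* f :+ a₁ :* f′) :+ z :* (a₀ :* g :+ a₁ :* g′))
        refl a₀ a₁ x y z e₁ e₂ e₃ (φ e₁) (φ e₂) (φ e₃))

  Nᵢ : Point → Carrier → VSet
  Nᵢ i r = N (Span₂ (comb (a i)) (comb (b i))) (Line (rmap (comb (a i)) (comb (b i)))) (rmap r)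

  -- A form of N that refers to Z only through its normal vector and is therefore independent of the
  -- basis chosen for Z.
  InN : Point → Carrier → VSet
  InN i r (x , y) = Σ Vec λ v → FqVec v × h i ∙ v ≡ 0# × x ≡ comb v × Σ Carrier λ c → Fq c × y ≡ rmap r x + c * u (h i)

  u-h : ∀ i → rmap (comb (a i)) (comb (b i)) ≡ u (h i)
  u-h i = trans (rmap-comb (FqVec-a i) (FqVec-b i)) (cong u (a⨯b≡h i))

  -- Another basis of Z multiplies the generator of `Line` by the determinant `c` of the change of
  -- basis, which leaves the line unchanged as c ≠ 0.
  N≐InN : ∀ i r {v₁ v₂ c} → FqVec v₁ → FqVec v₂ → Fq c → c ≢ 0# → v₁ ⨯ v₂ ≡ c ⊛ h i →
    N (Span₂ (comb v₁) (comb v₂)) (Line (rmap (comb v₁) (comb v₂))) (rmap r) ≐ InN i r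
  N≐InN i r {v₁} {v₂} {c} f₁ f₂ fc c≢0 v₁⨯v₂≡ (x , y) = mk⇔
    (λ { (x , y , (s , t , fs , ft , x≡) , (d , fd , y≡) , refl) →
      s ⊛ v₁ ⊞ t ⊛ v₂ , FqVec-⊞ (FqVec-⊛ fs f₁) (FqVec-⊛ ft f₂) , orthogonal s t , trans x≡ (sym (comb-span s t))
      , d * c , Fq-* fd fc , cong (rmap r x +_) (trans y≡ (trans (cong (d *_) line≡) (sym (*-assoc d c _)))) })
    (λ (v , fv , h∙v≡0 , x≡ , d , fd , y≡) → let (s , t , fs , ft , v≡) = span-orthogonal i f₁ f₂ fc c≢0 v₁⨯v₂≡ fv h∙v≡0 in
      x , d * u (h i) , (s , t , fs , ft , trans x≡ (trans (cong comb v≡) (comb-span s t)))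
      , (d * c ⁻¹ , Fq-* fd (Fq-⁻¹ c≢0 fc) , trans (cong (d *_) (trans (sym (x⁻¹*[x*y]≡y c≢0)) (cong (c ⁻¹ *_) (sym line≡))))
          (sym (*-assoc d _ _)))
      , cong (x ,_) y≡)
    where
    line≡ : rmap (comb v₁) (comb v₂) ≡ c * u (h i)
    line≡ = trans (rmap-comb f₁ f₂) (trans (cong u v₁⨯v₂≡) (u-⊛ c (h i)))
    comb-span : ∀ s t → comb (s ⊛ v₁ ⊞ t ⊛ v₂) ≡ s * comb v₁ + t * comb v₂
    comb-span s t = trans (comb-⊞ _ _) (cong₂ _+_ (comb-⊛ s v₁) (comb-⊛ t v₂))
    orthogonal : ∀ s t → h i ∙ (s ⊛ v₁ ⊞ t ⊛ v₂) ≡ 0#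
    orthogonal s t = x*y≡0⇒y≡0 c≢0 (begin
      c * (h i ∙ (s ⊛ v₁ ⊞ t ⊛ v₂))             ≡⟨ trans (cong (_∙ (s ⊛ v₁ ⊞ t ⊛ v₂)) v₁⨯v₂≡) (∙-⊛ c (h i) _) ⟨
      v₁ ⨯ v₂ ∙ (s ⊛ v₁ ⊞ t ⊛ v₂)               ≡⟨ ∙-comm (v₁ ⨯ v₂) _ ⟩
      (s ⊛ v₁ ⊞ t ⊛ v₂) ∙ (v₁ ⨯ v₂)             ≡⟨ trans (∙-⊞ _ _ _) (cong₂ _+_ (∙-⊛ s v₁ _) (∙-⊛ t v₂ _)) ⟩
      s * (v₁ ∙ (v₁ ⨯ v₂)) + t * (v₂ ∙ (v₁ ⨯ v₂))
        ≡⟨ cong₂ (λ x y → s * x + t * y) (trans (∙-comm v₁ _) (⨯-orthogonalˡ v₁ v₂)) (trans (∙-comm v₂ _) (⨯-orthogonalʳ v₁ v₂)) ⟩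
      s * 0# + t * 0#                           ≡⟨ solve 2 (λ s t → s :* O :+ t :* O := O) refl s t ⟩
      0#                                        ∎)

  N⇔InN : ∀ i r → Nᵢ i r ≐ InN i r
  N⇔InN i r = N≐InN i r (FqVec-a i) (FqVec-b i) Fq-1 (0≢1 ∘ sym) (trans (a⨯b≡h i) (sym (⊛-identity (h i))))

  plane-N : ∀ i r → Plane (Nᵢ i r)
  plane-N i r = plane-from-basis ⟨ A , B , 0# ⟩ ⟨ rmap r A , rmap r B , t₀ ⟩
    (comb-W (FqVec-a i)) (comb-W (FqVec-b i)) W-0
    ind coords member
    where
    A = comb (a i)
    B = comb (b i)
    t₀ = rmap A B
    drop₃ : ∀ s t c A B → s * A + t * B + c * 0# ≡ s * A + t * B
    drop₃ = solve 5 (λ s t c A B → s :* A :+ t :* B :+ c :* O := s :* A :+ t :* B) refl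
    rmap-sA+tB : ∀ {s t} → Fq s → Fq t → rmap r (s * A + t * B) ≡ s * rmap r A + t * rmap r B
    rmap-sA+tB fs ft = trans (rmap-+ʳ r _ _) (cong₂ _+_ (rmap-*ʳ fs r A) (rmap-*ʳ ft r B))
    ind : ∀ {c} → FqVec c → c ∙ ⟨ A , B , 0# ⟩ ≡ 0# → c ∙ ⟨ rmap r A , rmap r B , t₀ ⟩ ≡ 0# → c ≡ 𝟎
    ind {⟨ s , t , c ⟩} (fs , ft , fc) eq eq′ = vec-≡ s≡0 t≡0 (x*y≡0⇒y≡0 t₀≢0 (trans (*-comm t₀ c) c*t₀≡0))
      where
      t₀≢0 : t₀ ≢ 0#
      t₀≢0 e = u-h≢0 i (trans (sym (u-h i)) e)
      st≡0 = ab≡𝟎 i (independent (FqVec-ab i fs ft) (trans (comb-ab i s t) (trans (sym (drop₃ s t c A B)) eq)))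
      s≡0 = proj₁ st≡0
      t≡0 = proj₂ st≡0
      c*t₀≡0 : c * t₀ ≡ 0#
      c*t₀≡0 = trans (solve 4 (λ x y c t → c :* t := O :* x :+ O :* y :+ c :* t) refl (rmap r A) (rmap r B) c t₀)
        (trans (cong₂ (λ s t → s * rmap r A + t * rmap r B + c * t₀) (sym s≡0) (sym t≡0)) eq′)
    coords : ∀ {x y} → Nᵢ i r (x , y) → Σ Vec λ c → FqVec c × x ≡ c ∙ ⟨ A , B , 0# ⟩ × y ≡ c ∙ ⟨ rmap r A , rmap r B , t₀ ⟩
    coords (x , y , (s , t , fs , ft , refl) , (c , fc , refl) , refl) = ⟨ s , t , c ⟩ , (fs , ft , fc)
      , sym (drop₃ s t c A B) , cong (_+ c * t₀) (rmap-sA+tB fs ft)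
    member : ∀ {x y c} → FqVec c → x ≡ c ∙ ⟨ A , B , 0# ⟩ → y ≡ c ∙ ⟨ rmap r A , rmap r B , t₀ ⟩ → Nᵢ i r (x , y)
    member {c = ⟨ s , t , c ⟩} (fs , ft , fc) refl refl = _ , c * t₀ , (s , t , fs , ft , drop₃ s t c A B) , (c , fc , refl)
      , cong ((s * A + t * B + c * 0#) ,_) (cong (_+ c * t₀) (sym (trans (cong (rmap r) (drop₃ s t c A B)) (rmap-sA+tB fs ft))))

  GraphIndex NIndex : Set
  GraphIndex = Σ Carrier (_≢ 0#) × Carrier
  NIndex = Point × 𝔽 × 𝔽

  -- gmap a₀ a₁ ∈ ℛ exactly if d = a₀ + a₁^q vanishes.
  graphPlane : GraphIndex → VSet
  graphPlane ((d , _) , a₁) = Γ (gmap (d - φ a₁) a₁)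

  -- Representatives of K modulo h^⊥ ⊂ W.
  representative : NIndex → Carrier
  representative (i , (ρ , _) , (σ , _)) = ρ * e₀ + σ * comb (j i)

  nPlane : NIndex → VSet
  nPlane k@(i , _) = Nᵢ i (representative k)

  Γ-vertical : ∀ {a₀ a₁ s} → Γ (gmap a₀ a₁) (0# , s) → s ≡ 0#
  Γ-vertical {a₀} {a₁} (_ , eq) = trans eq (trans (cong (λ t → a₀ * 0# + a₁ * t) φ-0)
    (solve 2 (λ x y → x :* O :+ y :* O := O) refl a₀ a₁))

  -- The Gabidulin property: a nonzero map a₀ x + a₁ x^q vanishes on an F_q-space of dimension at
  -- most 1, here by `moore` applied to the difference.
  gmap≡⇒coefficients≡ : ∀ {a₀ a₁ b₀ b₁ x x′} → rmap x x′ ≢ 0# → gmap a₀ a₁ x ≡ gmap b₀ b₁ x → gmap a₀ a₁ x′ ≡ gmap b₀ b₁ x′ →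
    a₀ ≡ b₀ × a₁ ≡ b₁
  gmap≡⇒coefficients≡ {a₀} {a₁} {b₀} {b₁} r≢0 eq eq′ =
    let (p , p′) = moore r≢0 (difference eq) (difference eq′) in x-y≡0⇒x≡y p , x-y≡0⇒x≡y p′
    where
    difference : ∀ {x} → gmap a₀ a₁ x ≡ gmap b₀ b₁ x → (a₀ - b₀) * x + (a₁ - b₁) * φ x ≡ 0#
    difference {x} e = trans (solve 6 (λ a₀ a₁ b₀ b₁ x y → (a₀ :- b₀) :* x :+ (a₁ :- b₁) :* y := (a₀ :* x :+ a₁ :* y) :-
        (b₀ :* x :+ b₁ :* y)) refl a₀ a₁ b₀ b₁ x (φ x))
      (x≡y⇒x-y≡0 e)

  rmap≡gmap : ∀ r x → rmap r x ≡ gmap (- φ r) r x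
  rmap≡gmap r x = solve 4 (λ r r′ x x′ → r :* x′ :- r′ :* x := (:- r′) :* x :+ r :* x′) refl r (φ r) x (φ x)

  d-φa≡-φa⇒d≡0 : ∀ {d y} → d - y ≡ - y → d ≡ 0#
  d-φa≡-φa⇒d≡0 {d} {y} eq = trans (solve 2 (λ d y → d := (d :- y) :- (:- y)) refl d y) (x≡y⇒x-y≡0 eq)

  graph-separated : ∀ {i k} → Common (graphPlane i) (graphPlane k) → i ≡ k
  graph-separated {i@((d , d≢0) , a₁)} {k@((d′ , d′≢0) , b₁)} common = go (split (plane-Γ _ _) (plane-Γ _ _) common)
    where
    index-≡ : ∀ {d d′ a b} {p : d ≢ 0#} {p′ : d′ ≢ 0#} → a ≡ b → d - φ a ≡ d′ - φ b → ((d , p) , a) ≡ ((d′ , p′) , b)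
    index-≡ {d} {d′} {a} refl eq with trans (solve 2 (λ d y → d := (d :- y) :+ y) refl d (φ a)) (trans (cong (_+ φ a) eq) (solve 2 (λ d y → (d :- y) :+ y := d) refl d′ (φ a)))
    ... | refl = refl
    go : CommonPair (graphPlane i) (graphPlane k) → i ≡ k
    go (graph (_ , y≡) (_ , y≡′) (_ , z≡) (_ , z≡′) r≢0) =
      let (p , p′) = gmap≡⇒coefficients≡ r≢0 (trans (sym y≡) y≡′) (trans (sym z≡) z≡′) in index-≡ p′ p
    go (mixed p _ s≢0 _ _ _) = contradiction (Γ-vertical p) s≢0
    go (vertical p _ s≢0 _ _ _) = contradiction (Γ-vertical p) s≢0

  InN-vertical : ∀ {i r s} → InN i r (0# , s) → ∃ λ c → Fq c × s ≡ c * u (h i)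
  InN-vertical {i} {r} (_ , _ , _ , _ , c , fc , eq) = c , fc , trans eq (trans (cong (_+ c * u (h i)) rmap-0) (+-identityˡ _))
    where
    rmap-0 : rmap r 0# ≡ 0#
    rmap-0 = trans (cong (rmap r) (sym (zeroˡ 0#))) (trans (rmap-*ʳ Fq-0 r 0#) (zeroˡ _))

  -- On the plane W' = ⟨x, x'⟩ every linear map into the line of rmap x x' is given by an element of W'.
  interpolate : ∀ {r x x′ μ μ′} → Fq μ → Fq μ′ → let R = r + (μ′ * x - μ * x′) in
    rmap R x ≡ rmap r x + μ * rmap x x′ × rmap R x′ ≡ rmap r x′ + μ′ * rmap x x′
  interpolate {r} {x} {x′} {μ} {μ′} fμ fμ′ = at-x , at-x′
    where
    expand : ∀ z → rmap (r + (μ′ * x - μ * x′)) z ≡ rmap r z + (μ′ * rmap x z + - μ * rmap x′ z)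
    expand z = trans (rmap-+ˡ r _ z) (cong (rmap r z +_) (trans (cong (λ t → rmap (μ′ * x + t) z) (solve 2 (λ m x → :-
        (m :* x) := (:- m) :* x) refl μ x′))
      (trans (rmap-+ˡ _ _ z) (cong₂ _+_ (rmap-*ˡ fμ′ x z) (rmap-*ˡ (Fq-neg fμ) x′ z)))))
    at-x : rmap (r + (μ′ * x - μ * x′)) x ≡ rmap r x + μ * rmap x x′
    at-x = trans (expand x) (cong (rmap r x +_) (trans (cong₂ (λ s t → μ′ * s + - μ * t) (rmap-self x) (rmap-anti x′ x))
      (solve 3 (λ m m′ y → m′ :* O :+ (:- m) :* (:- y) := m :* y) refl μ μ′ (rmap x x′))))
    at-x′ : rmap (r + (μ′ * x - μ * x′)) x′ ≡ rmap r x′ + μ′ * rmap x x′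
    at-x′ = trans (expand x′) (cong (rmap r x′ +_) (trans (cong (λ t → μ′ * rmap x x′ + - μ * t) (rmap-self x′))
      (solve 3 (λ m m′ y → m′ :* y :+ (:- m) :* O := m′ :* y) refl μ μ′ (rmap x x′))))

  -- Any two independent elements of Z generate T_Z, because the exterior square of Z is a line.
  -- This allows `rmap x y` to replace the generator `u (h i)`.
  cross-scale : ∀ i {v w x y} → FqVec v → FqVec w → h i ∙ v ≡ 0# → h i ∙ w ≡ 0# → x ≡ comb v → y ≡ comb w → rmap x y ≢ 0# →
    ∃ λ κ → Fq κ × κ ≢ 0# × rmap x y ≡ κ * u (h i)
  cross-scale i {v} {w} fv fw h∙v h∙w refl refl r≢0 = κ , Fq-∙ (FqVec-⨯ fv fw) (FqVec-j i) , κ≢0 , r≡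
    where
    κ = v ⨯ w ∙ j i
    r≡ : rmap (comb v) (comb w) ≡ κ * u (h i)
    r≡ = trans (rmap-comb fv fw) (trans (cong u (orthogonal⇒⨯-parallel (h∙j≡1 i) h∙v h∙w)) (u-⊛ κ (h i)))
    κ≢0 : κ ≢ 0#
    κ≢0 e = r≢0 (trans r≡ (trans (cong (_* u (h i)) e) (zeroˡ _)))

  multiples-proportional : ∀ {c c′ s s′ z} → Fq c → Fq c′ → s ≢ 0# → s ≡ c * z → s′ ≡ c′ * z → ∃ λ d → Fq d × s′ ≡ d * s
  multiples-proportional {c} {c′} {s} {s′} {z} fc fc′ s≢0 s≡ s′≡ = c′ * c ⁻¹ , Fq-* fc′ (Fq-⁻¹ c≢0 fc) , (begin
    s′                        ≡⟨ s′≡ ⟩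
    c′ * z                    ≡⟨ cong (c′ *_) (x⁻¹*[x*y]≡y c≢0) ⟨
    c′ * (c ⁻¹ * (c * z))     ≡⟨ *-assoc c′ (c ⁻¹) _ ⟨
    (c′ * c ⁻¹) * (c * z)     ≡⟨ cong ((c′ * c ⁻¹) *_) s≡ ⟨
    (c′ * c ⁻¹) * s           ∎)
    where
    c≢0 : c ≢ 0#
    c≢0 c≡0 = s≢0 (trans s≡ (trans (cong (_* z) c≡0) (zeroˡ z)))

  InN-not-vertical : ∀ {i r s s′} → InN i r (0# , s) → s ≢ 0# → InN i r (0# , s′) → ¬ (∀ {c} → Fq c → s′ ≢ c * s)
  InN-not-vertical {i} {r} p s≢0 p′ ¬prop =
    let (_ , fc , e)   = InN-vertical {i} {r} p
        (_ , fc′ , e′) = InN-vertical {i} {r} p′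
        (_ , fd , e″)  = multiples-proportional fc fc′ s≢0 e e′
    in ¬prop fd e″

  graph-n-separated : ∀ {i k} → ¬ Common (graphPlane i) (nPlane k)
  graph-n-separated {(d , d≢0) , a₁} {k@(i , _)} common = go (split (plane-Γ _ _) (dimension-≐ (≐-sym (N⇔InN i r)) (plane-N i r))
      (Common-≐ ≐-refl (N⇔InN i r) common))
    where
    r = representative k
    go : ¬ CommonPair (Γ (gmap (d - φ a₁) a₁)) (InN i r)
    go (mixed p _ s≢0 _ _ _) = s≢0 (Γ-vertical p)
    go (vertical p _ s≢0 _ _ _) = s≢0 (Γ-vertical p)
    go (graph {x} {y} {x′} {y′} (_ , y≡) (v , fv , h∙v , x≡ , c , fc , y≡r) (_ , y′≡) (v′ , fv′ , h∙v′ , x′≡ , c′ , fc′ , y′≡r) r≢0) =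
      finish (cross-scale i fv fv′ h∙v h∙v′ x≡ x′≡ r≢0)
      where
      finish : ¬ (∃ λ κ → Fq κ × κ ≢ 0# × rmap x x′ ≡ κ * u (h i))
      finish (κ , fκ , κ≢0 , r≡) = d≢0 (d-φa≡-φa⇒d≡0 (trans (proj₁ coefficients) (cong (λ t → - φ t) (sym (proj₂ coefficients)))))
        where
        rescale : ∀ c → c * u (h i) ≡ (c * κ ⁻¹) * rmap x x′
        rescale c = sym (trans (cong ((c * κ ⁻¹) *_) r≡) (trans (*-assoc c _ _) (cong (c *_) (x⁻¹*[x*y]≡y κ≢0))))
        μ = c * κ ⁻¹
        μ′ = c′ * κ ⁻¹
        R = r + (μ′ * x - μ * x′)
        interpolated = interpolate {r} {x} {x′} (Fq-* fc (Fq-⁻¹ κ≢0 fκ)) (Fq-* fc′ (Fq-⁻¹ κ≢0 fκ))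
        -- Agreement at the independent x and x′ identifies the coefficients of the graph map with
        -- those of `rmap R`, and this forces d = 0.
        coefficients : d - φ a₁ ≡ - φ R × a₁ ≡ R
        coefficients = gmap≡⇒coefficients≡ r≢0
          (trans (sym y≡) (trans y≡r (trans (cong (rmap r x +_) (rescale c)) (trans (sym (proj₁ interpolated)) (rmap≡gmap R x)))))
          (trans (sym y′≡) (trans y′≡r (trans (cong (rmap r x′ +_) (rescale c′)) (trans (sym (proj₂ interpolated)) (rmap≡gmap R x′)))))

  ⊛-h-injective : ∀ {i k c c′} → c ≢ 0# → c ⊛ h i ≡ c′ ⊛ h k → i ≡ k
  ⊛-h-injective {i} {k} {c} {c′} c≢0 eq = h-injective i k (trans (⊛-cancel c≢0 eq) (sym (⊛-assoc (c ⁻¹) c′ (h k))))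

  -- If w is a partner of v, the difference ω = c - c′ of the T_Z-parts contributes ω u(h) =
  -- `rmap (ω * comb w) x`. Hence `rmap z x` vanishes for z = r - r′ + ω w, so z is a multiple of x
  -- and r - r′ lies in Z. Distinct representatives are incongruent modulo Z.
  n-representative : ∀ {k k′} → proj₁ k ≡ proj₁ k′ → ∀ {x y} → x ≢ 0# →
    InN (proj₁ k) (representative k) (x , y) → InN (proj₁ k′) (representative k′) (x , y) → k ≡ k′
  n-representative {i , (ρ , fρ) , (σ , fσ)} {_ , (ρ′ , fρ′) , (σ′ , fσ′)} refl {x} {y} x≢0
    (v , fv , h∙v , x≡ , c , fc , y≡) (_ , _ , _ , _ , c′ , fc′ , y≡′) = go (partner i fv v≢𝟎 h∙v)
    where
    r = ρ * e₀ + σ * comb (j i)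
    r′ = ρ′ * e₀ + σ′ * comb (j i)
    v≢𝟎 : v ≢ 𝟎
    v≢𝟎 e = x≢0 (trans x≡ (trans (cong comb e) comb-𝟎))
    go : (∃ λ w → FqVec w × h i ∙ w ≡ 0# × w ⨯ v ≡ h i) → (i , (ρ , fρ) , (σ , fσ)) ≡ (i , (ρ′ , fρ′) , (σ′ , fσ′))
    go (w , fw , h∙w , w⨯v) = go′ (rmap≡0⇒proportional x≢0 (trans (rmap-anti x z) (trans (cong -_ rz≡0) (solve 1 (λ o →
        :- O := O) refl 0#))))
      where
      ω = c - c′
      z = (r - r′) + ω * comb w
      u-h≡ : rmap (comb w) x ≡ u (h i)
      u-h≡ = trans (cong (rmap (comb w)) x≡) (trans (rmap-comb fw fv) (cong u w⨯v))
      rz≡0 : rmap z x ≡ 0#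
      rz≡0 = begin
        rmap z x                                        ≡⟨ rmap-+ˡ (r - r′) _ x ⟩
        rmap (r - r′) x + rmap (ω * comb w) x
          ≡⟨ cong₂ _+_ (rmap-+ˡ r (- r′) x) (trans (rmap-*ˡ (Fq-- fc fc′) (comb w) x) (cong (ω *_) u-h≡)) ⟩
        (rmap r x + rmap (- r′) x) + ω * u (h i)
          ≡⟨ cong (λ t → (rmap r x + t) + ω * u (h i)) (trans (cong (λ t → rmap t x) (minus r′)) (trans (rmap-*ˡ
              (Fq-neg Fq-1) r′ x) (sym (minus (rmap r′ x))))) ⟩
        (rmap r x - rmap r′ x) + ω * u (h i)
          ≡⟨ solve 5 (λ a b c d e → (a :- b) :+ (c :- d) :* e := (a :+ c :* e) :- (b :+ d :* e)) refl (rmap r x)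
              (rmap r′ x) c c′ (u (h i)) ⟩
        (rmap r x + c * u (h i)) - (rmap r′ x + c′ * u (h i)) ≡⟨ x≡y⇒x-y≡0 (trans (sym y≡) y≡′) ⟩
        0#                                              ∎
        where
        minus : ∀ x → - x ≡ (- 1#) * x
        minus = solve 1 (λ x → :- x := (:- con (ℤ.+ 1)) :* x) refl
      go′ : (∃ λ e → Fq e × z ≡ e * x) → (i , (ρ , fρ) , (σ , fσ)) ≡ (i , (ρ′ , fρ′) , (σ′ , fσ′))
      go′ (e , fe , z≡) = cong₂ (λ s t → i , s , t) (𝔽-≡ ρ≡ρ′) (𝔽-≡ σ≡σ′)
        where
        -- The relation z = e x reads (ρ - ρ′) e₀ = comb n. Its trace gives ρ = ρ′, so n = 0;
        -- pairing with `h i`, which kills v and w and is 1 on `j i`, gives σ = σ′.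
        n = e ⊛ v ⊟ (ω ⊛ w ⊞ (σ - σ′) ⊛ j i)
        fn : FqVec n
        fn = FqVec-⊟ (FqVec-⊛ fe fv) (FqVec-⊞ (FqVec-⊛ (Fq-- fc fc′) fw) (FqVec-⊛ (Fq-- fσ fσ′) (FqVec-j i)))
        comb-n : comb n ≡ e * comb v - (ω * comb w + (σ - σ′) * comb (j i))
        comb-n = trans (comb-⊟ _ _) (cong₂ _-_ (comb-⊛ e v) (trans (comb-⊞ _ _) (cong₂ _+_ (comb-⊛ ω w) (comb-⊛ _ (j i)))))
        [ρ-ρ′]e₀≡ : (ρ - ρ′) * e₀ ≡ comb n
        [ρ-ρ′]e₀≡ = begin
          (ρ - ρ′) * e₀
            ≡⟨ solve 7 (λ ρ ρ′ e σ σ′ j w → (ρ :- ρ′) :* e := (((ρ :* e :+ σ :* j) :- (ρ′ :* e :+ σ′ :* j)) :+ w) :- (w :+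
                (σ :- σ′) :* j)) refl ρ ρ′ e₀ σ σ′ (comb (j i)) (ω * comb w) ⟩
          z - (ω * comb w + (σ - σ′) * comb (j i)) ≡⟨ cong (_- (ω * comb w + (σ - σ′) * comb (j i))) (trans z≡ (cong (e *_) x≡)) ⟩
          e * comb v - (ω * comb w + (σ - σ′) * comb (j i)) ≡⟨ comb-n ⟨
          comb n ∎
        ρ-ρ′≡0 : ρ - ρ′ ≡ 0#
        ρ-ρ′≡0 = x*y≡0⇒y≡0 Tr-e₀≢0 (trans (*-comm (Tr e₀) _) (trans (sym (Tr-* (Fq-- fρ fρ′) e₀)) (trans (cong Tr [ρ-ρ′]e₀≡)
            (W⇒Tr≡0 (comb-W fn)))))
        ρ≡ρ′ = x-y≡0⇒x≡y ρ-ρ′≡0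
        n≡𝟎 : n ≡ 𝟎
        n≡𝟎 = independent fn (trans (sym [ρ-ρ′]e₀≡) (trans (cong (_* e₀) ρ-ρ′≡0) (zeroˡ e₀)))
        σ≡σ′ : σ ≡ σ′
        σ≡σ′ = x-y≡0⇒x≡y (begin
          σ - σ′
            ≡⟨ solve 4 (λ s e w t → s := (w :* O :+ s :* con (ℤ.+ 1)) :- e :* O) refl (σ - σ′) e ω 0# ⟩
          (ω * 0# + (σ - σ′) * 1#) - e * 0#
            ≡⟨ cong₂ _-_ (cong₂ (λ s t → ω * s + (σ - σ′) * t) (trans (∙-comm w (h i)) h∙w) (trans (∙-comm (j i) (h i))
                (h∙j≡1 i))) (cong (e *_) (trans (∙-comm v (h i)) h∙v)) ⟨
          (ω * (w ∙ h i) + (σ - σ′) * (j i ∙ h i)) - e * (v ∙ h i)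
            ≡⟨ cong₂ _-_ (trans (∙-⊞ _ _ (h i)) (cong₂ _+_ (∙-⊛ ω w (h i)) (∙-⊛ _ (j i) (h i)))) (∙-⊛ e v (h i)) ⟨
          (ω ⊛ w ⊞ (σ - σ′) ⊛ j i) ∙ h i - (e ⊛ v) ∙ h i ≡⟨ x≡y⇒x-y≡0 (cong (_∙ h i) (sym (⊟≡𝟎 n≡𝟎))) ⟩
          0#                                         ∎)

  -- The normal vector can be recovered: `rmap x y` is a nonzero multiple of both `u (h i)` and
  -- `u (h i′)`, and `u` is injective over F_q.
  orthogonal-unique : ∀ {i i′ v w v₁ w₁ x y} → FqVec v → FqVec w → h i ∙ v ≡ 0# → h i ∙ w ≡ 0# → x ≡ comb v → y ≡ comb w →
    FqVec v₁ → FqVec w₁ → h i′ ∙ v₁ ≡ 0# → h i′ ∙ w₁ ≡ 0# → x ≡ comb v₁ → y ≡ comb w₁ → rmap x y ≢ 0# → i ≡ i′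
  orthogonal-unique {i} {i′} fv fw h∙v h∙w x≡ y≡ fv₁ fw₁ h∙v₁ h∙w₁ x≡₁ y≡₁ r≢0
    with cross-scale i fv fw h∙v h∙w x≡ y≡ r≢0 | cross-scale i′ fv₁ fw₁ h∙v₁ h∙w₁ x≡₁ y≡₁ r≢0
  ... | κ , fκ , κ≢0 , e | κ′ , fκ′ , _ , e′ = ⊛-h-injective κ≢0
    (u-injective (FqVec-⊛ fκ (FqVec-h i)) (FqVec-⊛ fκ′ (FqVec-h i′)) (trans (u-⊛ κ (h i)) (trans (sym e) (trans e′ (sym (u-⊛ κ′ (h i′)))))))

  -- A common pair independent in W determines Z, and a common vertical vector determines T_Z and
  -- with it Z. In either case a common vector off S remains for `n-representative`. Two independent
  -- vertical vectors do not fit into the line T_Z.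
  n-separated : ∀ {k k′} → Common (nPlane k) (nPlane k′) → k ≡ k′
  n-separated {k@(i , _)} {k′@(i′ , _)} common = go (split (dimension-≐ (≐-sym (N⇔InN i r)) (plane-N i r)) (dimension-≐
      (≐-sym (N⇔InN i′ r′)) (plane-N i′ r′))
      (Common-≐ (N⇔InN i r) (N⇔InN i′ r′) common))
    where
    r = representative k
    r′ = representative k′
    Goal = k ≡ k′
    go : CommonPair (InN i r) (InN i′ r′) → Goal
    go (graph {x} {y} {x′} {y′} p@(v , fv , h∙v , x≡ , _) p′@(v₁ , fv₁ , h′∙v , x≡₁ , _) (w , fw , h∙w , x′≡ , _)
        (w₁ , fw₁ , h′∙w , x′≡₁ , _) r≢0) =
      n-representative (orthogonal-unique fv fw h∙v h∙w x≡ x′≡ fv₁ fw₁ h′∙v h′∙w x≡₁ x′≡₁ r≢0) x≢0 p p′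
      where
      x≢0 : x ≢ 0#
      x≢0 e = r≢0 (trans (cong (λ t → rmap t x′) (trans e (sym (zeroˡ 0#)))) (trans (rmap-*ˡ Fq-0 0# x′) (zeroˡ _)))
    go (mixed {s} p p′ s≢0 n n′ x≢0) = combine (InN-vertical {i} {r} p) (InN-vertical {i′} {r′} p′)
      where
      combine : (∃ λ c → Fq c × s ≡ c * u (h i)) → (∃ λ c → Fq c × s ≡ c * u (h i′)) → Goal
      combine (c , fc , e) (c′ , fc′ , e′) = n-representative i≡i′ x≢0 n n′
        where
        c≢0 : c ≢ 0#
        c≢0 c≡0 = s≢0 (trans e (trans (cong (_* u (h i)) c≡0) (zeroˡ _)))
        i≡i′ = ⊛-h-injective c≢0 (u-injective (FqVec-⊛ fc (FqVec-h i)) (FqVec-⊛ fc′ (FqVec-h i′)) (trans (u-⊛ c (h i)) (trans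
            (sym e) (trans e′ (sym (u-⊛ c′ (h i′)))))))
    go (vertical p _ s≢0 p′ _ ¬prop) = ⊥-elim (InN-not-vertical {i} {r} p s≢0 p′ ¬prop)

-- The additional planes.

module Augmentation (q : ℕ) (q-primePower : IsPrimePower q) (K : FiniteField (q ℕ.^ 4)) where
  open Families q q-primePower K public
  open ≡-Reasoning

  private
    O I : ∀ {m} → Polynomial m
    O = con (ℤ.+ 0)
    I = con (ℤ.+ 1)

  -- Every plane of V that meets S in dimension exactly 2 has this form, with a nonzero x in W and
  -- independent t₁, t₂.
  Pencil : (x y t₁ t₂ : Carrier) → VSet
  Pencil x y t₁ t₂ (x′ , y′) = Σ Carrier λ c → Σ Carrier λ α → Σ Carrier λ β →
    (Fq c × Fq α × Fq β) × x′ ≡ c * x × y′ ≡ c * y + (α * t₁ + β * t₂)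

  Independent₂ : Carrier → Carrier → Set
  Independent₂ t₁ t₂ = ∀ {α β} → Fq α → Fq β → α * t₁ + β * t₂ ≡ 0# → α ≡ 0# × β ≡ 0#

  module _ {x y t₁ t₂ : Carrier} (x≢0 : x ≢ 0#) where

    pencil-vertical : ∀ {s} → Pencil x y t₁ t₂ (0# , s) → ∃ λ α → ∃ λ β → Fq α × Fq β × s ≡ α * t₁ + β * t₂
    pencil-vertical (c , α , β , (_ , fα , fβ) , 0≡ , s≡) = α , β , fα , fβ , trans s≡
      (trans (cong (λ c → c * y + (α * t₁ + β * t₂)) (x*y≡0⇒y≡0 x≢0 (trans (*-comm x c) (sym 0≡))))
        (trans (cong (_+ (α * t₁ + β * t₂)) (zeroˡ y)) (+-identityˡ _)))

    plane-Pencil : W x → Independent₂ t₁ t₂ → Plane (Pencil x y t₁ t₂)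
    plane-Pencil wx ind₂ = plane-from-basis ⟨ x , 0# , 0# ⟩ ⟨ y , t₁ , t₂ ⟩ wx W-0 W-0 ind
      (λ (c , α , β , fs , x≡ , y≡) → ⟨ c , α , β ⟩ , fs , trans x≡ (sym (drop c α β)) , trans y≡ (sym (+-assoc _ _ _)))
      (λ { {c = ⟨ c , α , β ⟩} fs x≡ y≡ → c , α , β , fs , trans x≡ (drop c α β) , trans y≡ (+-assoc _ _ _) })
      where
      drop : ∀ c α β → c * x + α * 0# + β * 0# ≡ c * x
      drop c α β = solve 4 (λ c α β x → c :* x :+ α :* O :+ β :* O := c :* x) refl c α β x
      ind : ∀ {c} → FqVec c → c ∙ ⟨ x , 0# , 0# ⟩ ≡ 0# → c ∙ ⟨ y , t₁ , t₂ ⟩ ≡ 0# → c ≡ 𝟎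
      ind {⟨ c , α , β ⟩} (fc , fα , fβ) eq eq′ = vec-≡ c≡0 (proj₁ αβ≡0) (proj₂ αβ≡0)
        where
        c≡0 = x*y≡0⇒y≡0 x≢0 (trans (*-comm x c) (trans (sym (drop c α β)) eq))
        αβ≡0 = ind₂ fα fβ (trans (sym (trans (+-assoc _ _ _) (trans (cong (λ c → c * y + (α * t₁ + β * t₂)) c≡0)
          (trans (cong (_+ (α * t₁ + β * t₂)) (zeroˡ y)) (+-identityˡ _))))) eq′)

    Pencil∩S : Independent₂ t₁ t₂ → IsSubspaceOfDim (Pencil x y t₁ t₂ ∩ S) 2
    Pencil∩S ind₂ = basis-vectors , (λ { zero → W-0 ; (suc zero) → W-0 }) , ind , λ w → mk⇔ (forward w) (backward w)
      where
      basis-vectors : Fin 2 → Vec2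
      basis-vectors zero = 0# , t₁
      basis-vectors (suc zero) = 0# , t₂
      collect : ∀ (c : Fin 2 → Carrier) → lincomb 2 c basis-vectors ≡ (0# , c zero * t₁ + c (suc zero) * t₂)
      collect c = cong₂ _,_ (solve 2 (λ c d → c :* O :+ (d :* O :+ O) := O) refl (c zero) (c (suc zero)))
        (solve 4 (λ c d x y → c :* x :+ (d :* y :+ O) := c :* x :+ d :* y) refl (c zero) (c (suc zero)) t₁ t₂)
      ind : Independent 2 basis-vectors
      ind c fc eq = λ { zero → proj₁ c≡0 ; (suc zero) → proj₂ c≡0 }
        where c≡0 = ind₂ (fc zero) (fc (suc zero)) (cong proj₂ (trans (sym (collect c)) eq))
      pair : Carrier → Carrier → Fin 2 → Carrier
      pair α β zero = α
      pair α β (suc zero) = β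
      forward : ∀ w → (Pencil x y t₁ t₂ ∩ S) w → InSpan 2 basis-vectors w
      forward (_ , s) (p , refl) = let (α , β , fα , fβ , s≡) = pencil-vertical p in
        pair α β , (λ { zero → fα ; (suc zero) → fβ }) , trans (cong (0# ,_) s≡) (sym (collect (pair α β)))
      backward : ∀ w → InSpan 2 basis-vectors w → (Pencil x y t₁ t₂ ∩ S) w
      backward w (c , fc , refl) = (0# , c zero , c (suc zero) , (Fq-0 , fc zero , fc (suc zero))
        , trans (cong proj₁ (collect c)) (sym (zeroˡ x))
        , trans (cong proj₂ (collect c)) (sym (trans (cong (_+ (c zero * t₁ + c (suc zero) * t₂)) (zeroˡ y)) (+-identityˡ _))))
        , cong proj₁ (collect c)

    -- All first components are F_q-multiples of x. For intersections with a pencil this rules out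
    -- the case `graph`.
    pencil-not-graph : ∀ {x₁ y₁ x₂ y₂} → Pencil x y t₁ t₂ (x₁ , y₁) → Pencil x y t₁ t₂ (x₂ , y₂) → rmap x₁ x₂ ≡ 0#
    pencil-not-graph (c , _ , _ , (fc , _) , refl , _) (d , _ , _ , (fd , _) , refl , _) = trans (rmap-*ˡ fc x _)
      (trans (cong (c *_) (trans (rmap-*ʳ fd x x) (trans (cong (d *_) (rmap-self x)) (zeroʳ d)))) (zeroʳ c))

  point : Point → Carrier
  point i = comb (h i)

  point-W : ∀ i → W (point i)
  point-W i = comb-W (FqVec-h i)

  point≢0 : ∀ i → point i ≢ 0#
  point≢0 i e = h≢𝟎 i (independent (FqVec-h i) e)

  point-unique : ∀ {i k c c′ x} → Fq c → Fq c′ → x ≢ 0# → x ≡ c * point i → x ≡ c′ * point k → i ≡ k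
  point-unique {i} {k} {c} {c′} fc fc′ x≢0 e e′ = ⊛-h-injective
    (λ c≡0 → x≢0 (trans e (trans (cong (_* point i) c≡0) (zeroˡ _))))
    (comb-injective (FqVec-⊛ fc (FqVec-h i)) (FqVec-⊛ fc′ (FqVec-h k)) (trans (comb-⊛ c (h i)) (trans (sym e) (trans e′ (sym
        (comb-⊛ c′ (h k)))))))

  -- Planes meeting S in {r x^q − r^q x : r ∈ W}, where x spans the point i.
  aPlane : Point → VSet
  aPlane i = Pencil (point i) (e₀ * (point i * φ (point i))) (u (a i)) (u (b i))

  -- An endomorphism of h^⊥ with characteristic polynomial t² − t − δ, hence without eigenvalue in 𝔽.
  twist : Point → Carrier → Carrier → Vec
  twist i s t = ab i (δ * t) (s + t)

  -- Here Z is the subspace with normal vector `g i`. That g · h ≠ 0 means both that the point `i`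
  -- lies outside Z and that h^⊥ is a complement of `g i`, so that (s, t) runs through the q² lines
  -- on T_Z outside U.
  bPlane : NIndex → VSet
  bPlane (i , (s , _) , (t , _)) = Pencil (point i) (u (twist i s t)) (u (g i)) (e′ + u (ab i s t))

  independent-a : ∀ i → Independent₂ (u (a i)) (u (b i))
  independent-a i {α} {β} fα fβ eq = ab≡𝟎 i (u-kernel (FqVec-ab i fα fβ) (trans (u-ab i α β) eq))

  collect-b : ∀ i α β m → α * u (g i) + β * (e′ + u m) ≡ β * e′ + u (α ⊛ g i ⊞ β ⊛ m)
  collect-b i α β m = begin
    α * u (g i) + β * (e′ + u m)
      ≡⟨ solve 5 (λ α β x e y → α :* x :+ β :* (e :+ y) := β :* e :+ (α :* x :+ β :* y)) refl α β (u (g i)) e′ (u m) ⟩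
    β * e′ + (α * u (g i) + β * u m)      ≡⟨ cong (β * e′ +_) (trans (u-⊞ _ _) (cong₂ _+_ (u-⊛ α (g i)) (u-⊛ β m))) ⟨
    β * e′ + u (α ⊛ g i ⊞ β ⊛ m)          ∎

  -- K is the direct sum of the line of `e′` and of U, and `u` is injective over F_q.
  e′-unique : ∀ {β β′ m m′} → Fq β → Fq β′ → FqVec m → FqVec m′ → β * e′ + u m ≡ β′ * e′ + u m′ → β ≡ β′ × m ≡ m′
  e′-unique {β} {β′} {m} {m′} fβ fβ′ fm fm′ eq = x-y≡0⇒x≡y β-β′≡0 , sym (⊟≡𝟎 (u-kernel (FqVec-⊟ fm′ fm) (trans (sym diff)
      (trans (cong (_* e′) β-β′≡0) (zeroˡ e′)))))
    where
    diff : (β - β′) * e′ ≡ u (m′ ⊟ m)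
    diff = trans (solve 5 (λ b b′ e x y → (b :- b′) :* e := ((b :* e :+ x) :- (b′ :* e :+ y)) :+ (y :- x)) refl β β′ e′ (u m) (u m′))
      (trans (cong (_+ (u m′ - u m)) (x≡y⇒x-y≡0 eq)) (trans (+-identityˡ _) (sym (u-⊟ m′ m))))
    β-β′≡0 = e′-independent (Fq-- fβ fβ′) (FqVec-⊟ fm′ fm) diff

  e′-free : ∀ {β m m′} → Fq β → FqVec m → FqVec m′ → u m ≡ β * e′ + u m′ → β ≡ 0# × m ≡ m′
  e′-free {β} {m} fβ fm fm′ eq = let (p , r) = e′-unique Fq-0 fβ fm fm′ (trans (trans (cong (_+ u m) (zeroˡ e′)) (+-identityˡ _)) eq) in sym p , r

  g-part : ∀ i {α β m} → β ≡ 0# → α ⊛ g i ⊞ β ⊛ m ≡ α ⊛ g i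
  g-part i {α} {β} {m} β≡0 = trans (cong (α ⊛ g i ⊞_) (trans (cong (_⊛ m) β≡0) (⊛-zeroˡ m))) (⊞-identityʳ _)

  αg≡𝟎⇒α≡0 : ∀ i {α} → α * (g i ∙ h i) ≡ 0# → α ≡ 0#
  αg≡𝟎⇒α≡0 i {α} eq = x*y≡0⇒y≡0 (g∙h≢0 i) (trans (*-comm _ α) eq)

  independent-b : ∀ i m → FqVec m → Independent₂ (u (g i)) (e′ + u m)
  independent-b i m fm {α} {β} fα fβ eq = αg≡𝟎⇒α≡0 i (begin
      α * (g i ∙ h i)                     ≡⟨ ∙-⊛ α (g i) (h i) ⟨
      (α ⊛ g i) ∙ h i                     ≡⟨ cong (_∙ h i) (trans (sym (g-part i β≡0)) (sym (proj₂ zero-eq))) ⟩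
      𝟎 ∙ h i                             ≡⟨ trans (∙-comm 𝟎 (h i)) (∙-zeroʳ (h i)) ⟩
      0#                                  ∎) , β≡0
    where
    u𝟎 : u 𝟎 ≡ 0#
    u𝟎 = trans (cong u (sym (⊛-zeroˡ 𝟎))) (trans (u-⊛ 0# 𝟎) (zeroˡ _))
    zero-eq = e′-free fβ FqVec-𝟎 (FqVec-⊞ (FqVec-⊛ fα (FqVec-g i)) (FqVec-⊛ fβ fm)) (trans u𝟎 (trans (sym eq) (collect-b i α β m)))
    β≡0 = proj₁ zero-eq

  ab-orthogonal′ : ∀ i s t → ab i s t ∙ h i ≡ 0#
  ab-orthogonal′ i s t = trans (∙-comm _ (h i)) (ab-orthogonal i s t)

  DIndex : Set
  DIndex = Point ⊎ NIndex

  dPlane : DIndex → VSet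
  dPlane (inj₁ i) = aPlane i
  dPlane (inj₂ k) = bPlane k

  FqVec-index : ∀ i (s t : 𝔽) → FqVec (ab i (proj₁ s) (proj₁ t))
  FqVec-index i (_ , fs) (_ , ft) = FqVec-ab i fs ft

  plane-D : ∀ k → Plane (dPlane k)
  plane-D (inj₁ i) = plane-Pencil (point≢0 i) (point-W i) (independent-a i)
  plane-D (inj₂ (i , s , t)) = plane-Pencil (point≢0 i) (point-W i) (independent-b i _ (FqVec-index i s t))

  D∩S : ∀ k → IsSubspaceOfDim (dPlane k ∩ S) 2
  D∩S (inj₁ i) = Pencil∩S (point≢0 i) (independent-a i)
  D∩S (inj₂ (i , s , t)) = Pencil∩S (point≢0 i) (independent-b i _ (FqVec-index i s t))

  D-not-graph : ∀ k {x₁ y₁ x₂ y₂} → dPlane k (x₁ , y₁) → dPlane k (x₂ , y₂) → rmap x₁ x₂ ≡ 0#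
  D-not-graph (inj₁ i) = pencil-not-graph (point≢0 i)
  D-not-graph (inj₂ (i , _)) = pencil-not-graph (point≢0 i)

  graph-D-separated : ∀ {i k} → ¬ Common (graphPlane i) (dPlane k)
  graph-D-separated {(d , _) , a₁} {k} common = go (split (plane-Γ _ _) (plane-D k) common)
    where
    go : ¬ CommonPair (Γ (gmap (d - φ a₁) a₁)) (dPlane k)
    go (graph _ p _ p′ r≢0) = r≢0 (D-not-graph k p p′)
    go (mixed p _ s≢0 _ _ _) = s≢0 (Γ-vertical p)
    go (vertical p _ s≢0 _ _ _) = s≢0 (Γ-vertical p)

  orthogonal-points : ∀ i k {v c x} → FqVec v → h i ∙ v ≡ 0# → x ≡ comb v → Fq c → x ≡ c * point k → x ≢ 0# → h i ∙ h k ≡ 0#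
  orthogonal-points i k {v} {c} fv h∙v x≡ fc x≡c x≢0 = x*y≡0⇒y≡0 c≢0 (begin
    c * (h i ∙ h k)         ≡⟨ cong (c *_) (∙-comm (h i) (h k)) ⟩
    c * (h k ∙ h i)         ≡⟨ ∙-⊛ c (h k) (h i) ⟨
    (c ⊛ h k) ∙ h i         ≡⟨ cong (_∙ h i) (comb-injective (FqVec-⊛ fc (FqVec-h k)) fv (trans (comb-⊛ c (h k)) (trans (sym x≡c) x≡))) ⟩
    v ∙ h i                 ≡⟨ trans (∙-comm v (h i)) h∙v ⟩
    0#                      ∎)
    where
    c≢0 : c ≢ 0#
    c≢0 c≡0 = x≢0 (trans x≡c (trans (cong (_* point k) c≡0) (zeroˡ _)))

  -- By `orthogonal⇒⨯` the vector m is h × (m × j), so `u m` is up to sign the value at the point of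
  -- `rmap` with parameter comb (m × j).
  orthogonal⇒rmap : ∀ {k m} → FqVec m → m ∙ h k ≡ 0# → ∃ λ r → u m ≡ rmap r (point k)
  orthogonal⇒rmap {k} {m} fm m∙h = - 1# * comb (m ⨯ j k) , (begin
    u m                                     ≡⟨ cong u (orthogonal⇒⨯ (h∙j≡1 k) m∙h) ⟩
    u (h k ⨯ (m ⨯ j k))                     ≡⟨ rmap-comb (FqVec-h k) (FqVec-⨯ fm (FqVec-j k)) ⟨
    rmap (point k) (comb (m ⨯ j k))         ≡⟨ rmap-anti _ _ ⟩
    - rmap (comb (m ⨯ j k)) (point k)       ≡⟨ solve 1 (λ x → :- x := (:- I) :* x) refl _ ⟩
    - 1# * rmap (comb (m ⨯ j k)) (point k)  ≡⟨ rmap-*ˡ (Fq-neg Fq-1) _ _ ⟨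
    rmap (- 1# * comb (m ⨯ j k)) (point k)  ∎)

  n-D-separated : ∀ {k l} → ¬ Common (nPlane k) (dPlane l)
  n-D-separated {k@(i , _)} {l} common = go l (split (dimension-≐ (≐-sym (N⇔InN i r)) (plane-N i r)) (plane-D l)
      (Common-≐ (N⇔InN i r) ≐-refl common))
    where
    r = representative k

    -- Since x lies in Z, both T_Z and the vertical part of `aPlane` lie in the image of r ↦
    -- `rmap r x`. A common vector over x would put e₀ x^(q+1) there as well, against
    -- `e₀x^q+1≢rmap`.
    a-mixed : ∀ l {x y} → InN i r (x , y) → aPlane l (x , y) → x ≢ 0# → ⊥
    a-mixed l {x} {y} (v , fv , h∙v , x≡ , d , fd , y≡) (c , α , β , (fc , fα , fβ) , x≡c , y≡c) x≢0 =
      let (R , uζ≡) = orthogonal⇒rmap {l} fζ ζ∙h in e₀x^q+1≢rmap (point≢0 l) (r + c ⁻¹ * R) (*-cancelˡ c≢0 (begin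
        c * Y                                      ≡⟨ solve 3 (λ y z w → w := (y :+ (w :- z)) :- (y :- z)) refl (rmap r x) (u ζ) (c * Y) ⟩
        (rmap r x + (c * Y - u ζ)) - (rmap r x - u ζ) ≡⟨ cong (_- (rmap r x - u ζ)) (cong (λ t → rmap r x + t) cY-uζ) ⟩
        (rmap r x + rmap r x) - (rmap r x - u ζ)   ≡⟨ solve 2 (λ y z → (y :+ y) :- (y :- z) := y :+ z) refl (rmap r x) (u ζ) ⟩
        rmap r x + u ζ                             ≡⟨ cong₂ _+_ (trans (cong (rmap r) x≡c) (rmap-*ʳ fc r (point l))) uζ≡ ⟩
        c * rmap r (point l) + rmap R (point l)    ≡⟨ cong (c * rmap r (point l) +_) (x*[x⁻¹*y]≡y c≢0) ⟨
        c * rmap r (point l) + c * (c ⁻¹ * rmap R (point l)) ≡⟨ distribˡ c _ _ ⟨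
        c * (rmap r (point l) + c ⁻¹ * rmap R (point l)) ≡⟨ cong (λ t → c * (rmap r (point l) + t)) (rmap-*ˡ (Fq-⁻¹ c≢0 fc) R (point l)) ⟨
        c * (rmap r (point l) + rmap (c ⁻¹ * R) (point l)) ≡⟨ cong (c *_) (rmap-+ˡ r _ (point l)) ⟨
        c * rmap (r + c ⁻¹ * R) (point l)          ∎))
      where
      Y = e₀ * (point l * φ (point l))
      c≢0 : c ≢ 0#
      c≢0 c≡0 = x≢0 (trans x≡c (trans (cong (_* point l) c≡0) (zeroˡ _)))
      -- The T_Z-part minus the vertical part of the pencil. Both are orthogonal to `h l`, the
      -- former because x ∈ Z.
      ζ = d ⊛ h i ⊟ ab l α β
      fζ : FqVec ζ
      fζ = FqVec-⊟ (FqVec-⊛ fd (FqVec-h i)) (FqVec-ab l fα fβ)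
      ζ∙h : ζ ∙ h l ≡ 0#
      ζ∙h = trans (∙-⊟ _ _ (h l)) (trans (cong₂ _-_ (trans (∙-⊛ d (h i) (h l)) (trans (cong (d *_)
          (orthogonal-points i l fv h∙v x≡ fc x≡c x≢0)) (zeroʳ d)))
        (ab-orthogonal′ l α β)) (-‿inverseʳ 0#))
      uζ : u ζ ≡ d * u (h i) - (α * u (a l) + β * u (b l))
      uζ = trans (u-⊟ _ _) (cong₂ _-_ (u-⊛ d (h i)) (u-ab l α β))
      cY-uζ : c * Y - u ζ ≡ rmap r x
      cY-uζ = begin
        c * Y - u ζ                               ≡⟨ cong (λ t → c * Y - t) uζ ⟩
        c * Y - (d * u (h i) - T)                 ≡⟨ solve 3 (λ y d t → y :- (d :- t) := (y :+ t) :- d) refl (c * Y) (d * u (h i)) T ⟩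
        (c * Y + T) - d * u (h i)                 ≡⟨ cong (_- d * u (h i)) (trans (sym y≡c) y≡) ⟩
        (rmap r x + d * u (h i)) - d * u (h i)    ≡⟨ solve 2 (λ x y → (x :+ y) :- y := x) refl (rmap r x) (d * u (h i)) ⟩
        rmap r x                                  ∎
        where T = α * u (a l) + β * u (b l)

    -- A vertical vector of N lies in U, and the vertical part of `bPlane` meets U in the line of
    -- `u (g l)`. So `g l` would be proportional to `h i`, which is orthogonal to `h l` since x ∈ Z,
    -- whereas g · h ≠ 0.
    b-mixed : ∀ l {x y s} → InN i r (0# , s) → bPlane l (0# , s) → s ≢ 0# → InN i r (x , y) → bPlane l (x , y) → x ≢ 0# → ⊥
    b-mixed (l , (σ , fσ) , (τ , fτ)) {x} {y} {s} p p′ s≢0 (v , fv , h∙v , x≡ , _) (c , _ , _ , (fc , _) , x≡c , _) x≢0 =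
      finish (InN-vertical {i} {r} p) (pencil-vertical (point≢0 l) p′)
      where
      m = ab l σ τ
      finish : (∃ λ c → Fq c × s ≡ c * u (h i)) → ¬ (∃ λ α → ∃ λ β → Fq α × Fq β × s ≡ α * u (g l) + β * (e′ + u m))
      finish (d , fd , s≡d) (α , β , fα , fβ , s≡) = s≢0 (trans s≡ (trans (cong₂ (λ α β → α * u (g l) + β * (e′ + u m)) α≡0 β≡0)
          (solve 2 (λ x y → O :* x :+ O :* y := O) refl (u (g l)) (e′ + u m))))
        where
        free = e′-free fβ (FqVec-⊛ fd (FqVec-h i)) (FqVec-⊞ (FqVec-⊛ fα (FqVec-g l)) (FqVec-⊛ fβ (FqVec-ab l fσ fτ)))
          (trans (u-⊛ d (h i)) (trans (sym s≡d) (trans s≡ (collect-b l α β m))))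
        β≡0 = proj₁ free
        α≡0 : α ≡ 0#
        α≡0 = αg≡𝟎⇒α≡0 l (begin
          α * (g l ∙ h l)             ≡⟨ ∙-⊛ α (g l) (h l) ⟨
          (α ⊛ g l) ∙ h l             ≡⟨ cong (_∙ h l) (trans (sym (g-part l β≡0)) (sym (proj₂ free))) ⟩
          (d ⊛ h i) ∙ h l             ≡⟨ ∙-⊛ d (h i) (h l) ⟩
          d * (h i ∙ h l)             ≡⟨ cong (d *_) (orthogonal-points i l fv h∙v x≡ fc x≡c x≢0) ⟩
          d * 0#                      ≡⟨ zeroʳ d ⟩
          0#                          ∎)

    go : ∀ l → ¬ CommonPair (InN i r) (dPlane l)
    go l (graph _ p _ p′ r≢0) = r≢0 (D-not-graph l p p′)
    go l (vertical p _ s≢0 p′ _ ¬prop) = InN-not-vertical {i} {r} p s≢0 p′ ¬prop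
    go (inj₁ l) (mixed _ _ _ n p x≢0) = a-mixed l n p x≢0
    go (inj₂ l) (mixed p p′ s≢0 n n′ x≢0) = b-mixed l p p′ s≢0 n n′ x≢0

  InA : Point → Carrier → Set
  InA i s = ∃ λ m → FqVec m × h i ∙ m ≡ 0# × s ≡ u m

  a-vertical : ∀ i {s} → aPlane i (0# , s) → InA i s
  a-vertical i p = let (α , β , fα , fβ , s≡) = pencil-vertical (point≢0 i) p in
    ab i α β , FqVec-ab i fα fβ , ab-orthogonal i α β , trans s≡ (sym (u-ab i α β))

  InB : NIndex → Carrier → Set
  InB (i , (s , _) , (t , _)) z = ∃ λ α → ∃ λ β → Fq α × Fq β × z ≡ β * e′ + u (α ⊛ g i ⊞ β ⊛ ab i s t)

  b-vertical : ∀ k {z} → bPlane k (0# , z) → InB k z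
  b-vertical (i , _) p = let (α , β , fα , fβ , s≡) = pencil-vertical (point≢0 i) p in
    α , β , fα , fβ , trans s≡ (collect-b i α β _)

  a-separated : ∀ {i k} → Common (aPlane i) (aPlane k) → i ≡ k
  a-separated {i} {k} common = go (split (plane-D (inj₁ i)) (plane-D (inj₁ k)) common)
    where
    vertical-case : ∀ {s s′} → InA i s → InA k s → s ≢ 0# → InA i s′ → InA k s′ → (∀ {c} → Fq c → s′ ≢ c * s) → i ≡ k
    vertical-case {s} {s′} (m , fm , h∙m , s≡) (n , fn , h∙n , s≡n) s≢0 (m′ , fm′ , h∙m′ , s′≡) (n′ , fn′ , h∙n′ , s′≡n) ¬prop =
      -- The coordinate vectors m, m′ of elements of U are read as elements of W through `comb`, so
      -- that uniqueness of the normal vector applies to lines of U too.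
      orthogonal-unique fm fm′ h∙m h∙m′ refl refl fn fn′ h∙n h∙n′ (cong comb m≡n) (cong comb m′≡n′) r≢0
      where
      m≡n = u-injective fm fn (trans (sym s≡) s≡n)
      m′≡n′ = u-injective fm′ fn′ (trans (sym s′≡) s′≡n)
      u-𝟎 : m ≡ 𝟎 → u m ≡ 0#
      u-𝟎 refl = trans (cong u (sym (⊛-zeroˡ 𝟎))) (trans (u-⊛ 0# 𝟎) (zeroˡ _))
      r≢0 : rmap (comb m) (comb m′) ≢ 0#
      r≢0 e = finish (rmap≡0⇒proportional (λ e → s≢0 (trans s≡ (u-𝟎 (independent fm e)))) e)
        where
        finish : ¬ (∃ λ c → Fq c × comb m′ ≡ c * comb m)
        finish (c , fc , e) = ¬prop fc (trans s′≡ (trans (cong u (comb-injective fm′ (FqVec-⊛ fc fm) (trans e (sym (comb-⊛ c m)))))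
          (trans (u-⊛ c m) (cong (c *_) (sym s≡)))))
    go : CommonPair (aPlane i) (aPlane k) → i ≡ k
    go (graph p _ p′ _ r≢0) = contradiction (D-not-graph (inj₁ i) p p′) r≢0
    go (mixed _ _ _ (c , _ , _ , (fc , _) , x≡ , _) (c′ , _ , _ , (fc′ , _) , x≡′ , _) x≢0) = point-unique fc fc′ x≢0 x≡ x≡′
    go (vertical p n s≢0 p′ n′ ¬prop) = vertical-case (a-vertical i p) (a-vertical k n) s≢0 (a-vertical i p′) (a-vertical k n′) ¬prop

  -- One space lies in U, while the other meets U in the line of `u (g (proj₁ k))`: comparing the
  -- `e′`-parts gives β = 0.
  A∩B : ∀ i k {s} → InA i s → InB k s → ∃ λ α → Fq α × s ≡ α * u (g (proj₁ k)) × h i ∙ (α ⊛ g (proj₁ k)) ≡ 0#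
  A∩B i (k , (σ , fσ) , (τ , fτ)) {s} (m , fm , h∙m , s≡) (α , β , fα , fβ , s≡′) = α , fα , trans s≡ (trans (cong u m≡αg) (u-⊛ α (g k)))
    , subst (λ m → h i ∙ m ≡ 0#) m≡αg h∙m
    where
    free = e′-free fβ fm (FqVec-⊞ (FqVec-⊛ fα (FqVec-g k)) (FqVec-⊛ fβ (FqVec-ab k fσ fτ))) (trans (sym s≡) s≡′)
    m≡αg : m ≡ α ⊛ g k
    m≡αg = trans (proj₂ free) (g-part k (proj₁ free))

  -- By `A∩B` the common vertical vectors fill at most a line. If in addition the planes share a
  -- vector off S, their points agree, and g · h ≠ 0 leaves no common vertical vector other than
  -- zero.
  a-b-separated : ∀ {i k} → ¬ Common (aPlane i) (bPlane k)
  a-b-separated {i} {k@(l , _)} common = go (split (plane-D (inj₁ i)) (plane-D (inj₂ k)) common)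
    where
    go : ¬ CommonPair (aPlane i) (bPlane k)
    go (graph p _ p′ _ r≢0) = r≢0 (D-not-graph (inj₁ i) p p′)
    go (mixed {s} p n s≢0 (c , _ , _ , (fc , _) , x≡ , _) (c′ , _ , _ , (fc′ , _) , x≡′ , _) x≢0) =
      finish (point-unique fc fc′ x≢0 x≡ x≡′) (A∩B i k (a-vertical i p) (b-vertical k n))
      where
      finish : i ≡ l → ¬ (∃ λ α → Fq α × s ≡ α * u (g l) × h i ∙ (α ⊛ g l) ≡ 0#)
      finish i≡l (α , fα , s≡ , h∙αg) = s≢0 (trans s≡ (trans (cong (_* u (g l)) (αg≡𝟎⇒α≡0 l
        (trans (sym (∙-⊛ α (g l) (h l))) (trans (∙-comm _ (h l)) (subst (λ i → h i ∙ (α ⊛ g l) ≡ 0#) i≡l h∙αg))))) (zeroˡ _)))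
    go (vertical {s} {s′} p n s≢0 p′ n′ ¬prop) = finish (A∩B i k (a-vertical i p) (b-vertical k n)) (A∩B i k
        (a-vertical i p′) (b-vertical k n′))
      where
      finish : (∃ λ α → Fq α × s ≡ α * u (g l) × h i ∙ (α ⊛ g l) ≡ 0#) → ¬ (∃ λ α → Fq α × s′ ≡ α * u (g l) × h i ∙ (α ⊛ g l) ≡ 0#)
      finish (α , fα , e , _) (α′ , fα′ , e′ , _) = let (_ , fd , e″) = multiples-proportional fα fα′ s≢0 e e′ in ¬prop fd e″

  ab-scale : ∀ i c s t → c ⊛ ab i s t ≡ ab i (c * s) (c * t)
  ab-scale i c s t = vec-≡ (eq _ _) (eq _ _) (eq _ _)
    where
    eq : ∀ x y → c * (s * x + t * y) ≡ (c * s) * x + (c * t) * y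
    eq = solve 5 (λ c s t x y → c :* (s :* x :+ t :* y) := (c :* s) :* x :+ (c :* t) :* y) refl c s t

  -- Pairing with `h i` kills h^⊥ but not `g i`, so α is determined, and `ab≡𝟎` handles the rest.
  g-ab-unique : ∀ i {α p r α′ p′ r′} → α ⊛ g i ⊞ ab i p r ≡ α′ ⊛ g i ⊞ ab i p′ r′ → α ≡ α′ × p ≡ p′ × r ≡ r′
  g-ab-unique i {α} {p} {r} {α′} {p′} {r′} eq = α≡α′ , x-y≡0⇒x≡y (proj₁ zeros) , x-y≡0⇒x≡y (proj₂ zeros)
    where
    dot : ∀ α p r → (α ⊛ g i ⊞ ab i p r) ∙ h i ≡ (g i ∙ h i) * α
    dot α p r = trans (∙-⊞ _ _ (h i)) (trans (cong₂ _+_ (∙-⊛ α (g i) (h i)) (ab-orthogonal′ i p r)) (trans (+-identityʳ _) (*-comm _ _)))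
    α≡α′ : α ≡ α′
    α≡α′ = *-cancelˡ (g∙h≢0 i) (trans (sym (dot α p r)) (trans (cong (_∙ h i) eq) (dot α′ p′ r′)))
    component : ∀ {c x y z} → c * z + (p * x + r * y) ≡ c * z + (p′ * x + r′ * y) → (p - p′) * x + (r - r′) * y ≡ 0#
    component {c} {x} {y} {z} e = trans (solve 8 (λ c z p r p′ r′ x y → (p :- p′) :* x :+ (r :- r′) :* y := (c :* z :+
        (p :* x :+ r :* y)) :- (c :* z :+ (p′ :* x :+ r′ :* y))) refl c z p r p′ r′ x y)
      (x≡y⇒x-y≡0 e)
    eq′ : α ⊛ g i ⊞ ab i p r ≡ α ⊛ g i ⊞ ab i p′ r′
    eq′ = trans eq (cong (λ α → α ⊛ g i ⊞ ab i p′ r′) (sym α≡α′))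
    zeros = ab≡𝟎 i (vec-≡ (component {α} (cong x₁ eq′)) (component {α} (cong x₂ eq′)) (component {α} (cong x₃ eq′)))

  twist-without-eigenvalue : ∀ {c β s t} → Fq c → Fq β → c ≢ 0# → c * (δ * t) + β * s ≡ 0# → c * (s + t) + β * t ≡ 0# → s ≡ 0# × t ≡ 0#
  twist-without-eigenvalue {c} {β} {s} {t} fc fβ c≢0 eq₁ eq₂ = s≡0 , t≡0
    where
    -- the hypotheses say that δ t = ω s and s + t = ω t
    ω = - (c ⁻¹ * β)
    fω : Fq ω
    fω = Fq-neg (Fq-* (Fq-⁻¹ c≢0 fc) fβ)
    divided : ∀ {x y} → c * x + β * y ≡ 0# → x ≡ ω * y
    divided {x} {y} e = x-y≡0⇒x≡y (trans (trans (cong (_- ω * y) (sym (x⁻¹*[x*y]≡y c≢0)))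
      (solve 5 (λ i c β x y → i :* (c :* x) :- (:- (i :* β)) :* y := i :* (c :* x :+ β :* y)) refl (c ⁻¹) c β x y))
      (trans (cong (c ⁻¹ *_) e) (zeroʳ _)))
    δt≡ωs = divided eq₁
    s+t≡ωt = divided eq₂
    s≡[ω-1]t : s ≡ (ω - 1#) * t
    s≡[ω-1]t = trans (solve 2 (λ s t → s := (s :+ t) :- t) refl s t) (trans (cong (_- t) s+t≡ωt) (solve 2 (λ w t →
        w :* t :- t := (w :- I) :* t) refl ω t))
    [ω²-ω-δ]t≡0 : ((ω * ω - ω) - δ) * t ≡ 0#
    [ω²-ω-δ]t≡0 = trans (solve 3 (λ w d t → ((w :* w :- w) :- d) :* t := w :* ((w :- I) :* t) :- d :* t) refl ω δ t)
      (x≡y⇒x-y≡0 (trans (cong (ω *_) (sym s≡[ω-1]t)) (sym δt≡ωs)))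
    t≡0 : t ≡ 0#
    t≡0 = x*y≡0⇒y≡0 (λ e → proj₂ (proj₂ rootless) fω (x-y≡0⇒x≡y e)) [ω²-ω-δ]t≡0
    s≡0 : s ≡ 0#
    s≡0 = trans s≡[ω-1]t (trans (cong ((ω - 1#) *_) t≡0) (zeroʳ _))

  n-index-≡ : ∀ {i l} {s t s′ t′ : 𝔽} → i ≡ l → proj₁ s ≡ proj₁ s′ → proj₁ t ≡ proj₁ t′ → _≡_ {A = NIndex} (i , s , t) (l , s′ , t′)
  n-index-≡ refl p r = cong₂ (λ s t → _ , s , t) (𝔽-≡ p) (𝔽-≡ r)

  b-separated : ∀ {k k′} → Common (bPlane k) (bPlane k′) → k ≡ k′
  b-separated {k@(i , (s , fs) , (t , ft))} {k′@(i′ , (s′ , fs′) , (t′ , ft′))} common = go (split (plane-D (inj₂ k))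
      (plane-D (inj₂ k′)) common)
    where
    -- The points agree, so c = c′; the `e′`-parts give β = β′. With κ and κ′ the elements of h^⊥
    -- given by (s, t) and (s′, t′), the components in h^⊥ leave c θ(κ - κ′) + β (κ - κ′) = 0 with c
    -- ≠ 0, where θ is `twist`.
    mixed-case : ∀ {x y} → bPlane k (x , y) → bPlane k′ (x , y) → x ≢ 0# → k ≡ k′
    mixed-case {x} {y} (c , α , β , (fc , fα , fβ) , x≡ , y≡) (c′ , α′ , β′ , (fc′ , fα′ , fβ′) , x≡′ , y≡′) x≢0 =
      same (point-unique fc fc′ x≢0 x≡ x≡′)
      where
      same : i ≡ i′ → k ≡ k′
      same refl = n-index-≡ refl (x-y≡0⇒x≡y (proj₁ zeros)) (x-y≡0⇒x≡y (proj₂ zeros))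
        where
        c≢0 : c ≢ 0#
        c≢0 c≡0 = x≢0 (trans x≡ (trans (cong (_* point i) c≡0) (zeroˡ _)))
        c≡c′ : c ≡ c′
        c≡c′ = *-cancelˡ (point≢0 i) (trans (*-comm _ c) (trans (trans (sym x≡) x≡′) (*-comm c′ _)))
        vector : ∀ c α β s t → Vec
        vector c α β s t = α ⊛ g i ⊞ ab i (c * (δ * t) + β * s) (c * (s + t) + β * t)
        FqVec-vector : ∀ {c α β s t} → Fq c → Fq α → Fq β → Fq s → Fq t → FqVec (vector c α β s t)
        FqVec-vector fc fα fβ fs ft = FqVec-⊞ (FqVec-⊛ fα (FqVec-g i))
          (FqVec-ab i (Fq-+ (Fq-* fc (Fq-* Fq-δ ft)) (Fq-* fβ fs)) (Fq-+ (Fq-* fc (Fq-+ fs ft)) (Fq-* fβ ft)))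
        collect : ∀ c α β s t → c * u (twist i s t) + (α * u (g i) + β * (e′ + u (ab i s t))) ≡ β * e′ + u (vector c α β s t)
        collect c α β s t = begin
          c * u (ab i (δ * t) (s + t)) + (α * u (g i) + β * (e′ + u (ab i s t)))
            ≡⟨ cong₂ (λ x y → c * x + (α * u (g i) + β * (e′ + y))) (u-ab i (δ * t) (s + t)) (u-ab i s t) ⟩
          c * ((δ * t) * A + (s + t) * B) + (α * u (g i) + β * (e′ + (s * A + t * B)))
            ≡⟨ solve 10 (λ c α β s t d A B G e → c :* ((d :* t) :* A :+ (s :+ t) :* B) :+ (α :* G :+ β :* (e :+ (s :* A :+ t :* B))) :=
                 β :* e :+ (α :* G :+ ((c :* (d :* t) :+ β :* s) :* A :+ (c :*
                     (s :+ t) :+ β :* t) :* B))) refl c α β s t δ A B (u (g i)) e′ ⟩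
          β * e′ + (α * u (g i) + ((c * (δ * t) + β * s) * A + (c * (s + t) + β * t) * B))
            ≡⟨ cong (β * e′ +_) (trans (u-⊞ _ _) (cong₂ _+_ (u-⊛ α (g i)) (u-ab i _ _))) ⟨
          β * e′ + u (vector c α β s t) ∎
          where
          A = u (a i)
          B = u (b i)
        unique = e′-unique fβ fβ′ (FqVec-vector fc fα fβ fs ft) (FqVec-vector fc′ fα′ fβ′ fs′ ft′)
          (trans (sym (collect c α β s t)) (trans (trans (sym y≡) y≡′) (collect c′ α′ β′ s′ t′)))
        coordinates = g-ab-unique i (trans (proj₂ unique)
          (cong₂ (λ c β → vector c α′ β s′ t′) (sym c≡c′) (sym (proj₁ unique))))
        zeros = twist-without-eigenvalue {s = s - s′} {t = t - t′} fc fβ c≢0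
          (trans (solve 7 (λ c d β s s′ t t′ → c :* (d :* (t :- t′)) :+ β :* (s :- s′) := (c :* (d :* t) :+ β :* s) :- (c :*
              (d :* t′) :+ β :* s′)) refl c δ β s s′ t t′)
            (x≡y⇒x-y≡0 (proj₁ (proj₂ coordinates))))
          (trans (solve 6 (λ c β s s′ t t′ → c :* ((s :- s′) :+ (t :- t′)) :+ β :* (t :- t′) := (c :* (s :+ t) :+ β :* t) :-
              (c :* (s′ :+ t′) :+ β :* t′)) refl c β s s′ t t′)
            (x≡y⇒x-y≡0 (proj₂ (proj₂ coordinates))))

    -- Both planes meet S in the same T. The point T ∩ U determines `g i` and hence `i`; any element
    -- of T outside U then determines κ, which is normalised to lie in h^⊥.
    vertical-case : ∀ {z z′} → InB k z → InB k′ z → z ≢ 0# → InB k z′ → InB k′ z′ → (∀ {c} → Fq c → z′ ≢ c * z) → k ≡ k′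
    vertical-case {z} {z′} (α₁ , β₁ , fα₁ , fβ₁ , z≡) (α₁′ , β₁′ , fα₁′ , fβ₁′ , z≡′) z≢0 (α₂ , β₂ , fα₂ , fβ₂ , w≡)
        (α₂′ , β₂′ , fα₂′ , fβ₂′ , w≡′) ¬prop = decide (β₁ ≟ 0#)
      where
      κ = ab i s t
      κ′ = ab i′ s′ t′
      fκ = FqVec-ab i fs ft
      fκ′ = FqVec-ab i′ fs′ ft′
      FqVec-g+κ : ∀ {α β} → Fq α → Fq β → FqVec (α ⊛ g i ⊞ β ⊛ κ)
      FqVec-g+κ fα fβ = FqVec-⊞ (FqVec-⊛ fα (FqVec-g i)) (FqVec-⊛ fβ fκ)
      FqVec-g+κ′ : ∀ {α β} → Fq α → Fq β → FqVec (α ⊛ g i′ ⊞ β ⊛ κ′)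
      FqVec-g+κ′ fα fβ = FqVec-⊞ (FqVec-⊛ fα (FqVec-g i′)) (FqVec-⊛ fβ fκ′)
      unique₁ = e′-unique fβ₁ fβ₁′ (FqVec-g+κ fα₁ fβ₁) (FqVec-g+κ′ fα₁′ fβ₁′) (trans (sym z≡) z≡′)
      unique₂ = e′-unique fβ₂ fβ₂′ (FqVec-g+κ fα₂ fβ₂) (FqVec-g+κ′ fα₂′ fβ₂′) (trans (sym w≡) w≡′)
      eq₁ : α₁ ⊛ g i ⊞ β₁ ⊛ κ ≡ α₁′ ⊛ g i′ ⊞ β₁ ⊛ κ′
      eq₁ = trans (proj₂ unique₁) (cong (λ β → α₁′ ⊛ g i′ ⊞ β ⊛ κ′) (sym (proj₁ unique₁)))
      eq₂ : α₂ ⊛ g i ⊞ β₂ ⊛ κ ≡ α₂′ ⊛ g i′ ⊞ β₂ ⊛ κ′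
      eq₂ = trans (proj₂ unique₂) (cong (λ β → α₂′ ⊛ g i′ ⊞ β ⊛ κ′) (sym (proj₁ unique₂)))
      same-g : ∀ {α α′} → α ≢ 0# → α ⊛ g i ≡ α′ ⊛ g i′ → i ≡ i′
      same-g {α} {α′} α≢0 e = g-injective i i′ (trans (⊛-cancel α≢0 e) (sym (⊛-assoc (α ⁻¹) α′ (g i′))))
      same-κ : ∀ {α α′ β} → i ≡ i′ → β ≢ 0# → α ⊛ g i ⊞ β ⊛ κ ≡ α′ ⊛ g i′ ⊞ β ⊛ κ′ → k ≡ k′
      same-κ {α} {α′} {β} refl β≢0 e = n-index-≡ refl (*-cancelˡ β≢0 (proj₁ (proj₂ coordinates))) (*-cancelˡ β≢0 (proj₂
          (proj₂ coordinates)))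
        where
        coordinates = g-ab-unique i (trans (cong (α ⊛ g i ⊞_) (sym (ab-scale i β s t))) (trans e (cong (α′ ⊛ g i ⊞_) (ab-scale i β s′ t′))))
      decide : Dec (β₁ ≡ 0#) → k ≡ k′
      decide (yes β₁≡0) = same-κ (same-g α₁≢0 (trans (sym (g-part i β₁≡0)) (trans eq₁ (g-part i′ β₁≡0)))) β₂≢0 eq₂
        where
        only-g : ∀ {α β z} → z ≡ β * e′ + u (α ⊛ g i ⊞ β ⊛ κ) → β ≡ 0# → z ≡ α * u (g i)
        only-g {α} {β} e β≡0 = trans e (trans (cong₂ _+_ (trans (cong (_* e′) β≡0) (zeroˡ e′)) (trans (cong u (g-part i β≡0))
            (u-⊛ α (g i)))) (+-identityˡ _))
        z≡α₁g = only-g z≡ β₁≡0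
        α₁≢0 : α₁ ≢ 0#
        α₁≢0 e = z≢0 (trans z≡α₁g (trans (cong (_* u (g i)) e) (zeroˡ _)))
        β₂≢0 : β₂ ≢ 0#
        β₂≢0 e = let (_ , fd , e″) = multiples-proportional fα₁ fα₂ z≢0 z≡α₁g (only-g w≡ e) in ¬prop fd e″
      decide (no β₁≢0) = same-κ (same-g α≢0 αg≡α′g′) β₁≢0 eq₁
        where
        -- Subtracting c times the first vector from the second cancels the `e′`-part. The rest is a
        -- multiple of `u (g i)`, nonzero because z′ is not c z.
        c = β₁ ⁻¹ * β₂
        β₂≡cβ₁ : β₂ ≡ c * β₁
        β₂≡cβ₁ = trans (sym (x*[x⁻¹*y]≡y β₁≢0)) (*-comm β₁ c)
        combination : ∀ α₁ α₂ g k → α₂ ⊛ g ⊞ β₂ ⊛ k ≡ (α₂ - c * α₁) ⊛ g ⊞ c ⊛ (α₁ ⊛ g ⊞ β₁ ⊛ k)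
        combination α₁ α₂ g k = trans (cong (λ β → α₂ ⊛ g ⊞ β ⊛ k) β₂≡cβ₁) (vec-≡ (eq _ _) (eq _ _) (eq _ _))
          where
          eq : ∀ x y → α₂ * x + (c * β₁) * y ≡ (α₂ - c * α₁) * x + c * (α₁ * x + β₁ * y)
          eq = solve 6 (λ c α₁ α₂ β₁ x y → α₂ :* x :+ (c :* β₁) :* y := (α₂ :- c :* α₁) :* x :+ c :* (α₁ :* x :+ β₁ :* y)) refl c α₁ α₂ β₁
        ⊞-cancelʳ : ∀ {v w} m → v ⊞ m ≡ w ⊞ m → v ≡ w
        ⊞-cancelʳ m e = vec-≡ (cancel (cong x₁ e)) (cancel (cong x₂ e)) (cancel (cong x₃ e))
          where
          cancel : ∀ {x y z} → x + z ≡ y + z → x ≡ y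
          cancel {x} {y} {z} e = trans (solve 2 (λ x z → x := (x :+ z) :- z) refl x z) (trans (cong (_- z) e) (solve 2
              (λ y z → (y :+ z) :- z := y) refl y z))
        αg≡α′g′ : (α₂ - c * α₁) ⊛ g i ≡ (α₂′ - c * α₁′) ⊛ g i′
        αg≡α′g′ = ⊞-cancelʳ (c ⊛ (α₁ ⊛ g i ⊞ β₁ ⊛ κ)) (trans (sym (combination α₁ α₂ (g i) κ))
          (trans eq₂ (trans (combination α₁′ α₂′ (g i′) κ′) (cong (λ m → (α₂′ - c * α₁′) ⊛ g i′ ⊞ c ⊛ m) (sym eq₁)))))
        α≢0 : α₂ - c * α₁ ≢ 0#
        α≢0 e = ¬prop (Fq-* (Fq-⁻¹ β₁≢0 fβ₁) fβ₂) (begin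
          z′                                               ≡⟨ w≡ ⟩
          β₂ * e′ + u (α₂ ⊛ g i ⊞ β₂ ⊛ κ)                  ≡⟨ cong₂ (λ x y → x * e′ + u y) β₂≡cβ₁ (combination α₁ α₂ (g i) κ) ⟩
          (c * β₁) * e′ + u ((α₂ - c * α₁) ⊛ g i ⊞ c ⊛ (α₁ ⊛ g i ⊞ β₁ ⊛ κ)) ≡⟨ cong ((c * β₁) * e′ +_) (trans (u-⊞ _ _) (cong₂ _+_
              (trans (u-⊛ _ (g i)) (trans (cong (_* u (g i)) e) (zeroˡ _))) (u-⊛ c _))) ⟩
          (c * β₁) * e′ + (0# + c * u (α₁ ⊛ g i ⊞ β₁ ⊛ κ))
            ≡⟨ solve 4 (λ c β e u → (c :* β) :* e :+ (O :+ c :* u) := c :* (β :* e :+ u)) refl c β₁ e′ (u (α₁ ⊛ g i ⊞ β₁ ⊛ κ)) ⟩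
          c * (β₁ * e′ + u (α₁ ⊛ g i ⊞ β₁ ⊛ κ))            ≡⟨ cong (c *_) z≡ ⟨
          c * z                                            ∎)

    go : CommonPair (bPlane k) (bPlane k′) → k ≡ k′
    go (graph p _ p′ _ r≢0) = contradiction (D-not-graph (inj₂ k) p p′) r≢0
    go (mixed _ _ _ n n′ x≢0) = mixed-case n n′ x≢0
    go (vertical p n z≢0 p′ n′ ¬prop) = vertical-case (b-vertical k p) (b-vertical k′ n) z≢0 (b-vertical k p′) (b-vertical k′ n′) ¬prop

  D-separated : ∀ {k k′} → Common (dPlane k) (dPlane k′) → k ≡ k′
  D-separated {inj₁ i} {inj₁ k} common = cong inj₁ (a-separated common)
  D-separated {inj₁ i} {inj₂ k} common = contradiction common (a-b-separated {i} {k})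
  D-separated {inj₂ i} {inj₁ k} common = contradiction (Common-sym common) (a-b-separated {k} {i})
  D-separated {inj₂ i} {inj₂ k} common = cong inj₂ (b-separated common)

-- Arithmetic of the cardinalities.

module Sizes where
  open Data.Nat.Solver.+-*-Solver
  open import Data.Nat using (_+_; _*_; _^_)

  -- `m` is the number q⁴ - 1 of nonzero parameters d, specified by its successor to avoid truncated
  -- subtraction.
  size-C : ∀ q m → suc m ≡ q ^ 4 → m * q ^ 4 + (q * q + (q + 1)) * (q * q) ≡ q ^ 8 + q ^ 3 + q ^ 2
  size-C q m eq = begin
    m * q ^ 4 + (q * q + (q + 1)) * (q * q)
      ≡⟨ solve 2 (λ m q → m :* q :^ 4 :+ (q :* q :+ (q :+ con 1)) :* (q :* q) := (con 1 :+ m) :* q :^ 4 :+ q :^ 3 :+ q :^ 2) refl m q ⟩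
    suc m * q ^ 4 + q ^ 3 + q ^ 2
      ≡⟨ cong (λ s → s * q ^ 4 + q ^ 3 + q ^ 2) eq ⟩
    q ^ 4 * q ^ 4 + q ^ 3 + q ^ 2
      ≡⟨ cong (λ s → s + q ^ 3 + q ^ 2) (ℕ.^-distribˡ-+-* q 4 4) ⟨
    q ^ 8 + q ^ 3 + q ^ 2 ∎
    where open ≡-Reasoning

  size-D : ∀ q → (q * q + (q + 1)) + (q * q + (q + 1)) * (q * q) ≡ q ^ 4 + q ^ 3 + 2 * q ^ 2 + q + 1
  size-D = solve 1 (λ q → (q :* q :+ (q :+ con 1)) :+ (q :* q :+ (q :+ con 1)) :* (q :* q) :=
    q :^ 4 :+ q :^ 3 :+ con 2 :* q :^ 2 :+ q :+ con 1) refl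

  size-all : ∀ q → (q ^ 8 + q ^ 3 + q ^ 2) + (q ^ 4 + q ^ 3 + 2 * q ^ 2 + q + 1) ≡ q ^ 8 + q ^ 4 + 2 * q ^ 3 + 3 * q ^ 2 + q + 1
  size-all q = solve 5 (λ a b c d e → (a :+ b :+ c) :+ (d :+ b :+ con 2 :* c :+ e :+ con 1) :=
    a :+ d :+ con 2 :* b :+ con 3 :* c :+ e :+ con 1) refl (q ^ 8) (q ^ 3) (q ^ 2) (q ^ 4) q

-- Exhaustion, counting and the two codes.

module Codes (q : ℕ) (q-primePower : IsPrimePower q) (K : FiniteField (q ℕ.^ 4)) where

  open Augmentation q q-primePower K public
  open ≡-Reasoning

  CIndex : Set
  CIndex = GraphIndex ⊎ NIndex

  cPlane : CIndex → VSet
  cPlane = [ graphPlane , nPlane ]′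

  plane-C : ∀ i → Plane (cPlane i)
  plane-C (inj₁ _) = plane-Γ _ _
  plane-C (inj₂ (i , _)) = plane-N i _

  C-separated : ∀ {i k} → Common (cPlane i) (cPlane k) → i ≡ k
  C-separated {inj₁ i} {inj₁ k} common = cong inj₁ (graph-separated {i} {k} common)
  C-separated {inj₁ i} {inj₂ k} common = contradiction common (graph-n-separated {i} {k})
  C-separated {inj₂ i} {inj₁ k} common = contradiction (Common-sym common) (graph-n-separated {k} {i})
  C-separated {inj₂ i} {inj₂ k} common = cong inj₂ (n-separated {i} {k} common)

  C∈𝒞 : ∀ i → 𝒞 (cPlane i)
  C∈𝒞 (inj₁ ((d , d≢0) , a₁)) = inj₁ (d - φ a₁ , a₁ , not-ℛ , ≐-refl)
    where
    -- An arbitrary point; `a i` and `b i` supply independent elements of W at which the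
    -- coefficients can be compared.
    i : Point
    i = inj₂ (inj₂ tt)
    not-ℛ : ¬ InR (gmap (d - φ a₁) a₁)
    not-ℛ (r , gmap≡) = d≢0 (d-φa≡-φa⇒d≡0 (trans (proj₁ coefficients) (cong (λ r → - φ r) (sym (proj₂ coefficients)))))
      where
      agree : ∀ {v} → FqVec v → gmap (d - φ a₁) a₁ (comb v) ≡ gmap (- φ r) r (comb v)
      agree fv = trans (gmap≡ _ (comb-W fv)) (rmap≡gmap r _)
      coefficients = gmap≡⇒coefficients≡ (λ e → u-h≢0 i (trans (sym (u-h i)) e)) (agree (FqVec-a i)) (agree (FqVec-b i))
  C∈𝒞 (inj₂ k@(i , _)) = inj₂ (comb (a i) , comb (b i) , representative k , comb-W (FqVec-a i) , comb-W (FqVec-b i)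
    , (λ c d fc fd e → ab≡𝟎 i (independent (FqVec-ab i fc fd) (trans (comb-ab i c d) e))) , ≐-refl)

  -- For m and v in Z the product m × v is a multiple κ of the normal vector, so the change of r is
  -- absorbed by the T_Z-part, where κ is added to c.
  InN-shift : ∀ i {r r′ m} → FqVec m → h i ∙ m ≡ 0# → r ≡ r′ + comb m → ∀ w → InN i r w → InN i r′ w
  InN-shift i {r} {r′} {m} fm h∙m r≡ (x , y) (v , fv , h∙v , x≡ , c , fc , y≡) = v , fv , h∙v , x≡ , κ + c , Fq-+ fκ fc , (begin
    y                                           ≡⟨ y≡ ⟩
    rmap r x + c * u (h i)                      ≡⟨ cong (_+ c * u (h i)) (trans (cong (λ r → rmap r x) r≡) (rmap-+ˡ r′ (comb m) x)) ⟩
    (rmap r′ x + rmap (comb m) x) + c * u (h i)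
      ≡⟨ cong (λ t → (rmap r′ x + t) + c * u (h i)) (trans (cong (rmap (comb m)) x≡) (trans (rmap-comb fm fv)
                                                      (trans (cong u (orthogonal⇒⨯-parallel (h∙j≡1 i) h∙m h∙v)) (u-⊛ κ (h i))))) ⟩
    (rmap r′ x + κ * u (h i)) + c * u (h i)
      ≡⟨ solve 4 (λ x k c u → (x :+ k :* u) :+ c :* u := x :+ (k :+ c) :* u) refl (rmap r′ x) κ c (u (h i)) ⟩
    rmap r′ x + (κ + c) * u (h i)               ∎)
    where
    κ = m ⨯ v ∙ j i
    fκ = Fq-∙ (FqVec-⨯ fm fv) (FqVec-j i)

  -- The trace determines the multiple ρ of `e₀` that takes r into W, and pairing with `h i`
  -- determines the multiple σ of `j i` that takes the result into Z. What remains is removed by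
  -- `InN-shift`.
  InN-representative : ∀ i r → ∃ λ ρ → ∃ λ σ → InN i r ≐ InN i (representative (i , ρ , σ))
  InN-representative i r = go (span w-W)
    where
    ρ = Tr r * Tr e₀ ⁻¹
    fρ : Fq ρ
    fρ = Fq-* (Fq-Tr r) (Fq-⁻¹ Tr-e₀≢0 (Fq-Tr e₀))
    w = r - ρ * e₀
    w-W : W w
    w-W = Tr≡0⇒W (begin
      Tr (r - ρ * e₀)              ≡⟨ trans (Tr-+ r _) (cong (Tr r +_) (trans (Tr-neg _) (cong -_ (Tr-* fρ e₀)))) ⟩
      Tr r - ρ * Tr e₀             ≡⟨ solve 3 (λ r i e → r :- (r :* i) :* e := r :- e :* (i :* r)) refl (Tr r) (Tr e₀ ⁻¹) (Tr e₀) ⟩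
      Tr r - Tr e₀ * (Tr e₀ ⁻¹ * Tr r) ≡⟨ cong (λ t → Tr r - t) (x*[x⁻¹*y]≡y Tr-e₀≢0) ⟩
      Tr r - Tr r                  ≡⟨ -‿inverseʳ _ ⟩
      0#                           ∎)
    go : (∃ λ m → FqVec m × w ≡ comb m) → ∃ λ ρ → ∃ λ σ → InN i r ≐ InN i (representative (i , ρ , σ))
    go (m , fm , w≡) = (ρ , fρ) , (σ , fσ) , λ p → mk⇔ (InN-shift i fn h∙n r≡ p) (InN-shift i (FqVec-⊛ (Fq-neg Fq-1) fn) h∙-n r′≡ p)
      where
      σ = m ∙ h i
      fσ = Fq-∙ fm (FqVec-h i)
      n = m ⊟ σ ⊛ j i
      fn = FqVec-⊟ fm (FqVec-⊛ fσ (FqVec-j i))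
      r′ = ρ * e₀ + σ * comb (j i)
      h∙n : h i ∙ n ≡ 0#
      h∙n = begin
        h i ∙ n                        ≡⟨ ∙-comm (h i) n ⟩
        n ∙ h i                        ≡⟨ trans (∙-⊟ m _ (h i)) (cong (λ t → σ - t) (∙-⊛ σ (j i) (h i))) ⟩
        σ - σ * (j i ∙ h i)            ≡⟨ cong (λ t → σ - σ * t) (trans (∙-comm (j i) (h i)) (h∙j≡1 i)) ⟩
        σ - σ * 1#                     ≡⟨ trans (cong (λ t → σ - t) (*-identityʳ σ)) (-‿inverseʳ σ) ⟩
        0#                             ∎
      comb-n : comb n ≡ w - σ * comb (j i)
      comb-n = trans (comb-⊟ m _) (cong₂ _-_ (sym w≡) (comb-⊛ σ (j i)))
      r≡ : r ≡ r′ + comb n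
      r≡ = trans (solve 3 (λ r x y → r := (x :+ y) :+ ((r :- x) :- y)) refl r (ρ * e₀) (σ * comb (j i))) (cong (r′ +_) (sym comb-n))
      h∙-n : h i ∙ (- 1# ⊛ n) ≡ 0#
      h∙-n = trans (∙-comm (h i) _) (trans (∙-⊛ _ n (h i)) (trans (cong (- 1# *_) (trans (∙-comm n (h i)) h∙n)) (zeroʳ _)))
      r′≡ : r′ ≡ r + comb (- 1# ⊛ n)
      r′≡ = trans (solve 2 (λ r n → r := (r :+ n) :+ (:- con (ℤ.+ 1)) :* n) refl r′ (comb n)) (cong₂ _+_ (sym r≡) (sym (comb-⊛ (- 1#) n)))

  cover : ∀ P → 𝒞 P → ∃ λ i → P ≐ cPlane i
  cover P (inj₁ (a₀ , a₁ , not-ℛ , P≐)) = inj₁ ((a₀ + φ a₁ , d≢0) , a₁)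
    , subst (λ a₀ → P ≐ Γ (gmap a₀ a₁)) (solve 2 (λ x y → x := (x :+ y) :- y) refl a₀ (φ a₁)) P≐
    where
    d≢0 : a₀ + φ a₁ ≢ 0#
    d≢0 e = not-ℛ (a₁ , λ x _ → trans (cong (λ a₀ → gmap a₀ a₁ x)
      (trans (solve 2 (λ x y → x := (x :+ y) :- y) refl a₀ (φ a₁)) (trans (cong (_- φ a₁) e) (+-identityˡ _)))) (sym (rmap≡gmap a₁ x)))
  cover P (inj₂ (α , β , r , wα , wβ , ind , P≐)) = go (span wα) (span wβ)
    where
    r≢0 : rmap α β ≢ 0#
    r≢0 e = finish (rmap≡0⇒proportional α≢0 e)
      where
      α≢0 : α ≢ 0#
      α≢0 α≡0 = 0≢1 (sym (proj₁ (ind 1# 0# Fq-1 Fq-0 (trans (cong (λ α → 1# * α + 0# * β) α≡0)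
        (solve 1 (λ b → con (ℤ.+ 1) :* con (ℤ.+ 0) :+ con (ℤ.+ 0) :* b := con (ℤ.+ 0)) refl β)))))
      finish : ¬ (∃ λ c → Fq c × β ≡ c * α)
      finish (c , fc , β≡) = 0≢1 (sym (proj₂ (ind (- c) 1# (Fq-neg fc) Fq-1 (trans (cong (λ β → - c * α + 1# * β) β≡)
        (solve 2 (λ c a → (:- c) :* a :+ con (ℤ.+ 1) :* (c :* a) := con (ℤ.+ 0)) refl c α)))))
    go : (∃ λ v → FqVec v × α ≡ comb v) → (∃ λ v → FqVec v × β ≡ comb v) → ∃ λ i → P ≐ cPlane i
    go (v₁ , f₁ , α≡) (v₂ , f₂ , β≡) = go′ (normalise (FqVec-⨯ f₁ f₂) λ e → r≢0
        (trans (cong₂ rmap α≡ β≡) (trans (rmap-comb f₁ f₂) (trans (cong u (trans e (sym (⊛-zeroˡ 𝟎)))) (trans (u-⊛ 0# 𝟎) (zeroˡ _))))))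
      where
      go′ : (∃ λ i → ∃ λ c → Fq c × c ≢ 0# × v₁ ⨯ v₂ ≡ c ⊛ h i) → ∃ λ i → P ≐ cPlane i
      -- The index is the point of PG(2,q) given by v₁ × v₂, the normal vector of Z.
      go′ (i , c , fc , c≢0 , v₁⨯v₂≡) = let (ρ , σ , shift) = InN-representative i r in inj₂ (i , ρ , σ) ,
        ≐-trans (subst (λ (α , β) → P ≐ N (Span₂ α β) (Line (rmap α β)) (rmap r)) (cong₂ _,_ α≡ β≡) P≐)
          (≐-trans (N≐InN i r f₁ f₂ fc c≢0 v₁⨯v₂≡) (≐-trans shift (≐-sym (N⇔InN i _))))

  AllIndex : Set
  AllIndex = CIndex ⊎ DIndex

  allPlane : AllIndex → VSet
  allPlane = [ cPlane , dPlane ]′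

  plane-all : ∀ i → Plane (allPlane i)
  plane-all (inj₁ i) = plane-C i
  plane-all (inj₂ k) = plane-D k

  C-D-separated : ∀ {i k} → ¬ Common (cPlane i) (dPlane k)
  C-D-separated {inj₁ i} {k} = graph-D-separated {i} {k}
  C-D-separated {inj₂ i} {k} = n-D-separated {i} {k}

  all-separated : ∀ {i k} → Common (allPlane i) (allPlane k) → i ≡ k
  all-separated {inj₁ i} {inj₁ k} common = cong inj₁ (C-separated {i} {k} common)
  all-separated {inj₁ i} {inj₂ k} common = contradiction common (C-D-separated {i} {k})
  all-separated {inj₂ i} {inj₁ k} common = contradiction (Common-sym common) (C-D-separated {k} {i})
  all-separated {inj₂ i} {inj₂ k} common = cong inj₂ (D-separated {i} {k} common)

  -- Membership would make the plane equal to some `cPlane i`, with which it would then share a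
  -- 2-dimensional space.
  D∉𝒞 : ∀ k → ¬ 𝒞 (dPlane k)
  D∉𝒞 k p = let (i , D≐) = cover (dPlane k) p in C-D-separated {i} {k} (Common-sym (≐⇒Common (plane-D k) D≐))

  -- Adjoining zero again gives a bijection with K, and comparing the two finite counts yields the
  -- successor equation for m.
  count-nonzero : ∃ λ m → suc m ≡ q ℕ.^ 4 × (Fin m ↔ Σ Carrier (_≢ 0#))
  count-nonzero = m , ↔⇒≡ (↔-sym count-K ↔-∘ with-zero) , count
    where
    some = subtype-count count-K (λ x → ¬? (x ≟ 0#)) (λ _ _ → refl)
    m = proj₁ some
    count = proj₂ some
    classify : ∀ x → Dec (x ≡ 0#) → ⊤ ⊎ Σ Carrier (_≢ 0#)
    classify x (yes _) = inj₁ tt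
    classify x (no x≢0) = inj₂ (x , x≢0)
    forget : ⊤ ⊎ Σ Carrier (_≢ 0#) → Carrier
    forget (inj₁ _) = 0#
    forget (inj₂ (x , _)) = x
    forget-classify : ∀ x d → forget (classify x d) ≡ x
    forget-classify x (yes x≡0) = sym x≡0
    forget-classify x (no _) = refl
    classify-forget : ∀ s d → classify (forget s) d ≡ s
    classify-forget (inj₁ tt) (yes _) = refl
    classify-forget (inj₁ tt) (no 0≢0) = contradiction refl 0≢0
    classify-forget (inj₂ (x , x≢0)) (yes x≡0) = contradiction x≡0 x≢0
    classify-forget (inj₂ (x , x≢0)) (no _) = refl
    with-zero : Fin (1 ℕ.+ m) ↔ Carrier
    with-zero = mk↔ₛ′ forget (λ x → classify x (x ≟ 0#)) (λ x → forget-classify x (x ≟ 0#)) (λ s → classify-forget s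
        (forget s ≟ 0#)) ↔-∘ (Fin.1↔⊤ ⊎-count count)

  count-N : Fin ((q ℕ.* q ℕ.+ (q ℕ.+ 1)) ℕ.* (q ℕ.* q)) ↔ NIndex
  count-N = count-Point ×-count count-𝔽 ×-count count-𝔽

  count-C : Fin (q ℕ.^ 8 ℕ.+ q ℕ.^ 3 ℕ.+ q ℕ.^ 2) ↔ CIndex
  count-C = let (m , 1+m≡q⁴ , count) = count-nonzero in
    subst (λ s → Fin s ↔ CIndex) (Sizes.size-C q m 1+m≡q⁴) ((count ×-count count-K) ⊎-count count-N)

  count-D : Fin (q ℕ.^ 4 ℕ.+ q ℕ.^ 3 ℕ.+ 2 ℕ.* q ℕ.^ 2 ℕ.+ q ℕ.+ 1) ↔ DIndex
  count-D = subst (λ s → Fin s ↔ DIndex) (Sizes.size-D q) (count-Point ⊎-count count-N)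

  count-all : Fin (q ℕ.^ 8 ℕ.+ q ℕ.^ 4 ℕ.+ 2 ℕ.* q ℕ.^ 3 ℕ.+ 3 ℕ.* q ℕ.^ 2 ℕ.+ q ℕ.+ 1) ↔ AllIndex
  count-all = subst (λ s → Fin s ↔ AllIndex) (Sizes.size-all q) (count-C ⊎-count count-D)

  D : Fin (q ℕ.^ 4 ℕ.+ q ℕ.^ 3 ℕ.+ 2 ℕ.* q ℕ.^ 2 ℕ.+ q ℕ.+ 1) → VSet
  D = dPlane ∘ Inverse.to count-D

  all∈ : ∀ i → augment D (allPlane i)
  all∈ (inj₁ i) = inj₁ (C∈𝒞 i)
  all∈ (inj₂ k) = inj₂ (Inverse.from count-D k , subst (λ l → dPlane k ≐ dPlane l) (sym (Inverse.strictlyInverseˡ count-D k)) ≐-refl)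

  all-cover : ∀ P → augment D P → ∃ λ i → P ≐ allPlane i
  all-cover P (inj₁ p) = let (i , P≐) = cover P p in inj₁ i , P≐
  all-cover P (inj₂ (k , P≐)) = inj₂ (Inverse.to count-D k) , P≐

  module 𝒞-Code = IndexedCode count-C cPlane plane-C (λ {i} {k} → C-separated {i} {k}) 𝒞 C∈𝒞 cover
  module 𝒞̂-Code = IndexedCode count-all allPlane plane-all (λ {i} {k} → all-separated {i} {k}) (augment D) all∈ all-cover

open import Data.Nat using (_+_; _*_; _^_)

theorem4p2 : (q : ℕ) → IsPrimePower q → (K : FiniteField (q ^ 4)) →
    let open Construction K q in
    (IsPlaneCode 𝒞 × HasSize 𝒞 (q ^ 8 + q ^ 3 + q ^ 2))
    × Σ (Fin (q ^ 4 + q ^ 3 + 2 * q ^ 2 + q + 1) → VSet) (λ D →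
    (∀ i → Plane (D i))
    × (∀ i → IsSubspaceOfDim (D i ∩ S) 2)
    × (∀ i → ¬ 𝒞 (D i))
    × IsPlaneCode (augment D)
    × HasSize (augment D) (q ^ 8 + q ^ 4 + 2 * q ^ 3 + 3 * q ^ 2 + q + 1))
theorem4p2 q q-primePower K = (𝒞-Code.isPlaneCode , 𝒞-Code.hasSize)
  , D , (λ i → plane-D (to i)) , (λ i → D∩S (to i)) , (λ i → D∉𝒞 (to i)) , 𝒞̂-Code.isPlaneCode , 𝒞̂-Code.hasSize
  where
  open Codes q q-primePower K
  to = Inverse.to count-D
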